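{- Let $k_1,\ldots,k_n\ge 2$ be integers, let $G=[0,k_1-1]\times\cdots\times[0,k_n-1]\subseteq\mathbb{R}^n$ and $N=\sum_{i=1}^n(k_i-1)$. Let $d\in[0,N]$ and $E\subseteq[0,N]$, and write \[ [0,d]\setminus E=\{t_\ell<\cdots<t_1\},\qquad E\setminus[0,d]=\{w_1<\cdots<w_r\}. \] Then \[ \mathrm{H}_d(\underline{E})=\sum_{w\in E\cap[0,d]}\genfrac{[}{]}{0pt}{}{G}{w}+\sum_{j=1}^{\min\{\ell,r\}}\min\bigg\{\genfrac{[}{]}{0pt}{}{G}{t_j},\genfrac{[}{]}{0pt}{}{G}{w_j}\bigg\}. \]
   Context: For integers $a\le b$, $[a,b]$ denotes the set of integers between $a$ and $b$. For $x\in G$, $\mathrm{wt}(x)=\sum_i x_i$. For a set of integers $F$, $\underline{F}=\{x\in G:\mathrm{wt}(x)\in F\}$, $\underline{j}=\underline{\{j\}}$, and $\genfrac{[}{]}{0pt}{}{G}{F}=|\underline{F}|$. For $A\subseteq\mathbb{R}^n$, $V(A)$ is the real vector space of all functions $A\to\mathbb{R}$, $V_d(A)$ is the subspace of functions admitting a representation by a real polynomial of degree at most $d$, and $\mathrm{H}_d(A)=\dim V_d(A)$ (the affine Hilbert function over $\mathbb{R}$).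
   Formalization: V_d(A) and its dimension H_d are taken over the rationals (rational polynomials and scalars) instead of the reals; since the points are integral, the rank of the monomial evaluation matrix, hence H_d, is the same. -}

module Defs where

open import Data.Nat as ℕ using (ℕ; zero; suc; _≤_; _⊓_; _≡ᵇ_; _∸_)
open import Data.Bool using (Bool; true; false; not)
open import Data.List as L using (List; []; _∷_; upTo; concatMap; map; filterᵇ; length; reverse; zipWith; applyUpTo)
open import Data.Bool.ListAction using (any)
open import Data.Nat.ListAction using (sum)
open import Data.List.Membership.Propositional using (_∈_)
open import Data.List.Relation.Unary.All using (All)
open import Data.Vec as V using (Vec; []; _∷_)
open import Data.Fin using (Fin)
open import Data.Product using (_×_; _,_; Σ)
open import Data.Rational as Q using (ℚ; 0ℚ; 1ℚ)
open import Data.Integer using (+_)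
open import Relation.Binary.PropositionalEquality using (_≡_)
open import Relation.Nullary using (¬_)
open import Relation.Nullary.Decidable using (does)

wt : ∀ {n} → Vec ℕ n → ℕ
wt = V.sum

grid : ∀ {n} → Vec ℕ n → List (Vec ℕ n)
grid [] = [] ∷ []
grid (k ∷ ks) = concatMap (λ a → map (a ∷_) (grid ks)) (upTo k)

N : ∀ {n} → Vec ℕ n → ℕ
N ks = V.sum (V.map (λ k → k ∸ 1) ks)

_∈ᵇ_ : ℕ → List ℕ → Bool
t ∈ᵇ E = any (t ≡ᵇ_) E

layer : ∀ {n} → Vec ℕ n → ℕ → ℕ
layer ks w = length (filterᵇ (λ x → does (wt x ℕ.≟ w)) (grid ks))

InLayers : ∀ {n} → Vec ℕ n → List ℕ → Vec ℕ n → Set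
InLayers ks E x = (x ∈ grid ks) × (wt x ∈ᵇ E ≡ true)

Poly : ℕ → Set
Poly n = List (ℚ × Vec ℕ n)   -- list of (coefficient, exponent vector)

DegLe : ∀ {n} → ℕ → Poly n → Set
DegLe d p = All (λ ce → wt (Data.Product.proj₂ ce) ≤ d) p

_^ℚ_ : ℚ → ℕ → ℚ
q ^ℚ zero = 1ℚ
q ^ℚ suc m = q Q.* (q ^ℚ m)

monoEval : ∀ {n} → Vec ℕ n → Vec ℕ n → ℚ
monoEval [] [] = 1ℚ
monoEval (e ∷ es) (x ∷ xs) = ((+ x Q./ 1) ^ℚ e) Q.* monoEval es xs

evalP : ∀ {n} → Poly n → Vec ℕ n → ℚ
evalP [] x = 0ℚ
evalP ((c , e) ∷ p) x = c Q.* monoEval e x Q.+ evalP p x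

sumFin : (m : ℕ) → (Fin m → ℚ) → ℚ
sumFin zero f = 0ℚ
sumFin (suc m) f = f Fin.zero Q.+ sumFin m (λ j → f (Fin.suc j))
  where import Data.Fin as Fin

LinIndepOn : ∀ {n} → (Vec ℕ n → Set) → (m : ℕ) → (Fin m → Poly n) → Set
LinIndepOn {n} A m f =
  (c : Fin m → ℚ) →
  ((x : Vec ℕ n) → A x → sumFin m (λ j → c j Q.* evalP (f j) x) ≡ 0ℚ) →
  (j : Fin m) → c j ≡ 0ℚ

HasIndep : ∀ {n} → ℕ → (Vec ℕ n → Set) → ℕ → Set
HasIndep d A m = Σ (Fin m → Poly _) λ f → ((j : Fin m) → DegLe d (f j)) × LinIndepOn A m f

-- H_d(A) = h : dim V_d(A) = h, i.e. the maximal size of a linearly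
-- independent family in V_d(A) is h.
HilbertDim : ∀ {n} → ℕ → (Vec ℕ n → Set) → ℕ → Set
HilbertDim d A h = HasIndep d A h × ¬ HasIndep d A (suc h)

tList : ℕ → List ℕ → List ℕ
tList d E = reverse (filterᵇ (λ t → not (t ∈ᵇ E)) (upTo (suc d)))

-- E \ [0,d] listed as w₁ < ... < w_r  (E ⊆ [0,N])
wList : ℕ → ℕ → List ℕ → List ℕ
wList Nn d E = filterᵇ (λ w → w ∈ᵇ E) (applyUpTo (λ i → suc d ℕ.+ i) (Nn ∸ d))

capList : ℕ → List ℕ → List ℕ
capList d E = filterᵇ (λ w → w ∈ᵇ E) (upTo (suc d))

rhs : ∀ {n} → Vec ℕ n → ℕ → List ℕ → ℕ
rhs ks d E =
  sum (map (layer ks) (capList d E)) ℕ.+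
  sum (zipWith (λ t w → layer ks t ⊓ layer ks w) (tList d E) (wList (N ks) d E))

{-# OPTIONS --safe #-}

-- The functions on the grid split like a tensor product of sl₂-representations into chains: there are
-- polynomials h_c of degree i_c, vanishing on the grid off the layers of weight in I_c = [i_c, N - i_c], such
-- that the h_c with w ∈ I_c restrict to a basis of the functions on the layer of weight w. For two factors they
-- are Hahn polynomials, and in general iterated products of these. Every polynomial of degree at most d agrees
-- on the grid with some Σ_c h_c q_c(wt) where deg q_c ≤ d - i_c, so that, by interpolation in the weight,
-- H_d(E) = Σ_c min(max(d + 1 - i_c, 0), |E ∩ I_c|). Since [w] = #{c : w ∈ I_c} and the intervals I_c are nested,
-- min([t], [w]) counts the chains containing both t and w, and the formula follows chain by chain.

module Submission where

open import Defs
open import Data.Bool using (Bool; true; false; not; T; T?; if_then_else_)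
open import Data.Bool.Properties using (T-≡)
open import Data.Empty using (⊥)
open import Data.Fin using (Fin; zero; suc; punchIn)
import Data.Fin.Properties as Fin
import Data.Integer as ℤ
import Data.Integer.Properties as ℤ
open import Data.List as List using (List; []; _∷_; _++_; map; concatMap; upTo; downFrom; applyUpTo; filter; filterᵇ; length; lookup; reverse; zipWith)
open import Data.List.Membership.Propositional using (_∈_; lose; find)
open import Data.List.Membership.Propositional.Properties using (∈-concatMap⁺; ∈-concatMap⁻; ∈-map⁺; ∈-map⁻; ∈-upTo⁺; ∈-upTo⁻; ∈-filter⁺; ∈-filter⁻; ∈-++⁺ˡ; ∈-++⁺ʳ; ∈-++⁻; ∈-applyUpTo⁺; ∈-applyUpTo⁻; ∈-downFrom⁻; ∈-lookup)
import Data.List.Properties as List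
import Data.List.Relation.Unary.All as All
open import Data.List.Relation.Unary.All using (All; []; _∷_)
import Data.List.Relation.Unary.All.Properties as All
import Data.List.Relation.Unary.AllPairs as AllPairs
open import Data.List.Relation.Unary.AllPairs using (AllPairs; []; _∷_)
import Data.List.Relation.Unary.AllPairs.Properties as AllPairs
open import Data.List.Relation.Unary.Any using (here; there)
open import Data.List.Relation.Unary.Unique.Propositional using (Unique)
import Data.List.Relation.Unary.Unique.Propositional.Properties as Unique
open import Data.Nat as ℕ using (ℕ; zero; suc; _≤_; _<_; _∸_; _⊓_; z≤n; s≤s; s≤s⁻¹)
open import Data.Nat.Induction using (<-rec)
open import Data.Nat.ListAction using (sum)
open import Data.Nat.ListAction.Properties using (sum-++)
import Data.Nat.Properties as ℕ
open import Data.Nat.Tactic.RingSolver using () renaming (solve-∀ to ℕ-solve-∀)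
open import Data.Product using (∃; _×_; _,_; proj₁; proj₂)
open import Data.Rational as ℚ using (ℚ; 0ℚ; 1ℚ; _+_; _*_; -_; _-_; Positive)
import Data.Rational.Properties as ℚ
import Data.Rational.Unnormalised as ℚᵘ
import Data.Rational.Unnormalised.Properties as ℚᵘ
open import Data.Sum using (_⊎_; inj₁; inj₂)
open import Data.Vec as Vec using (Vec; []; _∷_)
import Data.Vec.Functional as Vector
import Data.Vec.Functional.Properties as Vector
import Data.Vec.Properties as Vec
import Data.Vec.Relation.Unary.All as VAll
open import Function using (_∘_; id)
open import Function.Bundles using (Equivalence)
open import Level using (0ℓ)
open import Relation.Binary.Definitions using (tri<; tri≈; tri>)
open import Relation.Binary.PropositionalEquality
open import Relation.Nullary using (¬_; Dec; yes; no; does; contradiction; dec⇒maybe)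
open import Relation.Nullary.Decidable using (¬?; decidable-stable; _×-dec_)
open import Tactic.RingSolver using (solve-∀)
open import Tactic.RingSolver.Core.AlmostCommutativeRing using (AlmostCommutativeRing; fromCommutativeRing)

open ≡-Reasoning

-- Two properties of the Hahn polynomials carry the proof: on each line of constant sum s in [0,M] ×
-- [0,K] the r-th one has degree exactly r in the second coordinate y, and it vanishes where s < r
-- or s > M + K - r. Umbrally both are read off (y - x)^r. With x = s - y all terms have positive
-- top coefficients in y, so none cancel; writing y - x as (1 - x) y - x (1 - y) puts r falling
-- factors at each end of the range of s. The obstacle is the degree. Bases of the single layers
-- would allow arbitrary coefficients on each layer, whereas H_d needs coefficients polynomial in
-- the weight, of degree at most d - i_c. Hence spanning is proved for polynomials: y^j is reduced
-- triangularly with the total degree under control, and coordinates are added one at a time. In the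
-- final count, a chain crossing d meets initial segments of t_1 > t_2 > ... and of w_1 < w_2 < ...,
-- so the number of j with t_j and w_j both on it is the smaller of the two counts. Adding the
-- weights of E up to d gives its rank, because d + 1 - i_c counts all its weights up to d.

ℚ-ring : AlmostCommutativeRing 0ℓ 0ℓ
ℚ-ring = fromCommutativeRing ℚ.+-*-commutativeRing λ x → dec⇒maybe (0ℚ ℚ.≟ x)

opaque

  ι : ℕ → ℚ
  ι n = ℤ.+ n ℚ./ 1

  ι-suc : ∀ n → ι (suc n) ≡ 1ℚ + ι n
  ι-suc n = ℚ.toℚᵘ-injective
    (ℚᵘ.≃-trans (ℚ.toℚᵘ-fromℚᵘ _)
    (ℚᵘ.≃-trans {i = ℚᵘ.mkℚᵘ (ℤ.+ suc n) 0} {j = ℚᵘ.1ℚᵘ ℚᵘ.+ ℚᵘ.mkℚᵘ (ℤ.+ n) 0} (ℚᵘ.*≡* (cong (λ k → (ℤ.+ 1 ℤ.+ k) ℤ.* ℤ.+ 1) (sym (ℤ.*-identityʳ (ℤ.+ n)))))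
    (ℚᵘ.≃-trans (ℚᵘ.+-congʳ ℚᵘ.1ℚᵘ (ℚᵘ.≃-sym (ℚ.toℚᵘ-fromℚᵘ (ℚᵘ.mkℚᵘ (ℤ.+ n) 0))))
    (ℚᵘ.≃-sym (ℚ.toℚᵘ-homo-+ 1ℚ (ι n))))))

  ι-suc-positive : ∀ n → Positive (ι (suc n))
  ι-suc-positive n = ℚ.normalize-pos (suc n) 1

  ι-+ : ∀ m n → ι (m ℕ.+ n) ≡ ι m + ι n
  ι-+ zero    n = sym (ℚ.+-identityˡ (ι n))
  ι-+ (suc m) n = begin
    ι (suc m ℕ.+ n)     ≡⟨ ι-suc (m ℕ.+ n) ⟩
    1ℚ + ι (m ℕ.+ n)    ≡⟨ cong (1ℚ +_) (ι-+ m n) ⟩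
    1ℚ + (ι m + ι n)    ≡⟨ ℚ.+-assoc 1ℚ (ι m) (ι n) ⟨
    1ℚ + ι m + ι n      ≡⟨ cong (_+ ι n) (ι-suc m) ⟨
    ι (suc m) + ι n     ∎

x+y-x≡y : ∀ a b → a + b - a ≡ b
x+y-x≡y = solve-∀ ℚ-ring

ι-∸ : ∀ {m n} → m ≤ n → ι (n ∸ m) ≡ ι n - ι m
ι-∸ {m} {n} m≤n = begin
  ι (n ∸ m)                ≡⟨ x+y-x≡y (ι m) _ ⟨
  ι m + ι (n ∸ m) - ι m    ≡⟨ cong (_- ι m) (ι-+ m (n ∸ m)) ⟨
  ι (m ℕ.+ (n ∸ m)) - ι m  ≡⟨ cong (λ k → ι k - ι m) (ℕ.m+[n∸m]≡n m≤n) ⟩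
  ι n - ι m                ∎

ι-<-positive : ∀ {m n} → m < n → Positive (ι n - ι m)
ι-<-positive {m} {n} m<n = subst Positive (ι-∸ (ℕ.<⇒≤ m<n)) (go (n ∸ m) (ℕ.m<n⇒0<n∸m m<n))
  where
  go : ∀ k → 0 < k → Positive (ι k)
  go (suc k) _ = ι-suc-positive k

positive≢0 : ∀ {q} → Positive q → q ≢ 0ℚ
positive≢0 () refl

x-y≡0⇒x≡y : ∀ {x y} → x - y ≡ 0ℚ → x ≡ y
x-y≡0⇒x≡y {x} {y} eq = trans (expand x y) (trans (cong (_+ y) eq) (ℚ.+-identityˡ y))
  where
  expand : ∀ x y → x ≡ x - y + y
  expand = solve-∀ ℚ-ring

ι-injective : ∀ {m n} → ι m ≡ ι n → m ≡ n
ι-injective {m} {n} eq with ℕ.<-cmp m n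
... | tri< m<n _ _ = contradiction (trans (cong (_- ι m) (sym eq)) (ℚ.+-inverseʳ (ι m))) (positive≢0 (ι-<-positive m<n))
... | tri≈ _ m≡n _ = m≡n
... | tri> _ _ n<m = contradiction (trans (cong (_- ι n) eq) (ℚ.+-inverseʳ (ι n))) (positive≢0 (ι-<-positive n<m))

*≡0⇒≡0 : ∀ {p q} → p ≢ 0ℚ → p * q ≡ 0ℚ → q ≡ 0ℚ
*≡0⇒≡0 {p} {q} p≢0 pq≡0 = begin
  q                ≡⟨ ℚ.*-identityˡ q ⟨
  1ℚ * q           ≡⟨ cong (_* q) (ℚ.*-inverseˡ p) ⟨
  ℚ.1/ p * p * q   ≡⟨ ℚ.*-assoc (ℚ.1/ p) p q ⟩
  ℚ.1/ p * (p * q) ≡⟨ cong (ℚ.1/ p *_) pq≡0 ⟩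
  ℚ.1/ p * 0ℚ      ≡⟨ ℚ.*-zeroʳ (ℚ.1/ p) ⟩
  0ℚ               ∎
  where instance _ = ℚ.≢-nonZero p≢0

*-zero : ∀ p {q} → q ≡ 0ℚ → p * q ≡ 0ℚ
*-zero p q≡0 = trans (cong (p *_) q≡0) (ℚ.*-zeroʳ p)

zero-* : ∀ {p} q → p ≡ 0ℚ → p * q ≡ 0ℚ
zero-* q p≡0 = trans (cong (_* q) p≡0) (ℚ.*-zeroˡ q)

-- Finite sums with values in ℚ

sumOver : ∀ {A : Set} → List A → (A → ℚ) → ℚ
sumOver []       f = 0ℚ
sumOver (x ∷ xs) f = f x + sumOver xs f

sumBelow : ℕ → (ℕ → ℚ) → ℚ
sumBelow zero    f = 0ℚ
sumBelow (suc m) f = sumBelow m f + f m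

module _ {A : Set} where

  sumOver-cong : ∀ (xs : List A) {f g} → (∀ {x} → x ∈ xs → f x ≡ g x) → sumOver xs f ≡ sumOver xs g
  sumOver-cong []       eq = refl
  sumOver-cong (x ∷ xs) eq = cong₂ _+_ (eq (here refl)) (sumOver-cong xs (eq ∘ there))

  sumOver-zero : ∀ (xs : List A) {f} → (∀ {x} → x ∈ xs → f x ≡ 0ℚ) → sumOver xs f ≡ 0ℚ
  sumOver-zero []       eq = refl
  sumOver-zero (x ∷ xs) eq = cong₂ _+_ (eq (here refl)) (sumOver-zero xs (eq ∘ there))

  sumOver-+ : ∀ (xs : List A) f g → sumOver xs (λ x → f x + g x) ≡ sumOver xs f + sumOver xs g
  sumOver-+ []       f g = refl
  sumOver-+ (x ∷ xs) f g = trans (cong (f x + g x +_) (sumOver-+ xs f g)) (interchange (f x) (g x) _ _)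
    where
    interchange : ∀ a b c d → a + b + (c + d) ≡ a + c + (b + d)
    interchange = solve-∀ ℚ-ring

  sumOver-*ˡ : ∀ (xs : List A) a f → sumOver xs (λ x → a * f x) ≡ a * sumOver xs f
  sumOver-*ˡ []       a f = sym (ℚ.*-zeroʳ a)
  sumOver-*ˡ (x ∷ xs) a f = trans (cong (a * f x +_) (sumOver-*ˡ xs a f)) (sym (ℚ.*-distribˡ-+ a (f x) _))

  sumOver-++ : ∀ (xs ys : List A) f → sumOver (xs ++ ys) f ≡ sumOver xs f + sumOver ys f
  sumOver-++ []       ys f = sym (ℚ.+-identityˡ _)
  sumOver-++ (x ∷ xs) ys f = trans (cong (f x +_) (sumOver-++ xs ys f)) (sym (ℚ.+-assoc (f x) _ _))

  sumOver-map : ∀ {B : Set} (g : B → A) xs f → sumOver (map g xs) f ≡ sumOver xs (f ∘ g)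
  sumOver-map g []       f = refl
  sumOver-map g (x ∷ xs) f = cong (f (g x) +_) (sumOver-map g xs f)

  sumOver-concatMap : ∀ {B : Set} (g : B → List A) xs f →
    sumOver (concatMap g xs) f ≡ sumOver xs (λ x → sumOver (g x) f)
  sumOver-concatMap g []       f = refl
  sumOver-concatMap g (x ∷ xs) f = trans (sumOver-++ (g x) (concatMap g xs) f) (cong (sumOver (g x) f +_) (sumOver-concatMap g xs f))

sumBelow-cong : ∀ m {f g} → (∀ {i} → i < m → f i ≡ g i) → sumBelow m f ≡ sumBelow m g
sumBelow-cong zero    eq = refl
sumBelow-cong (suc m) eq = cong₂ _+_ (sumBelow-cong m (λ i<m → eq (ℕ.m<n⇒m<1+n i<m))) (eq ℕ.≤-refl)

sumBelow-zero : ∀ m {f} → (∀ {i} → i < m → f i ≡ 0ℚ) → sumBelow m f ≡ 0ℚ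
sumBelow-zero zero    eq = refl
sumBelow-zero (suc m) eq = cong₂ _+_ (sumBelow-zero m (λ i<m → eq (ℕ.m<n⇒m<1+n i<m))) (eq ℕ.≤-refl)

sumBelow-+ : ∀ m f g → sumBelow m (λ i → f i + g i) ≡ sumBelow m f + sumBelow m g
sumBelow-+ zero    f g = refl
sumBelow-+ (suc m) f g = trans (cong (_+ (f m + g m)) (sumBelow-+ m f g)) (interchange (sumBelow m f) (sumBelow m g) (f m) (g m))
  where
  interchange : ∀ a b c d → a + b + (c + d) ≡ a + c + (b + d)
  interchange = solve-∀ ℚ-ring

sumBelow-*ˡ : ∀ m a f → sumBelow m (λ i → a * f i) ≡ a * sumBelow m f
sumBelow-*ˡ zero    a f = sym (ℚ.*-zeroʳ a)
sumBelow-*ˡ (suc m) a f = trans (cong (_+ a * f m) (sumBelow-*ˡ m a f)) (sym (ℚ.*-distribˡ-+ a _ (f m)))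

sumBelow-suc : ∀ m f → sumBelow (suc m) f ≡ f 0 + sumBelow m (f ∘ suc)
sumBelow-suc zero    f = trans (ℚ.+-identityˡ (f 0)) (sym (ℚ.+-identityʳ (f 0)))
sumBelow-suc (suc m) f = trans (cong (_+ f (suc m)) (sumBelow-suc m f)) (ℚ.+-assoc (f 0) _ _)

sumOver-applyUpTo : ∀ m (g : ℕ → ℕ) f → sumOver (applyUpTo g m) f ≡ sumBelow m (f ∘ g)
sumOver-applyUpTo zero    g f = refl
sumOver-applyUpTo (suc m) g f = trans (cong (f (g 0) +_) (sumOver-applyUpTo m (g ∘ suc) f)) (sym (sumBelow-suc m (f ∘ g)))

sumBelow-single : ∀ m {f j} → j < m → (∀ {i} → i ≢ j → f i ≡ 0ℚ) → sumBelow m f ≡ f j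
sumBelow-single (suc m) {f} {j} j<1+m eq with ℕ.m≤n⇒m<n∨m≡n (s≤s⁻¹ j<1+m)
... | inj₁ j<m = trans (cong₂ _+_ (sumBelow-single m j<m eq) (eq (ℕ.<⇒≢ j<m ∘ sym))) (ℚ.+-identityʳ (f j))
... | inj₂ refl = trans (cong (_+ f m) (sumBelow-zero m (λ i<m → eq (ℕ.<⇒≢ i<m)))) (ℚ.+-identityˡ (f m))

-- Linear algebra over ℚ

sumFin-cong : ∀ m {f g : Fin m → ℚ} → (∀ j → f j ≡ g j) → sumFin m f ≡ sumFin m g
sumFin-cong zero    eq = refl
sumFin-cong (suc m) eq = cong₂ _+_ (eq zero) (sumFin-cong m (eq ∘ suc))

sumFin-zero : ∀ m {f : Fin m → ℚ} → (∀ j → f j ≡ 0ℚ) → sumFin m f ≡ 0ℚ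
sumFin-zero zero    eq = refl
sumFin-zero (suc m) eq = cong₂ _+_ (eq zero) (sumFin-zero m (eq ∘ suc))

sumFin-linear : ∀ m a b (f g : Fin m → ℚ) →
  sumFin m (λ j → a * f j + b * g j) ≡ a * sumFin m f + b * sumFin m g
sumFin-linear zero    a b f g = trivial a b
  where
  trivial : ∀ a b → 0ℚ ≡ a * 0ℚ + b * 0ℚ
  trivial = solve-∀ ℚ-ring
sumFin-linear (suc m) a b f g = trans (cong (a * f zero + b * g zero +_) (sumFin-linear m a b (f ∘ suc) (g ∘ suc)))
  (rearrange a b (f zero) (g zero) _ _)
  where
  rearrange : ∀ a b x y u v → a * x + b * y + (a * u + b * v) ≡ a * (x + u) + b * (y + v)
  rearrange = solve-∀ ℚ-ring

sumFin-punchIn : ∀ m (f : Fin (suc m) → ℚ) i → sumFin (suc m) f ≡ f i + sumFin m (f ∘ punchIn i)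
sumFin-punchIn m       f zero    = refl
sumFin-punchIn (suc m) f (suc i) = trans (cong (f zero +_) (sumFin-punchIn m (f ∘ suc) i)) (swap (f zero) (f (suc i)) _)
  where
  swap : ∀ x y z → x + (y + z) ≡ y + (x + z)
  swap = solve-∀ ℚ-ring

sumFin-sumOver : ∀ {A : Set} m (c : Fin m → ℚ) (xs : List A) (f : Fin m → A → ℚ) →
  sumFin m (λ j → c j * sumOver xs (f j)) ≡ sumOver xs (λ x → sumFin m (λ j → c j * f j x))
sumFin-sumOver m c []       f = sumFin-zero m (λ j → ℚ.*-zeroʳ (c j))
sumFin-sumOver m c (x ∷ xs) f = begin
  sumFin m (λ j → c j * (f j x + sumOver xs (f j)))
    ≡⟨ sumFin-cong m (λ j → expand (c j) (f j x) _) ⟩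
  sumFin m (λ j → 1ℚ * (c j * f j x) + 1ℚ * (c j * sumOver xs (f j)))
    ≡⟨ sumFin-linear m 1ℚ 1ℚ _ _ ⟩
  1ℚ * sumFin m (λ j → c j * f j x) + 1ℚ * sumFin m (λ j → c j * sumOver xs (f j))
    ≡⟨ cong₂ _+_ (ℚ.*-identityˡ (sumFin m (λ j → c j * f j x))) (trans (ℚ.*-identityˡ (sumFin m (λ j → c j * sumOver xs (f j)))) (sumFin-sumOver m c xs f)) ⟩
  sumFin m (λ j → c j * f j x) + sumOver xs (λ x → sumFin m (λ j → c j * f j x)) ∎
  where
  expand : ∀ c x y → c * (x + y) ≡ 1ℚ * (c * x) + 1ℚ * (c * y)
  expand = solve-∀ ℚ-ring

-- Gaussian elimination, with `ps` indexing the equations and `Fin m` the unknowns. An equation with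
-- only zero entries costs one unknown, which is set to 0; any other equation has a pivot, which
-- eliminates one unknown.
nontrivial-kernel : ∀ {I : Set} (ps : List I) {m} → length ps < m → (a : Fin m → I → ℚ) →
  ∃ λ (c : Fin m → ℚ) → (∀ {p} → p ∈ ps → sumFin m (λ j → c j * a j p) ≡ 0ℚ) × ∃ λ j → c j ≢ 0ℚ
nontrivial-kernel []       {suc m} _   a = (λ _ → 1ℚ) , (λ ()) , zero , λ ()
nontrivial-kernel (p ∷ ps) {suc m} ps<m a with Fin.any? (λ j → ¬? (a j p ℚ.≟ 0ℚ))
... | no column≡0 with nontrivial-kernel ps (s≤s⁻¹ ps<m) (a ∘ suc)
...   | c , vanish , j , cj≢0 = Vector.insertAt c zero 0ℚ , vanish′ , suc j , cj≢0
  where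
  entry≡0 : ∀ j → a j p ≡ 0ℚ
  entry≡0 j = decidable-stable (a j p ℚ.≟ 0ℚ) (λ ajp≢0 → column≡0 (j , ajp≢0))
  vanish′ : ∀ {q} → q ∈ p ∷ ps → sumFin (suc m) (λ j → Vector.insertAt c zero 0ℚ j * a j q) ≡ 0ℚ
  vanish′ (here refl)  = sumFin-zero (suc m) (λ j → trans (cong (Vector.insertAt c zero 0ℚ j *_) (entry≡0 j)) (ℚ.*-zeroʳ (Vector.insertAt c zero 0ℚ j)))
  vanish′ {q} (there q∈ps) = cong₂ _+_ (ℚ.*-zeroˡ (a zero q)) (vanish q∈ps)
nontrivial-kernel (p ∷ ps) {suc m} ps<m a | yes (i , pivot≢0) with nontrivial-kernel ps (s≤s⁻¹ ps<m)
  (λ j q → a i p * a (punchIn i j) q - a (punchIn i j) p * a i q)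
... | c , vanish , j , cj≢0 = c′ , vanish′ , punchIn i j , c′j≢0
  where
  -- Since the other unknowns are scaled by the pivot, this value of the eliminated one solves
  -- equation p without a division.
  s : ℚ
  s = - sumFin m (λ j → c j * a (punchIn i j) p)
  c′ : Fin (suc m) → ℚ
  c′ = Vector.insertAt (λ j → a i p * c j) i s
  c′-punchIn : ∀ j → c′ (punchIn i j) ≡ a i p * c j
  c′-punchIn = Vector.insertAt-punchIn _ i s
  c′j≢0 : c′ (punchIn i j) ≢ 0ℚ
  c′j≢0 eq = cj≢0 (*≡0⇒≡0 pivot≢0 (trans (sym (c′-punchIn j)) eq))
  expand : ∀ x y c u v → y * (c * u) + - x * (c * v) ≡ c * (y * u - v * x)
  expand = solve-∀ ℚ-ring
  reduced : ∀ q → sumFin (suc m) (λ j → c′ j * a j q) ≡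
    sumFin m (λ j → c j * (a i p * a (punchIn i j) q - a (punchIn i j) p * a i q))
  reduced q = begin
    sumFin (suc m) (λ j → c′ j * a j q)
      ≡⟨ sumFin-punchIn m (λ j → c′ j * a j q) i ⟩
    c′ i * a i q + sumFin m (λ j → c′ (punchIn i j) * a (punchIn i j) q)
      ≡⟨ cong₂ (λ x y → x * a i q + y) (Vector.insertAt-lookup _ i s)
           (sumFin-cong m (λ j → trans (cong (_* a (punchIn i j) q) (c′-punchIn j)) (drop-0 (a i p) (c j) _ _))) ⟩
    s * a i q + sumFin m (λ j → a i p * (c j * a (punchIn i j) q) + 0ℚ * (c j * a (punchIn i j) p))
      ≡⟨ cong (s * a i q +_) (sumFin-linear m (a i p) 0ℚ _ _) ⟩
    s * a i q + (a i p * sumFin m (λ j → c j * a (punchIn i j) q) + 0ℚ * sumFin m (λ j → c j * a (punchIn i j) p))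
      ≡⟨ combine (a i q) (a i p) (sumFin m (λ j → c j * a (punchIn i j) p)) _ ⟩
    a i p * sumFin m (λ j → c j * a (punchIn i j) q) + - a i q * sumFin m (λ j → c j * a (punchIn i j) p)
      ≡⟨ sumFin-linear m (a i p) (- a i q) _ _ ⟨
    sumFin m (λ j → a i p * (c j * a (punchIn i j) q) + - a i q * (c j * a (punchIn i j) p))
      ≡⟨ sumFin-cong m (λ j → expand (a i q) (a i p) (c j) _ _) ⟩
    sumFin m (λ j → c j * (a i p * a (punchIn i j) q - a (punchIn i j) p * a i q)) ∎
    where
    drop-0 : ∀ y c u v → y * c * u ≡ y * (c * u) + 0ℚ * (c * v)
    drop-0 = solve-∀ ℚ-ring
    combine : ∀ x y S T → - S * x + (y * T + 0ℚ * S) ≡ y * T + - x * S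
    combine = solve-∀ ℚ-ring
  vanish′ : ∀ {q} → q ∈ p ∷ ps → sumFin (suc m) (λ j → c′ j * a j q) ≡ 0ℚ
  vanish′ (here refl) = trans (reduced p) (sumFin-zero m (λ j → cancel (c j) (a i p) (a (punchIn i j) p)))
    where
    cancel : ∀ c x y → c * (x * y - y * x) ≡ 0ℚ
    cancel = solve-∀ ℚ-ring
  vanish′ {q} (there q∈ps) = trans (reduced q) (vanish q∈ps)

dependent-of-small-span : ∀ {n m} {I : Set} {A : Vec ℕ n → Set} (f : Fin m → Poly n)
  (ps : List I) (b : I → Vec ℕ n → ℚ) → length ps < m →
  (∀ j → ∃ λ a → ∀ x → A x → evalP (f j) x ≡ sumOver ps (λ p → a p * b p x)) →
  ¬ LinIndepOn A m f
dependent-of-small-span {m = m} f ps b ps<m expand indep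
  with nontrivial-kernel ps ps<m (λ j → proj₁ (expand j))
... | c , vanish , j , cj≢0 = cj≢0 (indep c (λ x x∈A → begin
  sumFin m (λ j → c j * evalP (f j) x)
    ≡⟨ sumFin-cong m (λ j → cong (c j *_) (proj₂ (expand j) x x∈A)) ⟩
  sumFin m (λ j → c j * sumOver ps (λ p → proj₁ (expand j) p * b p x))
    ≡⟨ sumFin-sumOver m c ps _ ⟩
  sumOver ps (λ p → sumFin m (λ j → c j * (proj₁ (expand j) p * b p x)))
    ≡⟨ sumOver-zero ps (λ {p} p∈ps → begin
      sumFin m (λ j → c j * (proj₁ (expand j) p * b p x))
        ≡⟨ sumFin-cong m (λ j → rearrange (c j) (proj₁ (expand j) p) (b p x)) ⟩
      sumFin m (λ j → b p x * (c j * proj₁ (expand j) p) + 0ℚ * 0ℚ)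
        ≡⟨ sumFin-linear m (b p x) 0ℚ _ (λ _ → 0ℚ) ⟩
      b p x * sumFin m (λ j → c j * proj₁ (expand j) p) + 0ℚ * sumFin m (λ _ → 0ℚ)
        ≡⟨ cong (λ y → b p x * y + 0ℚ * sumFin m (λ _ → 0ℚ)) (vanish p∈ps) ⟩
      b p x * 0ℚ + 0ℚ * sumFin m (λ _ → 0ℚ)
        ≡⟨ zeros (b p x) (sumFin m (λ _ → 0ℚ)) ⟩
      0ℚ ∎) ⟩
  0ℚ ∎) j)
  where
  rearrange : ∀ c a b → c * (a * b) ≡ b * (c * a) + 0ℚ * 0ℚ
  rearrange = solve-∀ ℚ-ring
  zeros : ∀ a b → a * 0ℚ + 0ℚ * b ≡ 0ℚ
  zeros = solve-∀ ℚ-ring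

module _ {I : Set} (_≟_ : (p q : I) → Dec (p ≡ q)) where

  coefficient : (ps : List I) → (Fin (length ps) → ℚ) → I → ℚ
  coefficient []       c q = 0ℚ
  coefficient (p ∷ ps) c q with p ≟ q
  ... | yes _ = c zero
  ... | no  _ = coefficient ps (c ∘ suc) q

  coefficient-lookup : ∀ {ps} → Unique ps → ∀ c j → coefficient ps c (lookup ps j) ≡ c j
  coefficient-lookup {p ∷ ps} (p∉ps ∷ ps!) c zero with p ≟ p
  ... | yes _  = refl
  ... | no p≢p = contradiction refl p≢p
  coefficient-lookup {p ∷ ps} (p∉ps ∷ ps!) c (suc j) with p ≟ lookup ps j
  ... | yes p≡ = contradiction p≡ (All.lookup p∉ps (∈-lookup j))
  ... | no _   = coefficient-lookup ps! (c ∘ suc) j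

  sumFin-lookup : ∀ (ps : List I) (f : I → ℚ) → sumFin (length ps) (f ∘ lookup ps) ≡ sumOver ps f
  sumFin-lookup []       f = refl
  sumFin-lookup (p ∷ ps) f = cong (f p +_) (sumFin-lookup ps f)

  -- A passage between index sets: families in `HasIndep` are indexed by `Fin`, while independence
  -- is proved for coefficient functions on I. Uniqueness makes every `Fin` vector come from such a
  -- function.
  linIndepOn-lookup : ∀ {n} {A : Vec ℕ n → Set} {ps : List I} → Unique ps → (b : I → Vec ℕ n → ℚ) →
    (∀ (α : I → ℚ) → (∀ x → A x → sumOver ps (λ p → α p * b p x) ≡ 0ℚ) → ∀ {p} → p ∈ ps → α p ≡ 0ℚ) →
    (f : Fin (length ps) → Poly n) → (∀ j x → evalP (f j) x ≡ b (lookup ps j) x) →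
    LinIndepOn A (length ps) f
  linIndepOn-lookup {ps = ps} ps! b indep f f≡b c vanish j =
    trans (sym (coefficient-lookup ps! c j)) (indep α (λ x x∈A → begin
      sumOver ps (λ p → α p * b p x)
        ≡⟨ sumFin-lookup ps _ ⟨
      sumFin (length ps) (λ j → α (lookup ps j) * b (lookup ps j) x)
        ≡⟨ sumFin-cong (length ps) (λ j → cong₂ _*_ (coefficient-lookup ps! c j) (sym (f≡b j x))) ⟩
      sumFin (length ps) (λ j → c j * evalP (f j) x)
        ≡⟨ vanish x x∈A ⟩
      0ℚ ∎) (∈-lookup j))
    where
    α : I → ℚ
    α = coefficient ps c

-- Univariate polynomial functions

-- q is a polynomial function of degree at most D whose coefficient at x^D is a.
HasLead : ℕ → ℚ → (ℚ → ℚ) → Set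
HasLead zero    a q = ∀ x → q x ≡ a
HasLead (suc D) a q = ∃ λ b → ∃ λ q′ → HasLead D a q′ × (∀ x → q x ≡ b + x * q′ x)

-- Degree strictly less than D, so that DegBelow 0 only contains the zero function.
DegBelow : ℕ → (ℚ → ℚ) → Set
DegBelow D q = HasLead D 0ℚ q

hasLead-ext : ∀ D {a p q} → HasLead D a p → (∀ x → q x ≡ p x) → HasLead D a q
hasLead-ext zero    p≡a              q≡p = λ x → trans (q≡p x) (p≡a x)
hasLead-ext (suc D) (b , p′ , l , e) q≡p = b , p′ , l , λ x → trans (q≡p x) (e x)

hasLead-+ : ∀ D {a b p q} → HasLead D a p → HasLead D b q → HasLead D (a + b) (λ x → p x + q x)
hasLead-+ zero    p≡a q≡b = λ x → cong₂ _+_ (p≡a x) (q≡b x)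
hasLead-+ (suc D) (b , p′ , l , e) (c , q′ , k , f) =
  b + c , _ , hasLead-+ D l k , λ x → trans (cong₂ _+_ (e x) (f x)) (rearrange b c x (p′ x) (q′ x))
  where
  rearrange : ∀ b c x p q → b + x * p + (c + x * q) ≡ b + c + x * (p + q)
  rearrange = solve-∀ ℚ-ring

hasLead-*ˡ : ∀ D c {a p} → HasLead D a p → HasLead D (c * a) (λ x → c * p x)
hasLead-*ˡ zero    c p≡a = λ x → cong (c *_) (p≡a x)
hasLead-*ˡ (suc D) c (b , p′ , l , e) =
  c * b , _ , hasLead-*ˡ D c l , λ x → trans (cong (c *_) (e x)) (rearrange c b x (p′ x))
  where
  rearrange : ∀ c b x p → c * (b + x * p) ≡ c * b + x * (c * p)
  rearrange = solve-∀ ℚ-ring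

hasLead-x* : ∀ D {a p} → HasLead D a p → HasLead (suc D) a (λ x → x * p x)
hasLead-x* D {p = p} l = 0ℚ , p , l , λ x → sym (ℚ.+-identityˡ (x * p x))

hasLead⇒degBelow : ∀ D {a p} → HasLead D a p → DegBelow (suc D) p
hasLead⇒degBelow zero {a} p≡a = a , (λ _ → 0ℚ) , (λ _ → refl) , λ x → trans (p≡a x) (rearrange a x)
  where
  rearrange : ∀ a x → a ≡ a + x * 0ℚ
  rearrange = solve-∀ ℚ-ring
hasLead⇒degBelow (suc D) (b , p′ , l , e) = b , p′ , hasLead⇒degBelow D l , e

degBelow-+ : ∀ D {p q} → DegBelow D p → DegBelow D q → DegBelow D (λ x → p x + q x)
degBelow-+ D = hasLead-+ D

degBelow-*ˡ : ∀ D c {p} → DegBelow D p → DegBelow D (λ x → c * p x)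
degBelow-*ˡ D c {p} l = subst (λ a → HasLead D a (λ x → c * p x)) (ℚ.*-zeroʳ c) (hasLead-*ˡ D c l)

degBelow-weaken : ∀ {D D′ q} → D ≤ D′ → DegBelow D q → DegBelow D′ q
degBelow-weaken {D} {zero}   z≤n l = l
degBelow-weaken {D} {suc D′} D≤D′ l with ℕ.m≤n⇒m<n∨m≡n D≤D′
... | inj₁ D<D′ = hasLead⇒degBelow D′ (degBelow-weaken (s≤s⁻¹ D<D′) l)
... | inj₂ refl = l

degBelow-zero : ∀ D → DegBelow D (λ _ → 0ℚ)
degBelow-zero D = degBelow-weaken {0} {D} z≤n (λ _ → refl)

degBelow-constant : ∀ D a → DegBelow (suc D) (λ _ → a)
degBelow-constant D a = degBelow-weaken {1} {suc D} (s≤s z≤n) (hasLead⇒degBelow 0 {a} (λ _ → refl))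

hasLead-shift : ∀ D i {a p} → HasLead D a p → HasLead D a (λ x → p (x - i))
hasLead-shift zero    i p≡a = λ x → p≡a (x - i)
hasLead-shift (suc D) i {a} {p} (b , p′ , l , e) =
  subst (λ a → HasLead (suc D) a (λ x → p (x - i))) (ℚ.+-identityʳ a)
    (hasLead-ext (suc D)
      (hasLead-+ (suc D) (hasLead-x* D l′)
        (degBelow-+ (suc D) (degBelow-constant D b) (degBelow-*ˡ (suc D) (- i) (hasLead⇒degBelow D l′))))
      (λ x → trans (e (x - i)) (rearrange b x i (p′ (x - i)))))
  where
  l′ : HasLead D a (λ x → p′ (x - i))
  l′ = hasLead-shift D i l
  rearrange : ∀ b x i p → b + (x - i) * p ≡ x * p + (b + - i * p)
  rearrange = solve-∀ ℚ-ring

-- Synthetic division by x - e. The top coefficient passes unchanged to the quotient, so roots can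
-- be stripped one by one.
factor : ∀ D {a q} → HasLead (suc D) a q → ∀ e →
  ∃ λ q′ → HasLead D a q′ × (∀ x → q x ≡ q e + (x - e) * q′ x)
factor zero {a} {q} (b , p , p≡a , eq) e = p , p≡a , λ x → begin
  q x                        ≡⟨ eq x ⟩
  b + x * p x                ≡⟨ cong (λ y → b + x * y) (p≡a x) ⟩
  b + x * a                  ≡⟨ rearrange a b e x ⟩
  b + e * a + (x - e) * a    ≡⟨ cong₂ (λ y z → b + e * y + (x - e) * z) (p≡a e) (p≡a x) ⟨
  b + e * p e + (x - e) * p x ≡⟨ cong (_+ (x - e) * p x) (eq e) ⟨
  q e + (x - e) * p x        ∎
  where
  rearrange : ∀ a b e x → b + x * a ≡ b + e * a + (x - e) * a
  rearrange = solve-∀ ℚ-ring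
factor (suc D) {a} {q} (b , p , l , eq) e with factor D l e
... | p′ , l′ , eq′ = (λ x → p e + x * p′ x) , (p e , p′ , l′ , λ _ → refl) , λ x → begin
  q x
    ≡⟨ eq x ⟩
  b + x * p x
    ≡⟨ cong (λ y → b + x * y) (eq′ x) ⟩
  b + x * (p e + (x - e) * p′ x)
    ≡⟨ rearrange b e x (p e) (p′ x) ⟩
  b + e * p e + (x - e) * (p e + x * p′ x)
    ≡⟨ cong (_+ (x - e) * (p e + x * p′ x)) (eq e) ⟨
  q e + (x - e) * (p e + x * p′ x) ∎
  where
  rearrange : ∀ b e x y z → b + x * (y + (x - e) * z) ≡ b + e * y + (x - e) * (y + x * z)
  rearrange = solve-∀ ℚ-ring

-- Each division by a root lowers the degree and keeps the top coefficient. After D divisions the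
-- quotient is the constant a, and one root is left for it.
lead≡0 : ∀ D {a q} → HasLead D a q → (r : ℕ → ℚ) → (∀ {s t} → r s ≡ r t → s ≡ t) →
  (∀ {t} → t ≤ D → q (r t) ≡ 0ℚ) → a ≡ 0ℚ
lead≡0 zero    q≡a r _ root = trans (sym (q≡a (r 0))) (root z≤n)
lead≡0 (suc D) {a} {q} l r r-inj root with factor D l (r 0)
... | q′ , l′ , eq = lead≡0 D l′ (r ∘ suc) (ℕ.suc-injective ∘ r-inj) λ {t} t≤D →
  *≡0⇒≡0 {r (suc t) - r 0} (λ d≡0 → ℕ.1+n≢0 (r-inj (x-y≡0⇒x≡y d≡0))) (begin
    (r (suc t) - r 0) * q′ (r (suc t))         ≡⟨ ℚ.+-identityˡ _ ⟨
    0ℚ + (r (suc t) - r 0) * q′ (r (suc t))    ≡⟨ cong (_+ (r (suc t) - r 0) * q′ (r (suc t))) (root z≤n) ⟨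
    q (r 0) + (r (suc t) - r 0) * q′ (r (suc t)) ≡⟨ eq (r (suc t)) ⟨
    q (r (suc t))                              ≡⟨ root (s≤s t≤D) ⟩
    0ℚ                                         ∎)

newton : List ℕ → ℕ → ℚ → ℚ
newton es       zero    x = 1ℚ
newton []       (suc s) x = 0ℚ
newton (e ∷ es) (suc s) x = (x - ι e) * newton es s x

newton-degBelow : ∀ es s → DegBelow (suc s) (newton es s)
newton-degBelow es       zero    = degBelow-constant 0 1ℚ
newton-degBelow []       (suc s) = degBelow-zero (suc (suc s))
newton-degBelow (e ∷ es) (suc s) = hasLead-ext (suc (suc s))
  (degBelow-+ (suc (suc s)) (hasLead-x* (suc s) l) (degBelow-*ˡ (suc (suc s)) (- ι e) (hasLead⇒degBelow (suc s) l)))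
  (λ x → rearrange x (ι e) (newton es s x))
  where
  l : DegBelow (suc s) (newton es s)
  l = newton-degBelow es s
  rearrange : ∀ x e p → (x - e) * p ≡ x * p + - e * p
  rearrange = solve-∀ ℚ-ring

newtonSum : List ℕ → ℕ → (ℕ → ℚ) → ℚ → ℚ
newtonSum es m a x = sumBelow m (λ s → a s * newton es s x)

newtonSum-suc : ∀ e es m a x → newtonSum (e ∷ es) (suc m) a x ≡ a 0 + (x - ι e) * newtonSum es m (a ∘ suc) x
newtonSum-suc e es m a x = begin
  newtonSum (e ∷ es) (suc m) a x
    ≡⟨ sumBelow-suc m _ ⟩
  a 0 * 1ℚ + sumBelow m (λ s → a (suc s) * ((x - ι e) * newton es s x))
    ≡⟨ cong₂ _+_ (ℚ.*-identityʳ (a 0)) (sumBelow-cong m (λ {s} _ → swap (a (suc s)) (x - ι e) (newton es s x))) ⟩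
  a 0 + sumBelow m (λ s → (x - ι e) * (a (suc s) * newton es s x))
    ≡⟨ cong (a 0 +_) (sumBelow-*ˡ m (x - ι e) _) ⟩
  a 0 + (x - ι e) * newtonSum es m (a ∘ suc) x ∎
  where
  swap : ∀ a x p → a * (x * p) ≡ x * (a * p)
  swap = solve-∀ ℚ-ring

-- Splitting off the value at the first node leaves a quotient of smaller degree to interpolate at
-- the remaining nodes. The recursion ends when the degree or the nodes run out, whence the minimum.
newton-interpolate : ∀ D es {q} → DegBelow D q →
  ∃ λ a → ∀ {e} → e ∈ es → q (ι e) ≡ newtonSum es (D ⊓ length es) a (ι e)
newton-interpolate zero    es       q≡0 = (λ _ → 0ℚ) , λ {e} _ → q≡0 (ι e)
newton-interpolate (suc D) []       l   = (λ _ → 0ℚ) , λ ()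
newton-interpolate (suc D) (e ∷ es) {q} l with factor D l (ι e)
... | q′ , l′ , eq with newton-interpolate D es l′
...   | a , interp = b , at
  where
  b : ℕ → ℚ
  b zero    = q (ι e)
  b (suc s) = a s
  m : ℕ
  m = D ⊓ length es
  cancel : ∀ q e x y → q + (e - e) * x ≡ q + (e - e) * y
  cancel = solve-∀ ℚ-ring
  at : ∀ {f} → f ∈ e ∷ es → q (ι f) ≡ newtonSum (e ∷ es) (suc m) b (ι f)
  at (here refl) = trans (eq (ι e)) (trans (cancel (q (ι e)) (ι e) _ _) (sym (newtonSum-suc e es m b (ι e))))
  at {f} (there f∈es) = trans (eq (ι f)) (trans (cong (λ y → q (ι e) + (ι f - ι e) * y) (interp f∈es)) (sym (newtonSum-suc e es m b (ι f))))

-- The Newton polynomials are triangular at the nodes: the first node sees only `a 0`, and at the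
-- others the factor x - e can be cancelled because the nodes are distinct.
newton-independent : ∀ {es} → Unique es → ∀ m → m ≤ length es → ∀ a →
  (∀ {e} → e ∈ es → newtonSum es m a (ι e) ≡ 0ℚ) → ∀ {s} → s < m → a s ≡ 0ℚ
newton-independent {e ∷ es} (e∉es ∷ es!) (suc m) m<len a vanish = coefficients
  where
  a0≡0 : a 0 ≡ 0ℚ
  a0≡0 = trans (cancel (a 0) (ι e) (newtonSum es m (a ∘ suc) (ι e)))
    (trans (sym (newtonSum-suc e es m a (ι e))) (vanish (here refl)))
    where
    cancel : ∀ a e x → a ≡ a + (e - e) * x
    cancel = solve-∀ ℚ-ring
  tail-vanish : ∀ {f} → f ∈ es → newtonSum es m (a ∘ suc) (ι f) ≡ 0ℚ
  tail-vanish {f} f∈es = *≡0⇒≡0 {ι f - ι e}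
    (λ d≡0 → All.lookup e∉es f∈es (sym (ι-injective (x-y≡0⇒x≡y d≡0))))
    (begin
      (ι f - ι e) * newtonSum es m (a ∘ suc) (ι f)       ≡⟨ ℚ.+-identityˡ _ ⟨
      0ℚ + (ι f - ι e) * newtonSum es m (a ∘ suc) (ι f)  ≡⟨ cong (_+ (ι f - ι e) * newtonSum es m (a ∘ suc) (ι f)) a0≡0 ⟨
      a 0 + (ι f - ι e) * newtonSum es m (a ∘ suc) (ι f) ≡⟨ newtonSum-suc e es m a (ι f) ⟨
      newtonSum (e ∷ es) (suc m) a (ι f)                 ≡⟨ vanish (there f∈es) ⟩
      0ℚ                                                 ∎)
  coefficients : ∀ {s} → s < suc m → a s ≡ 0ℚ
  coefficients {zero}  _     = a0≡0
  coefficients {suc s} s<1+m = newton-independent es! m (s≤s⁻¹ m<len) (a ∘ suc) tail-vanish (s≤s⁻¹ s<1+m)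

-- Multivariate polynomial functions

IsPoly : ∀ {n} → ℕ → (Vec ℕ n → ℚ) → Set
IsPoly d f = ∃ λ p → DegLe d p × (∀ x → evalP p x ≡ f x)

evalP-++ : ∀ {n} (p q : Poly n) x → evalP (p ++ q) x ≡ evalP p x + evalP q x
evalP-++ []            q x = sym (ℚ.+-identityˡ _)
evalP-++ ((c , e) ∷ p) q x = trans (cong (c * monoEval e x +_) (evalP-++ p q x)) (sym (ℚ.+-assoc (c * monoEval e x) _ _))

isPoly-ext : ∀ {n d} {f g : Vec ℕ n → ℚ} → IsPoly d f → (∀ x → g x ≡ f x) → IsPoly d g
isPoly-ext (p , deg , eq) g≡f = p , deg , λ x → trans (eq x) (sym (g≡f x))

isPoly-weaken : ∀ {n d d′} {f : Vec ℕ n → ℚ} → d ≤ d′ → IsPoly d f → IsPoly d′ f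
isPoly-weaken d≤d′ (p , deg , eq) = p , All.map (λ e≤d → ℕ.≤-trans e≤d d≤d′) deg , eq

isPoly-+ : ∀ {n d} {f g : Vec ℕ n → ℚ} → IsPoly d f → IsPoly d g → IsPoly d (λ x → f x + g x)
isPoly-+ (p , deg-p , eq-p) (q , deg-q , eq-q) =
  p ++ q , All.++⁺ deg-p deg-q , λ x → trans (evalP-++ p q x) (cong₂ _+_ (eq-p x) (eq-q x))

-- es e lists the monomials of the product of m and x^e.
isPoly-multiply : ∀ {n n′ d k} {f : Vec ℕ n → ℚ} (restrict : Vec ℕ n′ → Vec ℕ n) (m : Vec ℕ n′ → ℚ)
  (es : Vec ℕ n → List (Vec ℕ n′)) → (∀ e → All (λ e′ → wt e′ ≤ k ℕ.+ wt e) (es e)) →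
  (∀ e x → sumOver (es e) (λ e′ → monoEval e′ x) ≡ m x * monoEval e (restrict x)) →
  ∀ c → IsPoly d f → IsPoly (k ℕ.+ d) (λ x → c * (m x * f (restrict x)))
isPoly-multiply {n} {n′} {d} {k} restrict m es es-deg es-eval a (p , deg , eq) = go p , go-deg p deg ,
  λ x → trans (go-eval p x) (cong (λ y → a * (m x * y)) (eq (restrict x)))
  where
  go : Poly n → Poly n′
  go []            = []
  go ((c , e) ∷ p) = map (a * c ,_) (es e) ++ go p
  go-deg : ∀ p → DegLe d p → DegLe (k ℕ.+ d) (go p)
  go-deg []            []          = []
  go-deg ((c , e) ∷ p) (e≤d ∷ deg) =
    All.++⁺ (All.map⁺ (All.map (λ e′≤ → ℕ.≤-trans e′≤ (ℕ.+-monoʳ-≤ k e≤d)) (es-deg e))) (go-deg p deg)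
  scaled-eval : ∀ b (es : List (Vec ℕ n′)) x → evalP (map (b ,_) es) x ≡ b * sumOver es (λ e′ → monoEval e′ x)
  scaled-eval b []       x = sym (ℚ.*-zeroʳ b)
  scaled-eval b (e ∷ es) x = trans (cong (b * monoEval e x +_) (scaled-eval b es x)) (sym (ℚ.*-distribˡ-+ b _ _))
  rearrange : ∀ a c m e p → a * c * (m * e) + a * (m * p) ≡ a * (m * (c * e + p))
  rearrange = solve-∀ ℚ-ring
  rearrange₀ : ∀ a m → 0ℚ ≡ a * (m * 0ℚ)
  rearrange₀ = solve-∀ ℚ-ring
  go-eval : ∀ p x → evalP (go p) x ≡ a * (m x * evalP p (restrict x))
  go-eval []            x = rearrange₀ a (m x)
  go-eval ((c , e) ∷ p) x = begin
    evalP (map (a * c ,_) (es e) ++ go p) x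
      ≡⟨ evalP-++ (map (a * c ,_) (es e)) (go p) x ⟩
    evalP (map (a * c ,_) (es e)) x + evalP (go p) x
      ≡⟨ cong₂ _+_ (trans (scaled-eval (a * c) (es e) x) (cong (a * c *_) (es-eval e x))) (go-eval p x) ⟩
    a * c * (m x * monoEval e (restrict x)) + a * (m x * evalP p (restrict x))
      ≡⟨ rearrange a c (m x) (monoEval e (restrict x)) _ ⟩
    a * (m x * (c * monoEval e (restrict x) + evalP p (restrict x))) ∎

isPoly-*ˡ : ∀ {n d} {f : Vec ℕ n → ℚ} c → IsPoly d f → IsPoly d (λ x → c * f x)
isPoly-*ˡ {f = f} c poly = isPoly-ext
  (isPoly-multiply {k = 0} id (λ _ → 1ℚ) (λ e → e ∷ []) (λ e → ℕ.≤-refl ∷ [])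
    (λ e x → trans (ℚ.+-identityʳ (monoEval e x)) (sym (ℚ.*-identityˡ (monoEval e x)))) c poly)
  (λ x → cong (c *_) (sym (ℚ.*-identityˡ (f x))))

isPoly-tail : ∀ {n d} {f : Vec ℕ n → ℚ} → IsPoly d f → IsPoly d (f ∘ Vec.tail)
isPoly-tail {f = f} poly = isPoly-ext
  (isPoly-multiply {k = 0} Vec.tail (λ _ → 1ℚ) (λ e → (0 ∷ e) ∷ []) (λ e → ℕ.≤-refl ∷ [])
    (λ { e (y ∷ x) → ℚ.+-identityʳ (1ℚ * monoEval e x) }) 1ℚ poly)
  (λ x → sym (trans (ℚ.*-identityˡ (1ℚ * f (Vec.tail x))) (ℚ.*-identityˡ (f (Vec.tail x)))))

opaque
  unfolding ι

  isPoly-head* : ∀ {n d} {f : Vec ℕ (suc n) → ℚ} → IsPoly d f → IsPoly (suc d) (λ x → ι (Vec.head x) * f x)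
  isPoly-head* {n} {f = f} poly = isPoly-ext
    (isPoly-multiply {k = 1} id (ι ∘ Vec.head) raise (λ { (e ∷ es) → ℕ.≤-refl ∷ [] })
      (λ { (e ∷ es) (y ∷ x) → trans (ℚ.+-identityʳ _) (ℚ.*-assoc (ι y) (ι y ^ℚ e) _) }) 1ℚ poly)
    (λ x → sym (ℚ.*-identityˡ (ι (Vec.head x) * f x)))
    where
    raise : Vec ℕ (suc n) → List (Vec ℕ (suc n))
    raise (e ∷ es) = (suc e ∷ es) ∷ []

  isPoly-wt* : ∀ {n d} {f : Vec ℕ n → ℚ} → IsPoly d f → IsPoly (suc d) (λ x → ι (wt x) * f x)
  isPoly-wt* {f = f} poly = isPoly-ext
    (isPoly-multiply {k = 1} id (ι ∘ wt) raise raise-deg raise-eval 1ℚ poly)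
    (λ x → sym (ℚ.*-identityˡ (ι (wt x) * f x)))
    where
    -- The weight is a sum of coordinates, so multiplying a monomial by it gives one monomial for
    -- each coordinate.
    raise : ∀ {n} → Vec ℕ n → List (Vec ℕ n)
    raise []       = []
    raise (e ∷ es) = (suc e ∷ es) ∷ map (e ∷_) (raise es)
    raise-deg : ∀ {n} (e : Vec ℕ n) → All (λ e′ → wt e′ ≤ suc (wt e)) (raise e)
    raise-deg []       = []
    raise-deg (e ∷ es) = ℕ.≤-refl ∷ All.map⁺ (All.map (λ {e′} e′≤ → subst (e ℕ.+ wt e′ ≤_) (ℕ.+-suc e (wt es)) (ℕ.+-monoʳ-≤ e e′≤)) (raise-deg es))
    rearrange : ∀ y w e m → y * e * m + e * (w * m) ≡ (y + w) * (e * m)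
    rearrange = solve-∀ ℚ-ring
    raise-eval : ∀ {n} (e x : Vec ℕ n) → sumOver (raise e) (λ e′ → monoEval e′ x) ≡ ι (wt x) * monoEval e x
    raise-eval []       []      = refl
    raise-eval (e ∷ es) (y ∷ x) = begin
      ι y * ι y ^ℚ e * monoEval es x + sumOver (map (e ∷_) (raise es)) (λ e′ → monoEval e′ (y ∷ x))
        ≡⟨ cong (ι y * ι y ^ℚ e * monoEval es x +_) (trans (sumOver-map (e ∷_) (raise es) _) (sumOver-*ˡ (raise es) (ι y ^ℚ e) _)) ⟩
      ι y * ι y ^ℚ e * monoEval es x + ι y ^ℚ e * sumOver (raise es) (λ e′ → monoEval e′ x)
        ≡⟨ cong (λ z → ι y * ι y ^ℚ e * monoEval es x + ι y ^ℚ e * z) (raise-eval es x) ⟩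
      ι y * ι y ^ℚ e * monoEval es x + ι y ^ℚ e * (ι (wt x) * monoEval es x)
        ≡⟨ rearrange (ι y) (ι (wt x)) (ι y ^ℚ e) (monoEval es x) ⟩
      (ι y + ι (wt x)) * (ι y ^ℚ e * monoEval es x)
        ≡⟨ cong (_* (ι y ^ℚ e * monoEval es x)) (ι-+ y (wt x)) ⟨
      ι (y ℕ.+ wt x) * (ι y ^ℚ e * monoEval es x) ∎

isPoly-degBelow : ∀ {n d} {f : Vec ℕ n → ℚ} D {q} → IsPoly d f → DegBelow (suc D) q →
  IsPoly (D ℕ.+ d) (λ x → f x * q (ι (wt x)))
isPoly-degBelow {f = f} zero    poly (b , q′ , q′≡0 , eq) = isPoly-ext (isPoly-*ˡ b poly)
  (λ x → trans (cong (f x *_) (trans (eq (ι (wt x))) (cong (λ y → b + ι (wt x) * y) (q′≡0 (ι (wt x)))))) (rearrange (f x) b (ι (wt x))))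
  where
  rearrange : ∀ f b w → f * (b + w * 0ℚ) ≡ b * f
  rearrange = solve-∀ ℚ-ring
isPoly-degBelow {f = f} (suc D) poly (b , q′ , l , eq) = isPoly-ext
  (isPoly-+ (isPoly-weaken (ℕ.m≤n+m _ (suc D)) (isPoly-*ˡ b poly)) (isPoly-wt* (isPoly-degBelow D poly l)))
  (λ x → trans (cong (f x *_) (eq (ι (wt x)))) (rearrange (f x) b (ι (wt x)) (q′ (ι (wt x)))))
  where
  rearrange : ∀ f b w q → f * (b + w * q) ≡ b * f + w * (f * q)
  rearrange = solve-∀ ℚ-ring

-- Hahn polynomials on a rectangle

falling : ℕ → ℚ → ℚ
falling zero    z = 1ℚ
falling (suc a) z = falling a z * (z - ι a)

-- This is (-1)^a times the falling factorial; the sign makes it monic in y after the substitution z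
-- = s - y.
negFalling : ℕ → ℚ → ℚ
negFalling zero    z = 1ℚ
negFalling (suc a) z = negFalling a z * (ι a - z)

-- The factors of `falling (n + e) L` that come after those of `falling n L`.
rest : ℚ → ℕ → ℕ → ℚ
rest L n zero    = 1ℚ
rest L n (suc e) = (L - ι n) * rest L (suc n) e

falling-zero : ∀ {a n} → n < a → falling a (ι n) ≡ 0ℚ
falling-zero {suc a} {n} n<1+a with ℕ.m≤n⇒m<n∨m≡n (s≤s⁻¹ n<1+a)
... | inj₁ n<a  = trans (cong (_* (ι n - ι a)) (falling-zero n<a)) (ℚ.*-zeroˡ (ι n - ι a))
... | inj₂ refl = trans (cong (falling a (ι a) *_) (ℚ.+-inverseʳ (ι a))) (ℚ.*-zeroʳ (falling a (ι a)))

negFalling-zero : ∀ {a n} → n < a → negFalling a (ι n) ≡ 0ℚ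
negFalling-zero {suc a} {n} n<1+a with ℕ.m≤n⇒m<n∨m≡n (s≤s⁻¹ n<1+a)
... | inj₁ n<a  = trans (cong (_* (ι a - ι n)) (negFalling-zero n<a)) (ℚ.*-zeroˡ (ι a - ι n))
... | inj₂ refl = trans (cong (negFalling a (ι a) *_) (ℚ.+-inverseʳ (ι a))) (ℚ.*-zeroʳ (negFalling a (ι a)))

rest-positive : ∀ {M} n e → n ℕ.+ e ≤ M → Positive (rest (ι M) n e)
rest-positive n zero    n≤M = _
rest-positive {M} n (suc e) n+e≤M = ℚ.pos*pos⇒pos (ι M - ι n) (rest (ι M) (suc n) e)
  where
  1+n+e≤M : suc n ℕ.+ e ≤ M
  1+n+e≤M = subst (_≤ M) (ℕ.+-suc n e) n+e≤M
  instance
    _ : Positive (ι M - ι n)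
    _ = ι-<-positive (ℕ.≤-trans (ℕ.m≤m+n (suc n) e) 1+n+e≤M)
    _ : Positive (rest (ι M) (suc n) e)
    _ = rest-positive (suc n) e 1+n+e≤M

-- Umbrally, hahn r a b e a′ b′ e′ is a constant multiple of (-x)^a (1-x)^b y^a′ (1-y)^b′ (y-x)^r, where
-- x^k ↦ falling k X / falling k M and y^k ↦ falling k Y / falling k K; the budgets e and e′ of the
-- factors rest clear these denominators.
module _ (M K : ℕ) (X Y : ℚ) where

  momentˣ momentʸ : ℕ → ℕ → ℕ → ℚ
  momentˣ a b e = negFalling a X * falling b (ι M - X) * rest (ι M) (a ℕ.+ b) e
  momentʸ a b e = falling a Y * falling b (ι K - Y) * rest (ι K) (a ℕ.+ b) e

  hahn : ℕ → ℕ → ℕ → ℕ → ℕ → ℕ → ℕ → ℚ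
  hahn zero    a b e a′ b′ e′ = momentˣ a b e * momentʸ a′ b′ e′
  hahn (suc r) a b e a′ b′ e′ = hahn r a b (suc e) (suc a′) b′ e′ + hahn r (suc a) b e a′ b′ (suc e′)

  -- Umbrally 1 = x + (1 - x), with one unit of the budget e spent on the extra power; the companion
  -- for Y is 1 = y + (1 - y).
  momentˣ-split : ∀ a b e → momentˣ a b (suc e) ≡ - momentˣ (suc a) b e + momentˣ a (suc b) e
  momentˣ-split a b e rewrite ℕ.+-suc a b | ι-+ a b =
    rearrange (negFalling a X) (falling b (ι M - X)) (rest (ι M) (suc (a ℕ.+ b)) e) (ι M) X (ι a) (ι b)
    where
    rearrange : ∀ p q R M X a b → p * q * ((M - (a + b)) * R) ≡ - (p * (a - X) * q * R) + p * (q * (M - X - b)) * R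
    rearrange = solve-∀ ℚ-ring

  momentʸ-split : ∀ a b e → momentʸ a b (suc e) ≡ momentʸ (suc a) b e + momentʸ a (suc b) e
  momentʸ-split a b e rewrite ℕ.+-suc a b | ι-+ a b =
    rearrange (falling a Y) (falling b (ι K - Y)) (rest (ι K) (suc (a ℕ.+ b)) e) (ι K) Y (ι a) (ι b)
    where
    rearrange : ∀ p q R K Y a b → p * q * ((K - (a + b)) * R) ≡ p * (Y - a) * q * R + p * (q * (K - Y - b)) * R
    rearrange = solve-∀ ℚ-ring

  hahn-splitˣ : ∀ r a b e a′ b′ e′ →
    hahn r a b (suc e) a′ b′ e′ ≡ - hahn r (suc a) b e a′ b′ e′ + hahn r a (suc b) e a′ b′ e′
  hahn-splitˣ zero a b e a′ b′ e′ =
    trans (cong (_* momentʸ a′ b′ e′) (momentˣ-split a b e)) (rearrange (momentˣ (suc a) b e) (momentˣ a (suc b) e) _)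
    where
    rearrange : ∀ x y z → (- x + y) * z ≡ - (x * z) + y * z
    rearrange = solve-∀ ℚ-ring
  hahn-splitˣ (suc r) a b e a′ b′ e′ =
    trans (cong₂ _+_ (hahn-splitˣ r a b (suc e) (suc a′) b′ e′) (hahn-splitˣ r (suc a) b e a′ b′ (suc e′)))
      (rearrange (hahn r (suc a) b (suc e) (suc a′) b′ e′) (hahn r a (suc b) (suc e) (suc a′) b′ e′) _ _)
    where
    rearrange : ∀ x y z w → - x + y + (- z + w) ≡ - (x + z) + (y + w)
    rearrange = solve-∀ ℚ-ring

  hahn-splitʸ : ∀ r a b e a′ b′ e′ →
    hahn r a b e a′ b′ (suc e′) ≡ hahn r a b e (suc a′) b′ e′ + hahn r a b e a′ (suc b′) e′
  hahn-splitʸ zero a b e a′ b′ e′ =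
    trans (cong (momentˣ a b e *_) (momentʸ-split a′ b′ e′)) (ℚ.*-distribˡ-+ (momentˣ a b e) _ _)
  hahn-splitʸ (suc r) a b e a′ b′ e′ =
    trans (cong₂ _+_ (hahn-splitʸ r a b (suc e) (suc a′) b′ e′) (hahn-splitʸ r (suc a) b e a′ b′ (suc e′)))
      (rearrange (hahn r a b (suc e) (suc (suc a′)) b′ e′) (hahn r a b (suc e) (suc a′) (suc b′) e′) _ _)
    where
    rearrange : ∀ x y z w → x + y + (z + w) ≡ x + z + (y + w)
    rearrange = solve-∀ ℚ-ring

  -- y - x = (1-x) y - x (1-y)
  hahn-dual : ∀ r a b e a′ b′ e′ →
    hahn (suc r) a b e a′ b′ e′ ≡ hahn r a (suc b) e (suc a′) b′ e′ + hahn r (suc a) b e a′ (suc b′) e′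
  hahn-dual r a b e a′ b′ e′ =
    -- The term in y is split by 1 = (1 - x) + x and the term in -x by 1 = y + (1 - y); the two
    -- products x y cancel.
    trans (cong₂ _+_ (hahn-splitˣ r a b e (suc a′) b′ e′) (hahn-splitʸ r (suc a) b e a′ b′ e′))
      (rearrange (hahn r (suc a) b e (suc a′) b′ e′) (hahn r a (suc b) e (suc a′) b′ e′) _)
    where
    rearrange : ∀ x y z → - x + y + (x + z) ≡ y + z
    rearrange = solve-∀ ℚ-ring

+-<-split : ∀ m n a b → m ℕ.+ n < a ℕ.+ b → m < a ⊎ n < b
+-<-split m n a b m+n<a+b with m ℕ.<? a
... | yes m<a = inj₁ m<a
... | no  m≮a = inj₂ (ℕ.≰⇒> (λ b≤n → ℕ.<⇒≱ m+n<a+b (ℕ.+-mono-≤ (ℕ.≮⇒≥ m≮a) b≤n)))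

-- Each use of `hahn-dual` moves one unit from r into a + a′ and one into b + b′, so both bounds
-- persist down to r = 0. There X + Y < a + a′ forces X < a or Y < a′, and a falling factorial
-- vanishes; the other end is the same with M - X and K - Y.
hahn-zero : ∀ {M K X Y} → X ≤ M → Y ≤ K → ∀ r a b e a′ b′ e′ →
  X ℕ.+ Y < r ℕ.+ (a ℕ.+ a′) ⊎ (M ∸ X) ℕ.+ (K ∸ Y) < r ℕ.+ (b ℕ.+ b′) →
  hahn M K (ι X) (ι Y) r a b e a′ b′ e′ ≡ 0ℚ
hahn-zero {M} {K} {X} {Y} X≤M Y≤K zero a b e a′ b′ e′ outside =
  annihilate (negFalling a (ι X)) (falling b (ι M - ι X)) _ (falling a′ (ι Y)) (falling b′ (ι K - ι Y)) _ (factor≡0 outside)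
  where
  annihilate : ∀ p q R u v S → (p ≡ 0ℚ ⊎ u ≡ 0ℚ) ⊎ (q ≡ 0ℚ ⊎ v ≡ 0ℚ) → p * q * R * (u * v * S) ≡ 0ℚ
  annihilate p q R u v S (inj₁ (inj₁ refl)) = zeros q R u v S
    where
    zeros : ∀ q R u v S → 0ℚ * q * R * (u * v * S) ≡ 0ℚ
    zeros = solve-∀ ℚ-ring
  annihilate p q R u v S (inj₁ (inj₂ refl)) = zeros p q R v S
    where
    zeros : ∀ p q R v S → p * q * R * (0ℚ * v * S) ≡ 0ℚ
    zeros = solve-∀ ℚ-ring
  annihilate p q R u v S (inj₂ (inj₁ refl)) = zeros p R u v S
    where
    zeros : ∀ p R u v S → p * 0ℚ * R * (u * v * S) ≡ 0ℚ
    zeros = solve-∀ ℚ-ring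
  annihilate p q R u v S (inj₂ (inj₂ refl)) = zeros p q R u S
    where
    zeros : ∀ p q R u S → p * q * R * (u * 0ℚ * S) ≡ 0ℚ
    zeros = solve-∀ ℚ-ring
  factor≡0 : X ℕ.+ Y < a ℕ.+ a′ ⊎ (M ∸ X) ℕ.+ (K ∸ Y) < b ℕ.+ b′ →
    (negFalling a (ι X) ≡ 0ℚ ⊎ falling a′ (ι Y) ≡ 0ℚ) ⊎ (falling b (ι M - ι X) ≡ 0ℚ ⊎ falling b′ (ι K - ι Y) ≡ 0ℚ)
  factor≡0 (inj₁ low) with +-<-split X Y a a′ low
  ... | inj₁ X<a  = inj₁ (inj₁ (negFalling-zero X<a))
  ... | inj₂ Y<a′ = inj₁ (inj₂ (falling-zero Y<a′))
  factor≡0 (inj₂ high) with +-<-split (M ∸ X) (K ∸ Y) b b′ high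
  ... | inj₁ <b  = inj₂ (inj₁ (trans (cong (falling b) (sym (ι-∸ X≤M))) (falling-zero <b)))
  ... | inj₂ <b′ = inj₂ (inj₂ (trans (cong (falling b′) (sym (ι-∸ Y≤K))) (falling-zero <b′)))
hahn-zero {M} {K} {X} {Y} X≤M Y≤K (suc r) a b e a′ b′ e′ outside =
  trans (hahn-dual M K (ι X) (ι Y) r a b e a′ b′ e′) (cong₂ _+_
    (hahn-zero X≤M Y≤K r a (suc b) e (suc a′) b′ e′ (bump (ℕ.+-suc a a′) refl outside))
    (hahn-zero X≤M Y≤K r (suc a) b e a′ (suc b′) e′ (bump refl (ℕ.+-suc b b′) outside)))
  where
  bump : ∀ {u v k l k′ l′} → k ≡ suc k′ → l ≡ suc l′ → u < suc r ℕ.+ k′ ⊎ v < suc r ℕ.+ l′ → u < r ℕ.+ k ⊎ v < r ℕ.+ l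
  bump {u} {k′ = k′} refl refl (inj₁ low)  = inj₁ (subst (u <_) (sym (ℕ.+-suc r k′)) low)
  bump {v = v} {l′ = l′} refl refl (inj₂ high) = inj₂ (subst (v <_) (sym (ℕ.+-suc r l′)) high)

-- g(s, y) is a polynomial function of total degree at most j whose coefficient at y^j is a.
HasLeadʸ : ℕ → ℚ → (ℚ → ℚ → ℚ) → Set
HasLeadʸ zero    a g = ∀ s y → g s y ≡ a
HasLeadʸ (suc j) a g = ∃ λ φ → ∃ λ g′ → DegBelow (suc (suc j)) φ × HasLeadʸ j a g′ × (∀ s y → g s y ≡ φ s + y * g′ s y)

hasLeadʸ-ext : ∀ j {a g h} → HasLeadʸ j a g → (∀ s y → h s y ≡ g s y) → HasLeadʸ j a h
hasLeadʸ-ext zero    g≡a                  h≡g = λ s y → trans (h≡g s y) (g≡a s y)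
hasLeadʸ-ext (suc j) (φ , g′ , dφ , l , e) h≡g = φ , g′ , dφ , l , λ s y → trans (h≡g s y) (e s y)

hasLeadʸ-+ : ∀ j {a b g h} → HasLeadʸ j a g → HasLeadʸ j b h → HasLeadʸ j (a + b) (λ s y → g s y + h s y)
hasLeadʸ-+ zero    g≡a h≡b = λ s y → cong₂ _+_ (g≡a s y) (h≡b s y)
hasLeadʸ-+ (suc j) (φ , g′ , dφ , l , e) (ψ , h′ , dψ , k , f) =
  _ , _ , degBelow-+ (suc (suc j)) dφ dψ , hasLeadʸ-+ j l k ,
  λ s y → trans (cong₂ _+_ (e s y) (f s y)) (rearrange (φ s) (ψ s) y (g′ s y) (h′ s y))
  where
  rearrange : ∀ b c x p q → b + x * p + (c + x * q) ≡ b + c + x * (p + q)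
  rearrange = solve-∀ ℚ-ring

hasLeadʸ-*ˡ : ∀ j c {a g} → HasLeadʸ j a g → HasLeadʸ j (c * a) (λ s y → c * g s y)
hasLeadʸ-*ˡ zero    c g≡a = λ s y → cong (c *_) (g≡a s y)
hasLeadʸ-*ˡ (suc j) c (φ , g′ , dφ , l , e) =
  _ , _ , degBelow-*ˡ (suc (suc j)) c dφ , hasLeadʸ-*ˡ j c l ,
  λ s y → trans (cong (c *_) (e s y)) (rearrange c (φ s) y (g′ s y))
  where
  rearrange : ∀ c b x p → c * (b + x * p) ≡ c * b + x * (c * p)
  rearrange = solve-∀ ℚ-ring

-- A factor not involving y raises the total degree bound without contributing to the top power of y.
hasLeadʸ-affine* : ∀ j u c {a g} → HasLeadʸ j a g → HasLeadʸ (suc j) 0ℚ (λ s y → (u * s + c) * g s y)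
hasLeadʸ-affine* zero u c {a} {g} g≡a =
  (λ s → (u * s + c) * a) , (λ _ _ → 0ℚ) ,
  (c * a , (λ _ → u * a) , hasLead⇒degBelow 0 {u * a} (λ _ → refl) , λ s → rearrange u c a s) , (λ _ _ → refl) ,
  λ s y → trans (cong ((u * s + c) *_) (g≡a s y)) (add-0 ((u * s + c) * a) y)
  where
  rearrange : ∀ u c a s → (u * s + c) * a ≡ c * a + s * (u * a)
  rearrange = solve-∀ ℚ-ring
  add-0 : ∀ z y → z ≡ z + y * 0ℚ
  add-0 = solve-∀ ℚ-ring
hasLeadʸ-affine* (suc j) u c {a} {g} (φ , g′ , dφ , l , e) =
  (λ s → u * (s * φ s) + c * φ s) , _ ,
  degBelow-+ (suc (suc (suc j))) (degBelow-*ˡ (suc (suc (suc j))) u (hasLead-x* (suc (suc j)) dφ))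
    (degBelow-*ˡ (suc (suc (suc j))) c (hasLead⇒degBelow (suc (suc j)) dφ)) ,
  hasLeadʸ-affine* j u c l , λ s y → trans (cong ((u * s + c) *_) (e s y)) (rearrange u c s y (φ s) (g′ s y))
  where
  rearrange : ∀ u c s y φ g → (u * s + c) * (φ + y * g) ≡ u * (s * φ) + c * φ + y * ((u * s + c) * g)
  rearrange = solve-∀ ℚ-ring

hasLeadʸ-y* : ∀ j {a g} → HasLeadʸ j a g → HasLeadʸ (suc j) a (λ s y → y * g s y)
hasLeadʸ-y* j {g = g} l = (λ _ → 0ℚ) , g , degBelow-zero (suc (suc j)) , l , λ s y → sym (ℚ.+-identityˡ (y * g s y))

hasLeadʸ-linear* : ∀ j u c {a g} → HasLeadʸ j a g → HasLeadʸ (suc j) a (λ s y → g s y * (y + (u * s + c)))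
hasLeadʸ-linear* j u c {a} {g} l = subst (λ a → HasLeadʸ (suc j) a _) (ℚ.+-identityʳ a)
  (hasLeadʸ-ext (suc j) (hasLeadʸ-+ (suc j) (hasLeadʸ-y* j l) (hasLeadʸ-affine* j u c l))
    (λ s y → rearrange (g s y) y (u * s + c)))
  where
  rearrange : ∀ g y z → g * (y + z) ≡ y * g + z * g
  rearrange = solve-∀ ℚ-ring

hasLeadʸ⇒hasLead : ∀ j {a g} → HasLeadʸ j a g → ∀ s → HasLead j a (g s)
hasLeadʸ⇒hasLead zero    g≡a                   s = g≡a s
hasLeadʸ⇒hasLead (suc j) (φ , g′ , dφ , l , e) s = φ s , g′ s , hasLeadʸ⇒hasLead j l s , e s

falling-hasLeadʸ : ∀ a a′ → HasLeadʸ (a ℕ.+ a′) 1ℚ (λ s y → negFalling a (s - y) * falling a′ y)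
falling-hasLeadʸ zero    zero     = λ s y → refl
falling-hasLeadʸ zero    (suc a′) = hasLeadʸ-ext (suc a′)
  (hasLeadʸ-linear* a′ 0ℚ (- ι a′) (falling-hasLeadʸ zero a′)) (λ s y → rearrange (falling a′ y) s y (ι a′))
  where
  rearrange : ∀ p s y a → 1ℚ * (p * (y - a)) ≡ 1ℚ * p * (y + (0ℚ * s + - a))
  rearrange = solve-∀ ℚ-ring
falling-hasLeadʸ (suc a) a′ = hasLeadʸ-ext (suc (a ℕ.+ a′))
  (hasLeadʸ-linear* (a ℕ.+ a′) (- 1ℚ) (ι a) (falling-hasLeadʸ a a′))
  (λ s y → rearrange (negFalling a (s - y)) (falling a′ y) s y (ι a))
  where
  rearrange : ∀ p q s y a → p * (a - (s - y)) * q ≡ p * q * (y + (- 1ℚ * s + a))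
  rearrange = solve-∀ ℚ-ring

-- With x = s - y the factors `negFalling a` and `falling a′` are monic in y, so every term of the
-- recursion has a product of values of `rest` as its top coefficient. The two inequalities make
-- these values positive, so the sum cannot cancel.
hahn-hasLeadʸ : ∀ {M K} r a e a′ e′ → r ℕ.+ (a ℕ.+ e) ≤ M → r ℕ.+ (a′ ℕ.+ e′) ≤ K →
  ∃ λ c → Positive c × HasLeadʸ (r ℕ.+ (a ℕ.+ a′)) c (λ s y → hahn M K (s - y) y r a 0 e a′ 0 e′)
hahn-hasLeadʸ {M} {K} zero a e a′ e′ e≤M e′≤K =
  R * R′ * 1ℚ , ℚ.pos*pos⇒pos (R * R′) {{ℚ.pos*pos⇒pos R {{R>0}} R′ {{R′>0}}}} 1ℚ ,
  hasLeadʸ-ext (a ℕ.+ a′) (hasLeadʸ-*ˡ (a ℕ.+ a′) (R * R′) (falling-hasLeadʸ a a′))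
    (λ s y → rearrange (negFalling a (s - y)) (falling a′ y) R R′)
  where
  R R′ : ℚ
  R  = rest (ι M) (a ℕ.+ 0) e
  R′ = rest (ι K) (a′ ℕ.+ 0) e′
  R>0 : Positive R
  R>0 = rest-positive (a ℕ.+ 0) e (subst (λ k → k ℕ.+ e ≤ M) (sym (ℕ.+-identityʳ a)) e≤M)
  R′>0 : Positive R′
  R′>0 = rest-positive (a′ ℕ.+ 0) e′ (subst (λ k → k ℕ.+ e′ ≤ K) (sym (ℕ.+-identityʳ a′)) e′≤K)
  rearrange : ∀ p q R R′ → p * 1ℚ * R * (q * 1ℚ * R′) ≡ R * R′ * (p * q)
  rearrange = solve-∀ ℚ-ring
hahn-hasLeadʸ {M} {K} (suc r) a e a′ e′ e≤M e′≤K
  with hahn-hasLeadʸ {M} {K} r a (suc e) (suc a′) e′ (subst (_≤ M) (shift a e) e≤M) (subst (_≤ K) (sym (ℕ.+-suc r (a′ ℕ.+ e′))) e′≤K)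
     | hahn-hasLeadʸ {M} {K} r (suc a) e a′ (suc e′) (subst (_≤ M) (sym (ℕ.+-suc r (a ℕ.+ e))) e≤M) (subst (_≤ K) (shift a′ e′) e′≤K)
  where
  shift : ∀ b f → suc r ℕ.+ (b ℕ.+ f) ≡ r ℕ.+ (b ℕ.+ suc f)
  shift b f = sym (trans (cong (r ℕ.+_) (ℕ.+-suc b f)) (ℕ.+-suc r (b ℕ.+ f)))
... | c , c>0 , l | c′ , c′>0 , l′ =
  c + c′ , ℚ.pos+pos⇒pos c {{c>0}} c′ {{c′>0}} ,
  hasLeadʸ-+ (suc r ℕ.+ (a ℕ.+ a′))
    (subst (λ j → HasLeadʸ j c (λ s y → hahn M K (s - y) y r a 0 (suc e) (suc a′) 0 e′)) (trans (cong (r ℕ.+_) (ℕ.+-suc a a′)) (ℕ.+-suc r (a ℕ.+ a′))) l)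
    (subst (λ j → HasLeadʸ j c′ (λ s y → hahn M K (s - y) y r (suc a) 0 e a′ 0 (suc e′))) (ℕ.+-suc r (a ℕ.+ a′)) l′)

-- Hahn polynomials: independence on lines and spanning with bounded degree

module _ (M K : ℕ) where

  -- Points of [0,M] × [0,K] are encoded as (s, y), where s is the sum of the coordinates and y the second one.
  InRect : ℕ → ℕ → Set
  InRect s y = y ≤ K × y ≤ s × s ≤ M ℕ.+ y

  -- Umbrally (y - x)^r with x = s - y, multiplied by the falling factorials of length r of M and of
  -- K.
  hahnPoly : ℕ → ℚ → ℚ → ℚ
  hahnPoly r s y = hahn M K (s - y) y r 0 0 0 0 0 0

  hahnPoly-zero : ∀ {s y} r → InRect s y → s < r ⊎ M ℕ.+ K < s ℕ.+ r → hahnPoly r (ι s) (ι y) ≡ 0ℚ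
  hahnPoly-zero {s} {y} r (y≤K , y≤s , s≤M+y) outside =
    trans (cong (λ x → hahn M K x (ι y) r 0 0 0 0 0 0) (sym (ι-∸ y≤s)))
      (hahn-zero X≤M y≤K r 0 0 0 0 0 0 (outside′ outside))
    where
    X : ℕ
    X = s ∸ y
    X+y≡s : X ℕ.+ y ≡ s
    X+y≡s = ℕ.m∸n+n≡m y≤s
    X≤M : X ≤ M
    X≤M = subst (X ≤_) (ℕ.m+n∸n≡m M y) (ℕ.∸-monoˡ-≤ y s≤M+y)
    complement : (M ∸ X) ℕ.+ (K ∸ y) ℕ.+ s ≡ M ℕ.+ K
    complement = begin
      (M ∸ X) ℕ.+ (K ∸ y) ℕ.+ s           ≡⟨ cong ((M ∸ X) ℕ.+ (K ∸ y) ℕ.+_) X+y≡s ⟨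
      (M ∸ X) ℕ.+ (K ∸ y) ℕ.+ (X ℕ.+ y)   ≡⟨ interchange (M ∸ X) (K ∸ y) X y ⟩
      (M ∸ X) ℕ.+ X ℕ.+ ((K ∸ y) ℕ.+ y)   ≡⟨ cong₂ ℕ._+_ (ℕ.m∸n+n≡m X≤M) (ℕ.m∸n+n≡m y≤K) ⟩
      M ℕ.+ K                             ∎
      where
      interchange : ∀ a b c d → a ℕ.+ b ℕ.+ (c ℕ.+ d) ≡ a ℕ.+ c ℕ.+ (b ℕ.+ d)
      interchange = ℕ-solve-∀
    outside′ : s < r ⊎ M ℕ.+ K < s ℕ.+ r → X ℕ.+ y < r ℕ.+ 0 ⊎ (M ∸ X) ℕ.+ (K ∸ y) < r ℕ.+ 0
    outside′ (inj₁ s<r)     = inj₁ (subst₂ _<_ (sym X+y≡s) (sym (ℕ.+-identityʳ r)) s<r)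
    outside′ (inj₂ M+K<s+r) = inj₂ (subst ((M ∸ X) ℕ.+ (K ∸ y) <_) (sym (ℕ.+-identityʳ r))
      (ℕ.+-cancelʳ-< s _ r (subst₂ _<_ (sym complement) (ℕ.+-comm s r) M+K<s+r)))

  hahnPoly-hasLeadʸ : ∀ {r} → r ≤ M → r ≤ K → ∃ λ c → Positive c × HasLeadʸ r c (hahnPoly r)
  hahnPoly-hasLeadʸ {r} r≤M r≤K =
    subst (λ j → ∃ λ c → Positive c × HasLeadʸ j c (hahnPoly r)) (ℕ.+-identityʳ r)
      (hahn-hasLeadʸ r 0 0 0 0 (subst (_≤ M) (sym (ℕ.+-identityʳ r)) r≤M) (subst (_≤ K) (sym (ℕ.+-identityʳ r)) r≤K))

  hahnSum-degBelow : ∀ m → m ≤ suc (M ⊓ K) → ∀ (α : ℕ → ℚ) s → DegBelow m (λ y → sumBelow m (λ r → α r * hahnPoly r s y))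
  hahnSum-degBelow zero    _   α s = λ _ → refl
  hahnSum-degBelow (suc m) m<  α s with hahnPoly-hasLeadʸ (ℕ.≤-trans (s≤s⁻¹ m<) (ℕ.m⊓n≤m M K)) (ℕ.≤-trans (s≤s⁻¹ m<) (ℕ.m⊓n≤n M K))
  ... | c , _ , l = degBelow-+ (suc m) (hasLead⇒degBelow m (hahnSum-degBelow m (ℕ.<⇒≤ m<) α s))
    (degBelow-*ˡ (suc m) (α m) (hasLead⇒degBelow m (hasLeadʸ⇒hasLead m l s)))

  -- On the line of sum s the polynomials have degrees 0, 1, ..., m in y, and the line meets the
  -- rectangle in at least m + 1 points, so coefficients vanish from the top one downwards.
  hahnPoly-top : ∀ s m → m ≤ M ⊓ K → ∀ (α : ℕ → ℚ) →
    (∀ {y} → InRect s y → sumBelow (suc m) (λ r → α r * hahnPoly r (ι s) (ι y)) ≡ 0ℚ) →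
    m ≤ s → s ℕ.+ m ≤ M ℕ.+ K → α m ≡ 0ℚ
  hahnPoly-top s m m≤ α vanish m≤s s+m≤M+K with hahnPoly-hasLeadʸ (ℕ.≤-trans m≤ (ℕ.m⊓n≤m M K)) (ℕ.≤-trans m≤ (ℕ.m⊓n≤n M K))
  ... | c , c>0 , l = *≡0⇒≡0 {c} (positive≢0 c>0) (trans (ℚ.*-comm c (α m)) αc≡0)
    where
    m≤M : m ≤ M
    m≤M = ℕ.≤-trans m≤ (ℕ.m⊓n≤m M K)
    m≤K : m ≤ K
    m≤K = ℕ.≤-trans m≤ (ℕ.m⊓n≤n M K)
    s∸M+m≤ : ∀ {k} → m ≤ k → s ℕ.+ m ≤ M ℕ.+ k → s ∸ M ℕ.+ m ≤ k
    s∸M+m≤ {k} m≤k s+m≤M+k with ℕ.≤-total s M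
    ... | inj₁ s≤M = subst (λ x → x ℕ.+ m ≤ k) (sym (ℕ.m≤n⇒m∸n≡0 s≤M)) m≤k
    ... | inj₂ M≤s = ℕ.+-cancelˡ-≤ M _ k (subst (_≤ M ℕ.+ k) (trans (cong (ℕ._+ m) (sym (ℕ.m+[n∸m]≡n M≤s))) (ℕ.+-assoc M (s ∸ M) m)) s+m≤M+k)
    -- The points start at the least y on the line, max(0, s - M), which is what truncated
    -- subtraction computes; m + 1 consecutive ones fit.
    inRect : ∀ {t} → t ≤ m → InRect s (s ∸ M ℕ.+ t)
    inRect {t} t≤m =
      ℕ.≤-trans y≤ (s∸M+m≤ m≤K s+m≤M+K) ,
      ℕ.≤-trans y≤ (s∸M+m≤ m≤s (subst (s ℕ.+ m ≤_) (ℕ.+-comm s M) (ℕ.+-monoʳ-≤ s m≤M))) ,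
      ℕ.≤-trans (ℕ.m≤n+m∸n s M) (ℕ.+-monoʳ-≤ M (ℕ.m≤m+n (s ∸ M) t))
      where
      y≤ : s ∸ M ℕ.+ t ≤ s ∸ M ℕ.+ m
      y≤ = ℕ.+-monoʳ-≤ (s ∸ M) t≤m
    αc≡0 : α m * c ≡ 0ℚ
    αc≡0 = lead≡0 m {q = λ y → sumBelow (suc m) (λ r → α r * hahnPoly r (ι s) y)}
      (subst (λ b → HasLead m b (λ y → sumBelow (suc m) (λ r → α r * hahnPoly r (ι s) y))) (ℚ.+-identityˡ (α m * c))
        (hasLead-+ m (hahnSum-degBelow m (ℕ.m≤n⇒m≤1+n m≤) α (ι s)) (hasLead-*ˡ m (α m) (hasLeadʸ⇒hasLead m l (ι s)))))
      (λ t → ι (s ∸ M ℕ.+ t)) (ℕ.+-cancelˡ-≡ (s ∸ M) _ _ ∘ ι-injective) (vanish ∘ inRect)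

  hahnPoly-independent : ∀ s m → m ≤ suc (M ⊓ K) → ∀ (α : ℕ → ℚ) →
    (∀ {y} → InRect s y → sumBelow m (λ r → α r * hahnPoly r (ι s) (ι y)) ≡ 0ℚ) →
    ∀ {r} → r < m → r ≤ s → s ℕ.+ r ≤ M ℕ.+ K → α r ≡ 0ℚ
  hahnPoly-independent s (suc m) m< α vanish {r} r<1+m r≤s s+r≤M+K with ℕ.m≤n⇒m<n∨m≡n (s≤s⁻¹ r<1+m)
  ... | inj₂ refl = hahnPoly-top s m (s≤s⁻¹ m<) α vanish r≤s s+r≤M+K
  ... | inj₁ r<m  = hahnPoly-independent s m (ℕ.<⇒≤ m<) α (λ {y} inRect → begin
    sumBelow m (λ r → α r * hahnPoly r (ι s) (ι y))                 ≡⟨ ℚ.+-identityʳ _ ⟨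
    sumBelow m (λ r → α r * hahnPoly r (ι s) (ι y)) + 0ℚ            ≡⟨ cong (sumBelow m (λ r → α r * hahnPoly r (ι s) (ι y)) +_) (top≡0 inRect) ⟨
    sumBelow (suc m) (λ r → α r * hahnPoly r (ι s) (ι y))           ≡⟨ vanish inRect ⟩
    0ℚ                                                              ∎) r<m r≤s s+r≤M+K
    where
    top≡0 : ∀ {y} → InRect s y → α m * hahnPoly m (ι s) (ι y) ≡ 0ℚ
    top≡0 {y} inRect with m ℕ.≤? s | s ℕ.+ m ℕ.≤? M ℕ.+ K
    ... | yes m≤s | yes s+m≤ = trans (cong (_* hahnPoly m (ι s) (ι y)) (hahnPoly-top s m (s≤s⁻¹ m<) α vanish m≤s s+m≤)) (ℚ.*-zeroˡ (hahnPoly m (ι s) (ι y)))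
    ... | no m≰s  | _        = trans (cong (α m *_) (hahnPoly-zero m inRect (inj₁ (ℕ.≰⇒> m≰s)))) (ℚ.*-zeroʳ (α m))
    ... | yes _   | no s+m≰  = trans (cong (α m *_) (hahnPoly-zero m inRect (inj₂ (ℕ.≰⇒> s+m≰)))) (ℚ.*-zeroʳ (α m))

  -- On the rectangle, g is a combination of the Hahn polynomials with coefficients polynomial in s,
  -- of total degree less than D.
  record InSpan (D : ℕ) (g : ℚ → ℚ → ℚ) : Set where
    constructor inSpan
    field
      coefficients : ℕ → ℚ → ℚ
      degrees      : ∀ r → DegBelow (D ∸ r) (coefficients r)
      expansion    : ∀ {s y} → InRect s y →
        g (ι s) (ι y) ≡ sumBelow (suc (M ⊓ K)) (λ r → coefficients r (ι s) * hahnPoly r (ι s) (ι y))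

  inSpan-ext : ∀ {D g h} → InSpan D g → (∀ {s y} → InRect s y → h (ι s) (ι y) ≡ g (ι s) (ι y)) → InSpan D h
  inSpan-ext (inSpan q dq eq) h≡g = inSpan q dq λ inRect → trans (h≡g inRect) (eq inRect)

  inSpan-zero : ∀ D → InSpan D (λ _ _ → 0ℚ)
  inSpan-zero D = inSpan (λ _ _ → 0ℚ) (λ r → degBelow-zero (D ∸ r))
    (λ {s} {y} _ → sym (sumBelow-zero (suc (M ⊓ K)) (λ {r} _ → ℚ.*-zeroˡ (hahnPoly r (ι s) (ι y)))))

  inSpan-weaken : ∀ {D D′ g} → D ≤ D′ → InSpan D g → InSpan D′ g
  inSpan-weaken D≤D′ (inSpan q dq eq) = inSpan q (λ r → degBelow-weaken (ℕ.∸-monoˡ-≤ r D≤D′) (dq r)) eq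

  inSpan-+ : ∀ {D g h} → InSpan D g → InSpan D h → InSpan D (λ s y → g s y + h s y)
  inSpan-+ {D} (inSpan q dq eq) (inSpan p dp ep) =
    inSpan (λ r s → q r s + p r s) (λ r → degBelow-+ (D ∸ r) (dq r) (dp r)) λ {s} {y} inRect →
      trans (cong₂ _+_ (eq inRect) (ep inRect)) (trans (sym (sumBelow-+ (suc (M ⊓ K)) _ _))
        (sumBelow-cong (suc (M ⊓ K)) (λ {r} _ → sym (ℚ.*-distribʳ-+ (hahnPoly r (ι s) (ι y)) (q r (ι s)) (p r (ι s))))))

  inSpan-*ˡ : ∀ {D g} c → InSpan D g → InSpan D (λ s y → c * g s y)
  inSpan-*ˡ {D} c (inSpan q dq eq) =
    inSpan (λ r s → c * q r s) (λ r → degBelow-*ˡ (D ∸ r) c (dq r)) λ {s} {y} inRect →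
      trans (cong (c *_) (eq inRect)) (trans (sym (sumBelow-*ˡ (suc (M ⊓ K)) c _))
        (sumBelow-cong (suc (M ⊓ K)) (λ {r} _ → sym (ℚ.*-assoc c (q r (ι s)) (hahnPoly r (ι s) (ι y))))))

  inSpan-s* : ∀ {D g} → InSpan D g → InSpan (suc D) (λ s y → s * g s y)
  inSpan-s* {D} (inSpan q dq eq) =
    inSpan (λ r s → s * q r s) dsq λ {s} {y} inRect →
      trans (cong (ι s *_) (eq inRect)) (trans (sym (sumBelow-*ˡ (suc (M ⊓ K)) (ι s) _))
        (sumBelow-cong (suc (M ⊓ K)) (λ {r} _ → sym (ℚ.*-assoc (ι s) (q r (ι s)) (hahnPoly r (ι s) (ι y))))))
    where
    dsq : ∀ r → DegBelow (suc D ∸ r) (λ s → s * q r s)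
    dsq r with r ℕ.≤? D
    ... | yes r≤D = subst (λ k → DegBelow k (λ s → s * q r s)) (sym (ℕ.+-∸-assoc 1 r≤D)) (hasLead-x* (D ∸ r) (dq r))
    -- Past r = D the coefficient is the zero function, and it stays so after multiplication by s.
    ... | no  r≰D = degBelow-weaken {0} z≤n (λ s →
      trans (cong (s *_) (subst (λ k → DegBelow k (q r)) (ℕ.m≤n⇒m∸n≡0 (ℕ.≰⇒≥ r≰D)) (dq r) s)) (ℚ.*-zeroʳ s))

  inSpan-degBelow* : ∀ m {j g φ} → InSpan j g → DegBelow (suc m) φ → InSpan (m ℕ.+ j) (λ s y → φ s * g s y)
  inSpan-degBelow* zero {g = g} g∈ (b , φ′ , φ′≡0 , eq) = inSpan-ext (inSpan-*ˡ b g∈) (λ {s} {y} _ →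
    cong (_* g (ι s) (ι y)) (trans (eq (ι s)) (trans (cong (λ z → b + ι s * z) (φ′≡0 (ι s))) (rearrange b (ι s)))))
    where
    rearrange : ∀ b s → b + s * 0ℚ ≡ b
    rearrange = solve-∀ ℚ-ring
  inSpan-degBelow* (suc m) {g = g} g∈ (b , φ′ , l , eq) = inSpan-ext
    (inSpan-+ (inSpan-weaken (ℕ.m≤n+m _ (suc m)) (inSpan-*ˡ b g∈)) (inSpan-s* (inSpan-degBelow* m g∈ l)))
    (λ {s} {y} _ → trans (cong (_* g (ι s) (ι y)) (eq (ι s))) (rearrange b (ι s) (φ′ (ι s)) (g (ι s) (ι y))))
    where
    rearrange : ∀ b s φ g → (b + s * φ) * g ≡ b * g + s * (φ * g)
    rearrange = solve-∀ ℚ-ring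

  -- Write g = φ(s) + y g′. As i < j, the term φ(s) y^i lies in the span by `lower`, with total
  -- degree at most (k + 1) + i = j, and is subtracted. Repeating this with g′ strips every term but
  -- the top one, a y^j.
  inSpan-top-power : ∀ {j} → (∀ {i} → i < j → InSpan (suc i) (λ _ y → y ^ℚ i)) →
    ∀ k i {a g} → k ℕ.+ i ≡ j → HasLeadʸ k a g →
    InSpan (suc j) (λ s y → y ^ℚ i * g s y) → InSpan (suc j) (λ _ y → a * y ^ℚ j)
  inSpan-top-power lower zero i {a} {g} refl g≡a g∈ = inSpan-ext g∈ (λ {s} {y} _ →
    trans (ℚ.*-comm a (ι y ^ℚ i)) (cong (ι y ^ℚ i *_) (sym (g≡a (ι s) (ι y)))))
  inSpan-top-power {j} lower (suc k) i {a} {g} refl (φ , g′ , dφ , l , eq) g∈ =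
    inSpan-top-power lower k (suc i) (ℕ.+-suc k i) l
      (inSpan-ext (inSpan-+ g∈ (inSpan-*ˡ (- 1ℚ) φ∈)) (λ {s} {y} _ →
        trans (rearrange (ι y) (ι y ^ℚ i) (φ (ι s)) (g′ (ι s) (ι y)))
          (cong (λ z → ι y ^ℚ i * z + - 1ℚ * (φ (ι s) * ι y ^ℚ i)) (sym (eq (ι s) (ι y))))))
    where
    φ∈ : InSpan (suc j) (λ s y → φ s * y ^ℚ i)
    φ∈ = subst (λ k → InSpan k (λ s y → φ s * y ^ℚ i)) (ℕ.+-suc (suc k) i)
      (inSpan-degBelow* (suc k) (lower (s≤s (ℕ.m≤n+m i k))) dφ)
    rearrange : ∀ y p φ g → y * p * g ≡ p * (φ + y * g) + - 1ℚ * (φ * p)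
    rearrange = solve-∀ ℚ-ring

  inSpan-hahnPoly : ∀ {j} → j ≤ M ⊓ K → InSpan (suc j) (hahnPoly j)
  inSpan-hahnPoly {j} j≤ = inSpan δ dδ λ {s} {y} _ → sym (begin
    sumBelow (suc (M ⊓ K)) (λ r → δ r (ι s) * hahnPoly r (ι s) (ι y))
      ≡⟨ sumBelow-single (suc (M ⊓ K)) (s≤s j≤) (λ {r} r≢j → trans (cong (_* hahnPoly r (ι s) (ι y)) (δ-off r≢j (ι s))) (ℚ.*-zeroˡ (hahnPoly r (ι s) (ι y)))) ⟩
    δ j (ι s) * hahnPoly j (ι s) (ι y)
      ≡⟨ cong (_* hahnPoly j (ι s) (ι y)) (δ-on (ι s)) ⟩
    1ℚ * hahnPoly j (ι s) (ι y)
      ≡⟨ ℚ.*-identityˡ (hahnPoly j (ι s) (ι y)) ⟩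
    hahnPoly j (ι s) (ι y) ∎)
    where
    δ : ℕ → ℚ → ℚ
    δ r s with r ℕ.≟ j
    ... | yes _ = 1ℚ
    ... | no  _ = 0ℚ
    δ-on : ∀ s → δ j s ≡ 1ℚ
    δ-on s with j ℕ.≟ j
    ... | yes _  = refl
    ... | no j≢j = contradiction refl j≢j
    δ-off : ∀ {r} → r ≢ j → ∀ s → δ r s ≡ 0ℚ
    δ-off {r} r≢j s with r ℕ.≟ j
    ... | yes r≡j = contradiction r≡j r≢j
    ... | no _    = refl
    dδ : ∀ r → DegBelow (suc j ∸ r) (δ r)
    dδ r with r ℕ.≟ j
    ... | yes refl = subst (λ k → DegBelow k (λ _ → 1ℚ)) (sym (ℕ.m+n∸n≡m 1 r)) (degBelow-constant 0 1ℚ)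
    ... | no _     = degBelow-zero (suc j ∸ r)

  -- For j > min(M, K) the power y^j is reduced by a product of j linear factors vanishing on the rectangle.
  monic-in-span : ∀ j → ∃ λ a → ∃ λ g → a ≢ 0ℚ × HasLeadʸ j a g × InSpan (suc j) g
  monic-in-span j with j ℕ.≤? M | j ℕ.≤? K
  ... | yes j≤M | yes j≤K with hahnPoly-hasLeadʸ j≤M j≤K
  ...   | a , a>0 , l = a , hahnPoly j , positive≢0 a>0 , l , inSpan-hahnPoly (ℕ.⊓-glb j≤M j≤K)
  monic-in-span j | no j≰M | _ = 1ℚ , _ , (λ ()) , l , inSpan-ext (inSpan-zero (suc j)) (λ {s} {y} (_ , y≤s , s≤M+y) →
    trans (cong (_* 1ℚ) (trans (cong (negFalling j) (sym (ι-∸ y≤s)))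
      (negFalling-zero (ℕ.≤-<-trans (subst (s ∸ y ≤_) (ℕ.m+n∸n≡m M y) (ℕ.∸-monoˡ-≤ y s≤M+y)) (ℕ.≰⇒> j≰M))))) (ℚ.*-zeroˡ 1ℚ))
    where
    l : HasLeadʸ j 1ℚ (λ s y → negFalling j (s - y) * falling 0 y)
    l = subst (λ k → HasLeadʸ k 1ℚ (λ s y → negFalling j (s - y) * falling 0 y)) (ℕ.+-identityʳ j) (falling-hasLeadʸ j 0)
  monic-in-span j | yes _ | no j≰K = 1ℚ , _ , (λ ()) , falling-hasLeadʸ 0 j , inSpan-ext (inSpan-zero (suc j)) (λ {s} {y} (y≤K , _) →
    trans (cong (1ℚ *_) (falling-zero (ℕ.≤-<-trans y≤K (ℕ.≰⇒> j≰K)))) (ℚ.*-zeroʳ 1ℚ))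

  inSpan-power : ∀ j → InSpan (suc j) (λ _ y → y ^ℚ j)
  inSpan-power = <-rec _ λ j lower → reduce j lower (monic-in-span j)
    where
    reduce : ∀ j → (∀ {i} → i < j → InSpan (suc i) (λ _ y → y ^ℚ i)) →
      (∃ λ a → ∃ λ g → a ≢ 0ℚ × HasLeadʸ j a g × InSpan (suc j) g) → InSpan (suc j) (λ _ y → y ^ℚ j)
    reduce j lower (a , g , a≢0 , l , g∈) = inSpan-ext
      (inSpan-*ˡ (ℚ.1/ a) (inSpan-top-power lower j 0 (ℕ.+-identityʳ j) l
        (inSpan-ext g∈ (λ {s} {y} _ → ℚ.*-identityˡ (g (ι s) (ι y))))))
      (λ {s} {y} _ → sym (begin
        ℚ.1/ a * (a * ι y ^ℚ j) ≡⟨ ℚ.*-assoc (ℚ.1/ a) a (ι y ^ℚ j) ⟨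
        ℚ.1/ a * a * ι y ^ℚ j   ≡⟨ cong (_* ι y ^ℚ j) (ℚ.*-inverseˡ a) ⟩
        1ℚ * ι y ^ℚ j           ≡⟨ ℚ.*-identityˡ (ι y ^ℚ j) ⟩
        ι y ^ℚ j                ∎))
      where instance _ = ℚ.≢-nonZero a≢0

  -- In the application s - y + c is the weight of the remaining coordinates. Horner's rule
  -- multiplies by it, and its three parts are absorbed by a coefficient, by the exponent e and by a
  -- scalar; this is why e is left free.
  inSpan-monomial : ∀ D e c {q} → DegBelow D q → InSpan (D ℕ.+ e) (λ s y → y ^ℚ e * q (s - y + c))
  inSpan-monomial zero    e c {q} q≡0 = inSpan-ext (inSpan-zero e) (λ {s} {y} _ →
    trans (cong (ι y ^ℚ e *_) (q≡0 (ι s - ι y + c))) (ℚ.*-zeroʳ (ι y ^ℚ e)))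
  inSpan-monomial (suc D) e c {q} (b , q′ , l , eq) = inSpan-ext
    (inSpan-+ (inSpan-+ (inSpan-weaken (s≤s (ℕ.m≤n+m e D)) (inSpan-*ˡ b (inSpan-power e))) (inSpan-s* ih))
      (inSpan-+ (inSpan-*ˡ (- 1ℚ) (subst (λ k → InSpan k (λ s y → y ^ℚ suc e * q′ (s - y + c))) (ℕ.+-suc D e) (inSpan-monomial D (suc e) c l)))
        (inSpan-weaken (ℕ.n≤1+n (D ℕ.+ e)) (inSpan-*ˡ c ih))))
    (λ {s} {y} _ → trans (cong (ι y ^ℚ e *_) (eq (ι s - ι y + c))) (rearrange b (ι s) (ι y) c (ι y ^ℚ e) (q′ (ι s - ι y + c))))
    where
    ih : InSpan (D ℕ.+ e) (λ s y → y ^ℚ e * q′ (s - y + c))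
    ih = inSpan-monomial D e c l
    rearrange : ∀ b s y c p q → p * (b + (s - y + c) * q) ≡ b * p + s * (p * q) + (- 1ℚ * (y * p * q) + c * (p * q))
    rearrange = solve-∀ ℚ-ring

-- Chains

extend : ∀ {n} → (Vec ℕ n → ℕ) → List (Vec ℕ n) → List (Vec ℕ (suc n))
extend g = concatMap (λ c → map (_∷ c) (upTo (g c)))

module _ {n} {g : Vec ℕ n → ℕ} where

  ∈-extend⁻ : ∀ {cs r c} → r ∷ c ∈ extend g cs → c ∈ cs × r < g c
  ∈-extend⁻ rc∈ with find (∈-concatMap⁻ (λ c → map (_∷ c) (upTo (g c))) rc∈)
  ... | c , c∈cs , rc∈′ with ∈-map⁻ (_∷ c) rc∈′
  ...   | r , r∈ , refl = c∈cs , ∈-upTo⁻ r∈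

  sumOver-extend : ∀ cs f → sumOver (extend g cs) f ≡ sumOver cs (λ c → sumBelow (g c) (λ r → f (r ∷ c)))
  sumOver-extend cs f = trans (sumOver-concatMap (λ c → map (_∷ c) (upTo (g c))) cs f)
    (sumOver-cong cs (λ {c} _ → trans (sumOver-map (_∷ c) (upTo (g c)) f) (sumOver-applyUpTo (g c) id (λ r → f (r ∷ c)))))

  extend-unique : ∀ {cs} → Unique cs → Unique (extend g cs)
  extend-unique []            = []
  extend-unique {c ∷ cs} (c∉cs ∷ cs!) = Unique.++⁺ (Unique.map⁺ Vec.∷-injectiveˡ (Unique.upTo⁺ (g c))) (extend-unique cs!)
    λ { {r ∷ c′} (rc∈ , rc∈′) → disjoint rc∈ (∈-extend⁻ rc∈′) }
    where
    disjoint : ∀ {r c′} → r ∷ c′ ∈ map (_∷ c) (upTo (g c)) → c′ ∈ cs × r < g c′ → ⊥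
    disjoint rc∈ (c′∈cs , _) with ∈-map⁻ (_∷ c) rc∈
    ... | _ , _ , refl = All.lookup c∉cs c′∈cs refl

  length-extend : ∀ cs → length (extend g cs) ≡ sum (map g cs)
  length-extend []       = refl
  length-extend (c ∷ cs) = trans (List.length-++ (map (_∷ c) (upTo (g c))))
    (cong₂ ℕ._+_ (trans (List.length-map (_∷ c) (upTo (g c))) (List.length-upTo (g c))) (length-extend cs))

∈-grid⁻ : ∀ {n} k (ks : Vec ℕ n) {y x} → y ∷ x ∈ grid (k ∷ ks) → y < k × x ∈ grid ks
∈-grid⁻ k ks yx∈ with find (∈-concatMap⁻ (λ a → map (a ∷_) (grid ks)) yx∈)
... | a , a∈ , yx∈′ with ∈-map⁻ (a ∷_) yx∈′
...   | x , x∈ , refl = ∈-upTo⁻ a∈ , x∈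

∈-grid⁺ : ∀ {n} k (ks : Vec ℕ n) {y x} → y < k → x ∈ grid ks → y ∷ x ∈ grid (k ∷ ks)
∈-grid⁺ k ks {y} y<k x∈ = ∈-concatMap⁺ (λ a → map (a ∷_) (grid ks)) (lose (∈-upTo⁺ y<k) (∈-map⁺ (y ∷_) x∈))

grid-wt : ∀ {n} (ks : Vec ℕ n) {x} → x ∈ grid ks → wt x ≤ N ks
grid-wt []       {[]}    _   = z≤n
grid-wt (k ∷ ks) {y ∷ x} yx∈ with ∈-grid⁻ k ks yx∈
... | y<k , x∈ = ℕ.+-mono-≤ (ℕ.∸-monoˡ-≤ 1 y<k) (grid-wt ks x∈)

-- A chain is encoded by a vector c; it occupies the layers from wt c to wt c + chainLength ks c.
-- The tensor product of a chain of length M with [0,K] splits into chains indexed by r ≤ min(M, K).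
chainLength : ∀ {n} → Vec ℕ n → Vec ℕ n → ℕ
chainLength []       []      = 0
chainLength (k ∷ ks) (r ∷ c) = (chainLength ks c ∸ r) ℕ.+ (k ∸ 1 ∸ r)

chains : ∀ {n} → Vec ℕ n → List (Vec ℕ n)
chains []       = [] ∷ []
chains (k ∷ ks) = extend (λ c → suc (chainLength ks c ⊓ (k ∸ 1))) (chains ks)

InChain : ∀ {n} → Vec ℕ n → Vec ℕ n → ℕ → Set
InChain ks c w = wt c ≤ w × w ≤ wt c ℕ.+ chainLength ks c

-- The point x enters the new rectangle through its position wt x - wt c on the chain c, so the sum
-- of the two coordinates is y + wt x - wt c. Where a grid point x is off the chain c, the first
-- factor is zero.
chainPoly : ∀ {n} → Vec ℕ n → Vec ℕ n → Vec ℕ n → ℚ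
chainPoly []       []      []      = 1ℚ
chainPoly (k ∷ ks) (r ∷ c) (y ∷ x) =
  chainPoly ks c x * hahnPoly (chainLength ks c) (k ∸ 1) r (ι (y ℕ.+ wt x) - ι (wt c)) (ι y)

∈-chains⁻ : ∀ {n} k (ks : Vec ℕ n) {r c} → r ∷ c ∈ chains (k ∷ ks) → c ∈ chains ks × r ≤ chainLength ks c × r ≤ k ∸ 1
∈-chains⁻ k ks {c = c} rc∈ with ∈-extend⁻ {cs = chains ks} rc∈
... | c∈ , r< = c∈ , ℕ.≤-trans (s≤s⁻¹ r<) (ℕ.m⊓n≤m (chainLength ks c) (k ∸ 1)) , ℕ.≤-trans (s≤s⁻¹ r<) (ℕ.m⊓n≤n (chainLength ks c) (k ∸ 1))

chains-unique : ∀ {n} (ks : Vec ℕ n) → Unique (chains ks)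
chains-unique []       = [] ∷ []
chains-unique (k ∷ ks) = extend-unique (chains-unique ks)

-- Compared with the whole range of sums, the part r of a product loses r weights at each end, so
-- the centre is preserved.
chain-symmetric : ∀ {n} (ks : Vec ℕ n) {c} → c ∈ chains ks → wt c ℕ.+ (wt c ℕ.+ chainLength ks c) ≡ N ks
chain-symmetric []       {[]}    _   = refl
chain-symmetric (k ∷ ks) {r ∷ c} rc∈ with ∈-chains⁻ k ks rc∈
... | c∈ , r≤M , r≤K = begin
  r ℕ.+ i ℕ.+ (r ℕ.+ i ℕ.+ ((M ∸ r) ℕ.+ (K ∸ r)))        ≡⟨ rearrange r i (M ∸ r) (K ∸ r) ⟩
  (K ∸ r) ℕ.+ r ℕ.+ (i ℕ.+ (i ℕ.+ ((M ∸ r) ℕ.+ r)))      ≡⟨ cong₂ (λ u v → u ℕ.+ (i ℕ.+ (i ℕ.+ v))) (ℕ.m∸n+n≡m r≤K) (ℕ.m∸n+n≡m r≤M) ⟩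
  K ℕ.+ (i ℕ.+ (i ℕ.+ M))                               ≡⟨ cong (K ℕ.+_) (chain-symmetric ks c∈) ⟩
  K ℕ.+ N ks                                            ∎
  where
  i M K : ℕ
  i = wt c
  M = chainLength ks c
  K = k ∸ 1
  rearrange : ∀ r i u v → r ℕ.+ i ℕ.+ (r ℕ.+ i ℕ.+ (u ℕ.+ v)) ≡ v ℕ.+ r ℕ.+ (i ℕ.+ (i ℕ.+ (u ℕ.+ r)))
  rearrange = ℕ-solve-∀

-- In terms of the offset s from `wt c`, the chain `r ∷ c` is the range of sums outside which
-- `hahnPoly r` vanishes.
InChain-∷ : ∀ {n} k (ks : Vec ℕ n) {r} c s → r ≤ chainLength ks c → r ≤ k ∸ 1 →
  r ≤ s → s ℕ.+ r ≤ chainLength ks c ℕ.+ (k ∸ 1) → InChain (k ∷ ks) (r ∷ c) (s ℕ.+ wt c)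
InChain-∷ k ks {r} c s r≤M r≤K r≤s s+r≤M+K =
  ℕ.+-monoˡ-≤ (wt c) r≤s , ℕ.+-cancelʳ-≤ r _ _ (subst₂ _≤_ (left s (wt c) r) right (ℕ.+-monoʳ-≤ (wt c) s+r≤M+K))
  where
  M K : ℕ
  M = chainLength ks c
  K = k ∸ 1
  left : ∀ s i r → i ℕ.+ (s ℕ.+ r) ≡ s ℕ.+ i ℕ.+ r
  left = ℕ-solve-∀
  rearrange : ∀ i r u v → i ℕ.+ (u ℕ.+ r ℕ.+ (v ℕ.+ r)) ≡ r ℕ.+ i ℕ.+ (u ℕ.+ v) ℕ.+ r
  rearrange = ℕ-solve-∀
  right : wt c ℕ.+ (M ℕ.+ K) ≡ r ℕ.+ wt c ℕ.+ ((M ∸ r) ℕ.+ (K ∸ r)) ℕ.+ r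
  right = trans (cong₂ (λ u v → wt c ℕ.+ (u ℕ.+ v)) (sym (ℕ.m∸n+n≡m r≤M)) (sym (ℕ.m∸n+n≡m r≤K))) (rearrange (wt c) r (M ∸ r) (K ∸ r))

InChain-∷⁻ : ∀ {n} k (ks : Vec ℕ n) {r} c s → r ≤ chainLength ks c → r ≤ k ∸ 1 →
  InChain (k ∷ ks) (r ∷ c) (s ℕ.+ wt c) → r ≤ s × s ℕ.+ r ≤ chainLength ks c ℕ.+ (k ∸ 1)
InChain-∷⁻ k ks {r} c s r≤M r≤K (low , high) =
  ℕ.+-cancelʳ-≤ (wt c) r s low ,
  ℕ.+-cancelʳ-≤ (wt c) _ _ (subst₂ _≤_ (left s (wt c) r) right (ℕ.+-monoˡ-≤ r high))
  where
  M K : ℕ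
  M = chainLength ks c
  K = k ∸ 1
  left : ∀ s i r → s ℕ.+ i ℕ.+ r ≡ s ℕ.+ r ℕ.+ i
  left = ℕ-solve-∀
  rearrange : ∀ i r u v → r ℕ.+ i ℕ.+ (u ℕ.+ v) ℕ.+ r ≡ u ℕ.+ r ℕ.+ (v ℕ.+ r) ℕ.+ i
  rearrange = ℕ-solve-∀
  right : r ℕ.+ wt c ℕ.+ ((M ∸ r) ℕ.+ (K ∸ r)) ℕ.+ r ≡ M ℕ.+ K ℕ.+ wt c
  right = trans (rearrange (wt c) r (M ∸ r) (K ∸ r)) (cong₂ (λ u v → u ℕ.+ v ℕ.+ wt c) (ℕ.m∸n+n≡m r≤M) (ℕ.m∸n+n≡m r≤K))

inChain? : ∀ {n} (ks c : Vec ℕ n) w → Dec (InChain ks c w)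
inChain? ks c w = (wt c ℕ.≤? w) ×-dec (w ℕ.≤? wt c ℕ.+ chainLength ks c)

InChain⇒InRect : ∀ {n} k (ks c : Vec ℕ n) {w y} → y < k → InChain ks c w →
  InRect (chainLength ks c) (k ∸ 1) (y ℕ.+ (w ∸ wt c)) y
InChain⇒InRect k ks c {w} {y} y<k (low , high) =
  ℕ.∸-monoˡ-≤ 1 y<k , ℕ.m≤m+n y (w ∸ wt c) ,
  subst (_≤ chainLength ks c ℕ.+ y) (ℕ.+-comm (w ∸ wt c) y)
    (ℕ.+-monoˡ-≤ y (subst (w ∸ wt c ≤_) (ℕ.m+n∸m≡n (wt c) (chainLength ks c)) (ℕ.∸-monoˡ-≤ (wt c) high)))

ι-offset : ∀ {i w} y → i ≤ w → ι (y ℕ.+ w) - ι i ≡ ι (y ℕ.+ (w ∸ i))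
ι-offset {i} {w} y i≤w = sym (trans (cong ι (sym (ℕ.+-∸-assoc y i≤w))) (ι-∸ (ℕ.≤-trans i≤w (ℕ.m≤n+m w y))))

-- If x is off the chain c, the first factor vanishes. Otherwise (s, y) is a point of the rectangle,
-- and leaving the chain `r ∷ c` puts its sum outside the range of `hahnPoly r`.
chainPoly-zero : ∀ {n} (ks : Vec ℕ n) {c x} → c ∈ chains ks → x ∈ grid ks → ¬ InChain ks c (wt x) → chainPoly ks c x ≡ 0ℚ
chainPoly-zero []       {[]}    {[]}    _   _   outside = contradiction (z≤n , z≤n) outside
chainPoly-zero (k ∷ ks) {r ∷ c} {y ∷ x} rc∈ yx∈ outside = go (∈-chains⁻ k ks rc∈) (∈-grid⁻ k ks yx∈) (inChain? ks c (wt x))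
  where
  M K s : ℕ
  M = chainLength ks c
  K = k ∸ 1
  s = y ℕ.+ (wt x ∸ wt c)
  off-chain : r ≤ M → r ≤ K → wt c ≤ wt x → s < r ⊎ M ℕ.+ K < s ℕ.+ r
  off-chain r≤M r≤K i≤x with r ℕ.≤? s | s ℕ.+ r ℕ.≤? M ℕ.+ K
  ... | no r≰s  | _        = inj₁ (ℕ.≰⇒> r≰s)
  ... | yes _   | no ≰     = inj₂ (ℕ.≰⇒> ≰)
  ... | yes r≤s | yes s+r≤ = contradiction (subst (InChain (k ∷ ks) (r ∷ c)) s+i≡ (InChain-∷ k ks c s r≤M r≤K r≤s s+r≤)) outside
    where
    s+i≡ : s ℕ.+ wt c ≡ y ℕ.+ wt x
    s+i≡ = trans (ℕ.+-assoc y (wt x ∸ wt c) (wt c)) (cong (y ℕ.+_) (ℕ.m∸n+n≡m i≤x))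
  go : c ∈ chains ks × r ≤ M × r ≤ K → y < k × x ∈ grid ks → Dec (InChain ks c (wt x)) → chainPoly (k ∷ ks) (r ∷ c) (y ∷ x) ≡ 0ℚ
  go (c∈ , _) (_ , x∈) (no ∉c) = zero-* (hahnPoly M K r (ι (y ℕ.+ wt x) - ι (wt c)) (ι y)) (chainPoly-zero ks c∈ x∈ ∉c)
  go (_ , r≤M , r≤K) (y<k , _) (yes ∈c) = *-zero (chainPoly ks c x)
    (trans (cong (λ z → hahnPoly M K r z (ι y)) (ι-offset y (proj₁ ∈c)))
      (hahnPoly-zero M K r (InChain⇒InRect k ks c y<k ∈c) (off-chain r≤M r≤K (proj₁ ∈c))))

isPoly-hasLeadʸ : ∀ {n d} {f : Vec ℕ (suc n) → ℚ} j {a g} i → IsPoly d f → HasLeadʸ j a g →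
  IsPoly (j ℕ.+ d) (λ x → f x * g (ι (wt x) - i) (ι (Vec.head x)))
isPoly-hasLeadʸ {f = f} zero {a} i poly g≡a = isPoly-ext (isPoly-*ˡ a poly)
  (λ x → trans (cong (f x *_) (g≡a (ι (wt x) - i) (ι (Vec.head x)))) (ℚ.*-comm (f x) a))
isPoly-hasLeadʸ {f = f} (suc j) {a} {g} i poly (φ , g′ , dφ , l , eq) = isPoly-ext
  (isPoly-+ (isPoly-degBelow (suc j) poly (hasLead-shift (suc (suc j)) i dφ)) (isPoly-head* (isPoly-hasLeadʸ j i poly l)))
  (λ x → trans (cong (f x *_) (eq (ι (wt x) - i) (ι (Vec.head x)))) (rearrange (f x) (φ (ι (wt x) - i)) (ι (Vec.head x)) _))
  where
  rearrange : ∀ f φ y g → f * (φ + y * g) ≡ f * φ + y * (f * g)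
  rearrange = solve-∀ ℚ-ring

chainPoly-isPoly : ∀ {n} (ks : Vec ℕ n) {c} → c ∈ chains ks → IsPoly (wt c) (chainPoly ks c)
chainPoly-isPoly []       {[]}    _   = (1ℚ , []) ∷ [] , z≤n ∷ [] , λ { [] → refl }
chainPoly-isPoly (k ∷ ks) {r ∷ c} rc∈ with ∈-chains⁻ k ks rc∈
... | c∈ , r≤M , r≤K with hahnPoly-hasLeadʸ (chainLength ks c) (k ∸ 1) r≤M r≤K
...   | _ , _ , l = isPoly-ext (isPoly-hasLeadʸ r (ι (wt c)) (isPoly-tail (chainPoly-isPoly ks c∈)) l) (λ { (y ∷ x) → refl })

-- Fixing the first coordinate y cuts the layer w down to the layer w - y of the remaining grid,
-- where the inductive hypothesis kills the combined coefficient of each chain c meeting it. For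
-- fixed c this is a relation among Hahn polynomials at the point (w - wt c, y), and it holds for
-- every y on that line of the rectangle.
chainPoly-independent : ∀ {n} (ks : Vec ℕ n) → VAll.All (2 ≤_) ks → ∀ w (α : Vec ℕ n → ℚ) →
  (∀ {x} → x ∈ grid ks → wt x ≡ w → sumOver (chains ks) (λ c → α c * chainPoly ks c x) ≡ 0ℚ) →
  ∀ {c} → c ∈ chains ks → InChain ks c w → α c ≡ 0ℚ
chainPoly-independent [] _ zero α vanish {[]} _ _ = trans (expand (α [])) (vanish (here refl) refl)
  where
  expand : ∀ a → a ≡ a * 1ℚ + 0ℚ
  expand = solve-∀ ℚ-ring
chainPoly-independent (suc zero ∷ ks) (s≤s () VAll.∷ _)
chainPoly-independent (suc (suc k) ∷ ks) (_ VAll.∷ ks≥2) w α vanish {r ∷ c} rc∈ in-rc with ∈-chains⁻ (suc (suc k)) ks rc∈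
... | c∈ , r≤M , r≤K = hahnPoly-independent M K s (suc (M ⊓ K)) ℕ.≤-refl (λ r → α (r ∷ c)) fibre
    (s≤s (ℕ.⊓-glb r≤M r≤K)) (proj₁ bounds) (proj₂ bounds)
  where
  M K s : ℕ
  M = chainLength ks c
  K = suc k
  s = w ∸ wt c
  i≤w : wt c ≤ w
  i≤w = ℕ.≤-trans (ℕ.m≤n+m (wt c) r) (proj₁ in-rc)
  bounds : r ≤ s × s ℕ.+ r ≤ M ℕ.+ K
  bounds = InChain-∷⁻ (suc (suc k)) ks c s r≤M r≤K (subst (InChain (suc (suc k) ∷ ks) (r ∷ c)) (sym (ℕ.m∸n+n≡m i≤w)) in-rc)
  fibre : ∀ {y} → InRect M K s y → sumBelow (suc (M ⊓ K)) (λ r → α (r ∷ c) * hahnPoly M K r (ι s) (ι y)) ≡ 0ℚ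
  fibre {y} (y≤K , y≤s , s≤M+y) = begin
    sumBelow (suc (M ⊓ K)) (λ r → α (r ∷ c) * hahnPoly M K r (ι s) (ι y))
      ≡⟨ sumBelow-cong (suc (M ⊓ K)) (λ {r} _ → cong (λ z → α (r ∷ c) * hahnPoly M K r z (ι y))
           (trans (ι-∸ i≤w) (cong (λ k → ι k - ι (wt c)) (sym y+w′≡w)))) ⟩
    β c
      ≡⟨ chainPoly-independent ks ks≥2 w′ β β-vanish c∈ in-c ⟩
    0ℚ ∎
    where
    w′ : ℕ
    w′ = w ∸ y
    y≤w : y ≤ w
    y≤w = ℕ.≤-trans y≤s (ℕ.m∸n≤m w (wt c))
    y+w′≡w : y ℕ.+ w′ ≡ w
    y+w′≡w = ℕ.m+[n∸m]≡n y≤w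
    β : Vec ℕ _ → ℚ
    β c = sumBelow (suc (chainLength ks c ⊓ K)) (λ r → α (r ∷ c) * hahnPoly (chainLength ks c) K r (ι (y ℕ.+ w′) - ι (wt c)) (ι y))
    -- The bounds y ≤ s and s ≤ M + y say exactly that w - y lies on the chain c.
    in-c : InChain ks c w′
    in-c = ℕ.+-cancelˡ-≤ y _ _ (subst₂ _≤_ (ℕ.+-comm (wt c) y) (sym y+w′≡w)
             (ℕ.≤-trans (ℕ.+-monoʳ-≤ (wt c) y≤s) (ℕ.≤-reflexive (ℕ.m+[n∸m]≡n i≤w)))) ,
           ℕ.+-cancelˡ-≤ y _ _ (subst₂ _≤_ (trans (ℕ.m∸n+n≡m i≤w) (sym y+w′≡w)) (rearrange M y (wt c))
             (ℕ.+-monoˡ-≤ (wt c) s≤M+y))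
      where
      rearrange : ∀ M y i → M ℕ.+ y ℕ.+ i ≡ y ℕ.+ (i ℕ.+ M)
      rearrange = ℕ-solve-∀
    β-vanish : ∀ {x} → x ∈ grid ks → wt x ≡ w′ → sumOver (chains ks) (λ c → β c * chainPoly ks c x) ≡ 0ℚ
    β-vanish {x} x∈ wtx≡w′ = begin
      sumOver (chains ks) (λ c → β c * chainPoly ks c x)
        ≡⟨ sumOver-cong (chains ks) (λ {c} _ → trans (ℚ.*-comm (β c) (chainPoly ks c x))
             (trans (sym (sumBelow-*ˡ (suc (chainLength ks c ⊓ K)) (chainPoly ks c x) _))
               (sumBelow-cong (suc (chainLength ks c ⊓ K)) (λ {r} _ → swap c r)))) ⟩
      sumOver (chains ks) (λ c → sumBelow (suc (chainLength ks c ⊓ K)) (λ r → α (r ∷ c) * chainPoly (suc (suc k) ∷ ks) (r ∷ c) (y ∷ x)))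
        ≡⟨ sumOver-extend (chains ks) _ ⟨
      sumOver (chains (suc (suc k) ∷ ks)) (λ c → α c * chainPoly (suc (suc k) ∷ ks) c (y ∷ x))
        ≡⟨ vanish (∈-grid⁺ (suc (suc k)) ks (s≤s y≤K) x∈) (trans (cong (y ℕ.+_) wtx≡w′) y+w′≡w) ⟩
      0ℚ ∎
      where
      swap-factors : ∀ p a h → p * (a * h) ≡ a * (p * h)
      swap-factors = solve-∀ ℚ-ring
      swap : ∀ c r → chainPoly ks c x * (α (r ∷ c) * hahnPoly (chainLength ks c) K r (ι (y ℕ.+ w′) - ι (wt c)) (ι y))
        ≡ α (r ∷ c) * chainPoly (suc (suc k) ∷ ks) (r ∷ c) (y ∷ x)
      swap c r = trans (swap-factors (chainPoly ks c x) (α (r ∷ c)) _)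
        (cong (λ v → α (r ∷ c) * (chainPoly ks c x * hahnPoly (chainLength ks c) K r (ι (y ℕ.+ v) - ι (wt c)) (ι y))) (sym wtx≡w′))

-- chainPoly ks c has degree wt c, so the terms of the expansion have total degree less than D.
record Expands {n} (ks : Vec ℕ n) (D : ℕ) (f : Vec ℕ n → ℚ) : Set where
  constructor expands
  field
    coefficients : Vec ℕ n → ℚ → ℚ
    degrees      : ∀ c → DegBelow (D ∸ wt c) (coefficients c)
    expansion    : ∀ {x} → x ∈ grid ks → f x ≡ sumOver (chains ks) (λ c → coefficients c (ι (wt x)) * chainPoly ks c x)

module _ {n} {ks : Vec ℕ n} where

  expands-zero : ∀ D → Expands ks D (λ _ → 0ℚ)
  expands-zero D = expands (λ _ _ → 0ℚ) (λ c → degBelow-zero (D ∸ wt c))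
    (λ {x} _ → sym (sumOver-zero (chains ks) (λ {c} _ → ℚ.*-zeroˡ (chainPoly ks c x))))

  expands-weaken : ∀ {D D′ f} → D ≤ D′ → Expands ks D f → Expands ks D′ f
  expands-weaken D≤D′ (expands q dq eq) = expands q (λ c → degBelow-weaken (ℕ.∸-monoˡ-≤ (wt c) D≤D′) (dq c)) eq

  expands-+ : ∀ {D f g} → Expands ks D f → Expands ks D g → Expands ks D (λ x → f x + g x)
  expands-+ {D} (expands q dq eq) (expands p dp ep) =
    expands (λ c w → q c w + p c w) (λ c → degBelow-+ (D ∸ wt c) (dq c) (dp c)) λ {x} x∈ →
      trans (cong₂ _+_ (eq x∈) (ep x∈)) (trans (sym (sumOver-+ (chains ks) _ _))
        (sumOver-cong (chains ks) (λ {c} _ → sym (ℚ.*-distribʳ-+ (chainPoly ks c x) (q c (ι (wt x))) (p c (ι (wt x)))))))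

  expands-*ˡ : ∀ {D f} a → Expands ks D f → Expands ks D (λ x → a * f x)
  expands-*ˡ {D} a (expands q dq eq) =
    expands (λ c w → a * q c w) (λ c → degBelow-*ˡ (D ∸ wt c) a (dq c)) λ {x} x∈ →
      trans (cong (a *_) (eq x∈)) (trans (sym (sumOver-*ˡ (chains ks) a _))
        (sumOver-cong (chains ks) (λ {c} _ → sym (ℚ.*-assoc a (q c (ι (wt x))) (chainPoly ks c x)))))

inSpan-monomial-∸ : ∀ M K a i e {q} → DegBelow (a ∸ i) q → InSpan M K (a ℕ.+ e ∸ i) (λ s y → y ^ℚ e * q (s - y + ι i))
inSpan-monomial-∸ M K a i e {q} dq with i ℕ.≤? a
... | yes i≤a = subst (λ D → InSpan M K D (λ s y → y ^ℚ e * q (s - y + ι i))) a∸i+e≡ (inSpan-monomial M K (a ∸ i) e (ι i) dq)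
  where
  a∸i+e≡ : a ∸ i ℕ.+ e ≡ a ℕ.+ e ∸ i
  a∸i+e≡ = trans (ℕ.+-comm (a ∸ i) e) (trans (sym (ℕ.+-∸-assoc e i≤a)) (cong (_∸ i) (ℕ.+-comm e a)))
... | no i≰a = inSpan-ext M K (inSpan-zero M K (a ℕ.+ e ∸ i)) (λ {s} {y} _ →
  trans (cong (ι y ^ℚ e *_) (subst (λ D → DegBelow D q) (ℕ.m≤n⇒m∸n≡0 (ℕ.≰⇒≥ i≰a)) dq (ι s - ι y + ι i))) (ℚ.*-zeroʳ (ι y ^ℚ e)))

module _ {n} (k : ℕ) (ks : Vec ℕ n) (e D : ℕ) (c : Vec ℕ n) {q : ℚ → ℚ} (dq : DegBelow (D ∸ wt c) q) where

  private
    M K : ℕ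
    M = chainLength ks c
    K = k ∸ 1
    span : InSpan M K (D ℕ.+ e ∸ wt c) (λ s y → y ^ℚ e * q (s - y + ι (wt c)))
    span = inSpan-monomial-∸ M K D (wt c) e dq

  -- On the rectangle the sum is counted from the start of the chain c; the shift by `wt c` turns
  -- the coefficient into a function of the total weight.
  fibreCoefficient : ℕ → ℚ → ℚ
  fibreCoefficient r w = InSpan.coefficients span r (w - ι (wt c))

  fibreCoefficient-degree : ∀ r → DegBelow (D ℕ.+ e ∸ (r ℕ.+ wt c)) (fibreCoefficient r)
  fibreCoefficient-degree r = subst (λ D → DegBelow D (fibreCoefficient r))
    (trans (ℕ.∸-+-assoc (D ℕ.+ e) (wt c) r) (cong (D ℕ.+ e ∸_) (ℕ.+-comm (wt c) r)))
    (hasLead-shift (D ℕ.+ e ∸ wt c ∸ r) (ι (wt c)) (InSpan.degrees span r))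

  private
    on-chain : ∀ {y} {x : Vec ℕ n} → y < k → InChain ks c (wt x) → ∀ p → ι y ^ℚ e * (q (ι (wt x)) * p) ≡
      sumBelow (suc (M ⊓ K)) (λ r → fibreCoefficient r (ι (y ℕ.+ wt x)) * (p * hahnPoly M K r (ι (y ℕ.+ wt x) - ι (wt c)) (ι y)))
    on-chain {y} {x} y<k ∈c p = begin
      ι y ^ℚ e * (q (ι (wt x)) * p)
        ≡⟨ rotate (ι y ^ℚ e) (q (ι (wt x))) p ⟩
      p * (ι y ^ℚ e * q (ι (wt x)))
        ≡⟨ cong (λ z → p * (ι y ^ℚ e * q z)) back ⟩
      p * (ι y ^ℚ e * q (ι s - ι y + ι (wt c)))
        ≡⟨ cong (p *_) (InSpan.expansion span (InChain⇒InRect k ks c y<k ∈c)) ⟩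
      p * sumBelow (suc (M ⊓ K)) (λ r → InSpan.coefficients span r (ι s) * hahnPoly M K r (ι s) (ι y))
        ≡⟨ sumBelow-*ˡ (suc (M ⊓ K)) p _ ⟨
      sumBelow (suc (M ⊓ K)) (λ r → p * (InSpan.coefficients span r (ι s) * hahnPoly M K r (ι s) (ι y)))
        ≡⟨ sumBelow-cong (suc (M ⊓ K)) (λ {r} _ → swap p (InSpan.coefficients span r (ι s)) (hahnPoly M K r (ι s) (ι y))) ⟩
      sumBelow (suc (M ⊓ K)) (λ r → InSpan.coefficients span r (ι s) * (p * hahnPoly M K r (ι s) (ι y)))
        ≡⟨ cong (λ z → sumBelow (suc (M ⊓ K)) (λ r → InSpan.coefficients span r z * (p * hahnPoly M K r z (ι y)))) (ι-offset y (proj₁ ∈c)) ⟨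
      sumBelow (suc (M ⊓ K)) (λ r → fibreCoefficient r (ι (y ℕ.+ wt x)) * (p * hahnPoly M K r (ι (y ℕ.+ wt x) - ι (wt c)) (ι y))) ∎
      where
      s : ℕ
      s = y ℕ.+ (wt x ∸ wt c)
      rotate : ∀ u v p → u * (v * p) ≡ p * (u * v)
      rotate = solve-∀ ℚ-ring
      swap : ∀ p v h → p * (v * h) ≡ v * (p * h)
      swap = solve-∀ ℚ-ring
      cancel : ∀ w i y → w ≡ y + w - i - y + i
      cancel = solve-∀ ℚ-ring
      back : ι (wt x) ≡ ι s - ι y + ι (wt c)
      back = trans (cancel (ι (wt x)) (ι (wt c)) (ι y))
        (cong (λ z → z - ι y + ι (wt c)) (trans (cong (_- ι (wt c)) (sym (ι-+ y (wt x)))) (ι-offset y (proj₁ ∈c))))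

  -- For x on the chain c the point lies in the rectangle of c and the expansion there applies; for
  -- all other x both sides contain the factor `chainPoly ks c x`, which is zero.
  fibre-expansion : ∀ {y x} → c ∈ chains ks → y < k → x ∈ grid ks → ι y ^ℚ e * (q (ι (wt x)) * chainPoly ks c x) ≡
    sumBelow (suc (M ⊓ K)) (λ r → fibreCoefficient r (ι (y ℕ.+ wt x)) * chainPoly (k ∷ ks) (r ∷ c) (y ∷ x))
  fibre-expansion {y} {x} c∈ y<k x∈ = go (inChain? ks c (wt x))
    where
    go : Dec (InChain ks c (wt x)) → ι y ^ℚ e * (q (ι (wt x)) * chainPoly ks c x) ≡
      sumBelow (suc (M ⊓ K)) (λ r → fibreCoefficient r (ι (y ℕ.+ wt x)) * chainPoly (k ∷ ks) (r ∷ c) (y ∷ x))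
    go (yes ∈c) = on-chain {y} {x} y<k ∈c (chainPoly ks c x)
    go (no ∉c)  = trans (*-zero (ι y ^ℚ e) (*-zero (q (ι (wt x))) cp≡0))
      (sym (sumBelow-zero (suc (M ⊓ K)) (λ {r} _ → *-zero (fibreCoefficient r (ι (y ℕ.+ wt x)))
        (zero-* (hahnPoly M K r (ι (y ℕ.+ wt x) - ι (wt c)) (ι y)) cp≡0))))
      where
      cp≡0 : chainPoly ks c x ≡ 0ℚ
      cp≡0 = chainPoly-zero ks c∈ x∈ ∉c

-- Each term q_c(wt x) h_c(x) is re-expanded on its own rectangle into the chains `r ∷ c`, and over
-- all c these make up the chains of `k ∷ ks`.
expands-∷ : ∀ {n} k (ks : Vec ℕ n) e {D f} → Expands ks D f →
  Expands (k ∷ ks) (D ℕ.+ e) (λ x → ι (Vec.head x) ^ℚ e * f (Vec.tail x))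
expands-∷ k ks e {D} {f} (expands q dq eq) = expands q′ (λ { (r ∷ c) → fibreCoefficient-degree k ks e D c (dq c) r }) expansion
  where
  q′ : Vec ℕ _ → ℚ → ℚ
  q′ (r ∷ c) = fibreCoefficient k ks e D c (dq c) r
  expansion : ∀ {x} → x ∈ grid (k ∷ ks) → ι (Vec.head x) ^ℚ e * f (Vec.tail x) ≡
    sumOver (chains (k ∷ ks)) (λ c → q′ c (ι (wt x)) * chainPoly (k ∷ ks) c x)
  expansion {y ∷ x} yx∈ = begin
    ι y ^ℚ e * f x
      ≡⟨ cong (ι y ^ℚ e *_) (eq x∈) ⟩
    ι y ^ℚ e * sumOver (chains ks) (λ c → q c (ι (wt x)) * chainPoly ks c x)
      ≡⟨ sumOver-*ˡ (chains ks) (ι y ^ℚ e) _ ⟨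
    sumOver (chains ks) (λ c → ι y ^ℚ e * (q c (ι (wt x)) * chainPoly ks c x))
      ≡⟨ sumOver-cong (chains ks) (λ {c} c∈ → fibre-expansion k ks e D c (dq c) {y} {x} c∈ y<k x∈) ⟩
    sumOver (chains ks) (λ c → sumBelow (suc (chainLength ks c ⊓ (k ∸ 1))) (λ r → q′ (r ∷ c) (ι (y ℕ.+ wt x)) * chainPoly (k ∷ ks) (r ∷ c) (y ∷ x)))
      ≡⟨ sumOver-extend (chains ks) _ ⟨
    sumOver (chains (k ∷ ks)) (λ c → q′ c (ι (y ℕ.+ wt x)) * chainPoly (k ∷ ks) c (y ∷ x)) ∎
    where
    y<k : y < k
    y<k = proj₁ (∈-grid⁻ k ks yx∈)
    x∈ : x ∈ grid ks
    x∈ = proj₂ (∈-grid⁻ k ks yx∈)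

expands-ext : ∀ {n} {ks : Vec ℕ n} {D f g} → Expands ks D f → (∀ x → g x ≡ f x) → Expands ks D g
expands-ext (expands q dq eq) g≡f = expands q dq (λ {x} x∈ → trans (g≡f x) (eq x∈))

opaque
  unfolding ι

  expands-monomial : ∀ {n} (ks : Vec ℕ n) e → Expands ks (suc (wt e)) (monoEval e)
  expands-monomial []       []       = expands (λ _ _ → 1ℚ) (λ { [] → degBelow-constant 0 1ℚ }) (λ { {[]} _ → refl })
  expands-monomial (k ∷ ks) (e ∷ es) = expands-ext
    (expands-weaken (ℕ.≤-reflexive (cong suc (ℕ.+-comm (wt es) e))) (expands-∷ k ks e (expands-monomial ks es)))
    (λ { (y ∷ x) → refl })

expands-poly : ∀ {n} (ks : Vec ℕ n) {d} p → DegLe d p → Expands ks (suc d) (evalP p)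
expands-poly ks {d} []            []          = expands-zero (suc d)
expands-poly ks     ((c , e) ∷ p) (e≤d ∷ deg) =
  expands-+ (expands-*ˡ c (expands-weaken (s≤s e≤d) (expands-monomial ks e))) (expands-poly ks p deg)

-- The Hilbert function as a sum over chains

capList-unique : ∀ d E → Unique (capList d E)
capList-unique d E = Unique.filter⁺ (T? ∘ (_∈ᵇ E)) (Unique.upTo⁺ (suc d))

wList-unique : ∀ M d E → Unique (wList M d E)
wList-unique M d E = Unique.filter⁺ (T? ∘ (_∈ᵇ E))
  (Unique.applyUpTo⁺₁ (λ i → suc d ℕ.+ i) (M ∸ d) (λ i<j _ → ℕ.<⇒≢ (ℕ.+-monoʳ-< (suc d) i<j)))

∈-capList⁻ : ∀ {d E w} → w ∈ capList d E → w ≤ d × w ∈ᵇ E ≡ true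
∈-capList⁻ {d} {E} w∈ with ∈-filter⁻ (T? ∘ (_∈ᵇ E)) {xs = upTo (suc d)} w∈
... | w∈upTo , w∈E = s≤s⁻¹ (∈-upTo⁻ w∈upTo) , Equivalence.to T-≡ w∈E

∈-wList⁻ : ∀ {M d E w} → w ∈ wList M d E → d < w × w ∈ᵇ E ≡ true
∈-wList⁻ {M} {d} {E} w∈ with ∈-filter⁻ (T? ∘ (_∈ᵇ E)) {xs = applyUpTo (λ i → suc d ℕ.+ i) (M ∸ d)} w∈
... | w∈upTo , w∈E with ∈-applyUpTo⁻ (λ i → suc d ℕ.+ i) w∈upTo
...   | i , _ , refl = s≤s (ℕ.m≤m+n d i) , Equivalence.to T-≡ w∈E

-- E is a list that may repeat elements. Here each weight is listed once, as interpolation nodes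
-- require, and the cut at d is kept for the counting.
levels : ℕ → ℕ → List ℕ → List ℕ
levels M d E = capList d E ++ wList M d E

levels-unique : ∀ M d E → Unique (levels M d E)
levels-unique M d E = Unique.++⁺ (capList-unique d E) (wList-unique M d E)
  λ (w∈cap , w∈wList) → ℕ.<⇒≱ (proj₁ (∈-wList⁻ {M} {d} {E} w∈wList)) (proj₁ (∈-capList⁻ {d} {E} w∈cap))

∈-levels⁻ : ∀ {M d E w} → w ∈ levels M d E → w ∈ᵇ E ≡ true
∈-levels⁻ {M} {d} {E} w∈ with ∈-++⁻ (capList d E) w∈
... | inj₁ w∈cap = proj₂ (∈-capList⁻ {d} {E} w∈cap)
... | inj₂ w∈wList = proj₂ (∈-wList⁻ {M} {d} {E} w∈wList)

∈-levels⁺ : ∀ {M d E w} → w ≤ M → w ∈ᵇ E ≡ true → w ∈ levels M d E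
∈-levels⁺ {M} {d} {E} {w} w≤M w∈E with w ℕ.≤? d
... | yes w≤d = ∈-++⁺ˡ (∈-filter⁺ (T? ∘ (_∈ᵇ E)) (∈-upTo⁺ (s≤s w≤d)) (Equivalence.from T-≡ w∈E))
... | no  w≰d = ∈-++⁺ʳ (capList d E) (∈-filter⁺ (T? ∘ (_∈ᵇ E))
  (subst (_∈ applyUpTo (λ i → suc d ℕ.+ i) (M ∸ d)) (ℕ.m+[n∸m]≡n d<w) (∈-applyUpTo⁺ (λ i → suc d ℕ.+ i) (ℕ.∸-monoˡ-< (s≤s w≤M) d<w)))
  (Equivalence.from T-≡ w∈E))
  where
  d<w : suc d ≤ w
  d<w = ℕ.≰⇒> w≰d

module _ {n} (ks : Vec ℕ n) (d : ℕ) (E : List ℕ) where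

  chainLevels : Vec ℕ n → List ℕ
  chainLevels c = filter (inChain? ks c) (levels (N ks) d E)

  chainRank : Vec ℕ n → ℕ
  chainRank c = (suc d ∸ wt c) ⊓ length (chainLevels c)

  -- The index `s ∷ c` stands for the s-th Newton polynomial on the chain c; coding the pairs as
  -- vectors lets `extend` and its lemmas serve again.
  basis : List (Vec ℕ (suc n))
  basis = extend chainRank (chains ks)

  basisFunction : Vec ℕ (suc n) → Vec ℕ n → ℚ
  basisFunction (s ∷ c) x = chainPoly ks c x * newton (chainLevels c) s (ι (wt x))

  sumOver-basis : ∀ (α : Vec ℕ (suc n) → ℚ) x → sumOver basis (λ p → α p * basisFunction p x) ≡
    sumOver (chains ks) (λ c → newtonSum (chainLevels c) (chainRank c) (λ s → α (s ∷ c)) (ι (wt x)) * chainPoly ks c x)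
  sumOver-basis α x = trans (sumOver-extend (chains ks) _) (sumOver-cong (chains ks) (λ {c} _ → begin
    sumBelow (chainRank c) (λ s → α (s ∷ c) * basisFunction (s ∷ c) x)
      ≡⟨ sumBelow-cong (chainRank c) (λ {s} _ → rearrange (α (s ∷ c)) (chainPoly ks c x) (newton (chainLevels c) s (ι (wt x)))) ⟩
    sumBelow (chainRank c) (λ s → chainPoly ks c x * (α (s ∷ c) * newton (chainLevels c) s (ι (wt x))))
      ≡⟨ sumBelow-*ˡ (chainRank c) (chainPoly ks c x) _ ⟩
    chainPoly ks c x * newtonSum (chainLevels c) (chainRank c) (λ s → α (s ∷ c)) (ι (wt x))
      ≡⟨ ℚ.*-comm (chainPoly ks c x) _ ⟩
    newtonSum (chainLevels c) (chainRank c) (λ s → α (s ∷ c)) (ι (wt x)) * chainPoly ks c x ∎))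
    where
    rearrange : ∀ a p q → a * (p * q) ≡ p * (a * q)
    rearrange = solve-∀ ℚ-ring

  basis-isPoly : ∀ {p} → p ∈ basis → IsPoly d (basisFunction p)
  basis-isPoly {s ∷ c} p∈ with ∈-extend⁻ {cs = chains ks} p∈
  ... | c∈ , s<rank = isPoly-weaken s+wt≤d (isPoly-degBelow s (chainPoly-isPoly ks c∈) (newton-degBelow (chainLevels c) s))
    where
    s< : s < suc d ∸ wt c
    s< = ℕ.≤-trans s<rank (ℕ.m⊓n≤m _ _)
    s+wt≤d : s ℕ.+ wt c ≤ d
    s+wt≤d = s≤s⁻¹ (ℕ.m≤o∸n⇒m+n≤o (suc s) (ℕ.<⇒≤ (ℕ.m∸n≢0⇒n<m (ℕ.m<n⇒n≢0 s<))) s<)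

  -- On the layer of weight w the Newton polynomials are constants, so independence of the h_c on
  -- that layer annihilates the Newton sum at w for each chain through w. As w runs over the levels
  -- of one chain, Newton independence annihilates its coefficients.
  basis-independent : VAll.All (2 ≤_) ks → ∀ (α : Vec ℕ (suc n) → ℚ) →
    (∀ x → InLayers ks E x → sumOver basis (λ p → α p * basisFunction p x) ≡ 0ℚ) → ∀ {p} → p ∈ basis → α p ≡ 0ℚ
  basis-independent ks≥2 α vanish {s ∷ c} p∈ with ∈-extend⁻ {cs = chains ks} p∈
  ... | c∈ , s<rank = newton-independent (Unique.filter⁺ (inChain? ks c) (levels-unique (N ks) d E))
    (chainRank c) (ℕ.m⊓n≤n (suc d ∸ wt c) _) (λ s → α (s ∷ c)) on-level s<rank
    where
    on-level : ∀ {w} → w ∈ chainLevels c → newtonSum (chainLevels c) (chainRank c) (λ s → α (s ∷ c)) (ι w) ≡ 0ℚ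
    on-level {w} w∈ with ∈-filter⁻ (inChain? ks c) {xs = levels (N ks) d E} w∈
    ... | w∈levels , w∈c = chainPoly-independent ks ks≥2 w
      (λ c → newtonSum (chainLevels c) (chainRank c) (λ s → α (s ∷ c)) (ι w))
      (λ { {x} x∈ refl → trans (sym (sumOver-basis α x)) (vanish x (x∈ , ∈-levels⁻ {N ks} {d} {E} w∈levels)) })
      c∈ w∈c

  -- Only the values of q_c at the weights of E on the chain c matter, since h_c vanishes on the
  -- other layers; so q_c may be replaced by its Newton interpolant at these weights.
  basis-spans : ∀ p → DegLe d p →
    ∃ λ a → ∀ x → InLayers ks E x → evalP p x ≡ sumOver basis (λ p → a p * basisFunction p x)
  basis-spans p deg with expands-poly ks p deg
  ... | expands q dq eq = a , λ x (x∈ , wtx∈E) → trans (eq x∈) (trans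
      (sumOver-cong (chains ks) (λ {c} c∈ → on-chain c∈ x∈ wtx∈E)) (sym (sumOver-basis a x)))
    where
    interpolant : ∀ c → ∃ λ a → ∀ {e} → e ∈ chainLevels c → q c (ι e) ≡ newtonSum (chainLevels c) (chainRank c) a (ι e)
    interpolant c = newton-interpolate (suc d ∸ wt c) (chainLevels c) (dq c)
    a : Vec ℕ (suc n) → ℚ
    a (s ∷ c) = proj₁ (interpolant c) s
    on-chain : ∀ {c x} → c ∈ chains ks → x ∈ grid ks → wt x ∈ᵇ E ≡ true → q c (ι (wt x)) * chainPoly ks c x ≡
      newtonSum (chainLevels c) (chainRank c) (λ s → a (s ∷ c)) (ι (wt x)) * chainPoly ks c x
    on-chain {c} {x} c∈ x∈ wtx∈E with inChain? ks c (wt x)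
    ... | yes ∈c = cong (_* chainPoly ks c x) (proj₂ (interpolant c)
      (∈-filter⁺ (inChain? ks c) (∈-levels⁺ {N ks} {d} {E} (grid-wt ks x∈) wtx∈E) ∈c))
    ... | no ∉c = trans (times-zero (q c (ι (wt x))) cp≡0) (sym (times-zero (newtonSum (chainLevels c) (chainRank c) (λ s → a (s ∷ c)) (ι (wt x))) cp≡0))
      where
      cp≡0 : chainPoly ks c x ≡ 0ℚ
      cp≡0 = chainPoly-zero ks c∈ x∈ ∉c
      times-zero : ∀ z {p} → p ≡ 0ℚ → z * p ≡ 0ℚ
      times-zero z refl = ℚ.*-zeroʳ z

  hilbertDim-chains : VAll.All (2 ≤_) ks → HilbertDim d (InLayers ks E) (sum (map chainRank (chains ks)))
  hilbertDim-chains ks≥2 = subst (HilbertDim d (InLayers ks E)) (length-extend (chains ks))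
    ( ( (λ j → proj₁ (poly j)) , (λ j → proj₁ (proj₂ (poly j)))
      , linIndepOn-lookup (Vec.≡-dec ℕ._≟_) (extend-unique (chains-unique ks)) basisFunction (basis-independent ks≥2)
          (λ j → proj₁ (poly j)) (λ j → proj₂ (proj₂ (poly j))))
    , λ (f , deg , indep) → dependent-of-small-span f basis basisFunction ℕ.≤-refl (λ j → basis-spans (f j) (deg j)) indep)
    where
    poly : ∀ j → IsPoly d (basisFunction (lookup basis j))
    poly j = basis-isPoly (∈-lookup j)

-- Counting

∑ : ∀ {A : Set} → List A → (A → ℕ) → ℕ
∑ xs f = sum (map f xs)

∑< : ℕ → (ℕ → ℕ) → ℕ
∑< m f = sum (applyUpTo f m)

module _ {A : Set} where

  ∑-cong : ∀ (xs : List A) {f g} → (∀ {x} → x ∈ xs → f x ≡ g x) → ∑ xs f ≡ ∑ xs g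
  ∑-cong []       eq = refl
  ∑-cong (x ∷ xs) eq = cong₂ ℕ._+_ (eq (here refl)) (∑-cong xs (eq ∘ there))

  ∑-mono : ∀ (xs : List A) {f g} → (∀ {x} → x ∈ xs → f x ≤ g x) → ∑ xs f ≤ ∑ xs g
  ∑-mono []       le = z≤n
  ∑-mono (x ∷ xs) le = ℕ.+-mono-≤ (le (here refl)) (∑-mono xs (le ∘ there))

  ∑-zero : ∀ (xs : List A) {f} → (∀ {x} → x ∈ xs → f x ≡ 0) → ∑ xs f ≡ 0
  ∑-zero []       eq = refl
  ∑-zero (x ∷ xs) eq = cong₂ ℕ._+_ (eq (here refl)) (∑-zero xs (eq ∘ there))

  ∑-++ : ∀ (xs ys : List A) f → ∑ (xs ++ ys) f ≡ ∑ xs f ℕ.+ ∑ ys f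
  ∑-++ xs ys f = trans (cong sum (List.map-++ f xs ys)) (sum-++ (map f xs) (map f ys))

  ∑-+ : ∀ (xs : List A) f g → ∑ xs (λ x → f x ℕ.+ g x) ≡ ∑ xs f ℕ.+ ∑ xs g
  ∑-+ []       f g = refl
  ∑-+ (x ∷ xs) f g = trans (cong (f x ℕ.+ g x ℕ.+_) (∑-+ xs f g)) (interchange (f x) (g x) _ _)
    where
    interchange : ∀ a b c d → a ℕ.+ b ℕ.+ (c ℕ.+ d) ≡ a ℕ.+ c ℕ.+ (b ℕ.+ d)
    interchange = ℕ-solve-∀

  ∑-map : ∀ {B : Set} (g : B → A) xs f → ∑ (map g xs) f ≡ ∑ xs (f ∘ g)
  ∑-map g xs f = cong sum (sym (List.map-∘ xs))

  ∑-concatMap : ∀ {B : Set} (g : B → List A) xs f → ∑ (concatMap g xs) f ≡ ∑ xs (λ x → ∑ (g x) f)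
  ∑-concatMap g []       f = refl
  ∑-concatMap g (x ∷ xs) f = trans (∑-++ (g x) (concatMap g xs) f) (cong (∑ (g x) f ℕ.+_) (∑-concatMap g xs f))

∑-swap : ∀ {A B : Set} (xs : List A) (ys : List B) (f : A → B → ℕ) → ∑ xs (λ x → ∑ ys (f x)) ≡ ∑ ys (λ y → ∑ xs (λ x → f x y))
∑-swap []       ys f = sym (∑-zero ys (λ _ → refl))
∑-swap (x ∷ xs) ys f = trans (cong (∑ ys (f x) ℕ.+_) (∑-swap xs ys f)) (sym (∑-+ ys (f x) _))

∑-zipWith : ∀ {A B C : Set} (xs : List A) (ys : List B) (zs : List C) (f : A → B → C → ℕ) →
  sum (zipWith (λ x y → ∑ zs (f x y)) xs ys) ≡ ∑ zs (λ z → sum (zipWith (λ x y → f x y z) xs ys))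
∑-zipWith []       ys       zs f = sym (∑-zero zs (λ _ → refl))
∑-zipWith (x ∷ xs) []       zs f = sym (∑-zero zs (λ _ → refl))
∑-zipWith (x ∷ xs) (y ∷ ys) zs f = trans (cong (∑ zs (f x y) ℕ.+_) (∑-zipWith xs ys zs f)) (sym (∑-+ zs (f x y) _))

∑-upTo : ∀ m f → ∑ (upTo m) f ≡ ∑< m f
∑-upTo m f = cong sum (List.map-upTo f m)

∑<-suc : ∀ m f → ∑< (suc m) f ≡ ∑< m f ℕ.+ f m
∑<-suc m f = trans (cong sum (sym (List.applyUpTo-∷ʳ f m)))
  (trans (sum-++ (applyUpTo f m) (f m ∷ [])) (cong (∑< m f ℕ.+_) (ℕ.+-identityʳ (f m))))

∑<-cong : ∀ m {f g} → (∀ i → f i ≡ g i) → ∑< m f ≡ ∑< m g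
∑<-cong zero    eq = refl
∑<-cong (suc m) eq = cong₂ ℕ._+_ (eq 0) (∑<-cong m (eq ∘ suc))

∑<-zero : ∀ m {f} → (∀ i → f i ≡ 0) → ∑< m f ≡ 0
∑<-zero zero    eq = refl
∑<-zero (suc m) eq = cong₂ ℕ._+_ (eq 0) (∑<-zero m (eq ∘ suc))

∑-extend : ∀ {n} {g : Vec ℕ n → ℕ} cs f → ∑ (extend g cs) f ≡ ∑ cs (λ c → ∑< (g c) (λ r → f (r ∷ c)))
∑-extend {g = g} cs f = trans (∑-concatMap (λ c → map (_∷ c) (upTo (g c))) cs f)
  (∑-cong cs (λ {c} _ → trans (∑-map (_∷ c) (upTo (g c)) f) (∑-upTo (g c) (λ r → f (r ∷ c)))))

indicator : ∀ {P : Set} → Dec P → ℕ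
indicator P? = if does P? then 1 else 0

indicator-⇔ : ∀ {P Q : Set} (P? : Dec P) (Q? : Dec Q) → (P → Q) → (Q → P) → indicator P? ≡ indicator Q?
indicator-⇔ (yes _)  (yes _)  _   _   = refl
indicator-⇔ (no _)   (no _)   _   _   = refl
indicator-⇔ (yes p)  (no ¬q)  p→q _   = contradiction (p→q p) ¬q
indicator-⇔ (no ¬p)  (yes q)  _   q→p = contradiction (q→p q) ¬p

indicator-yes : ∀ {P : Set} (P? : Dec P) → P → indicator P? ≡ 1
indicator-yes (yes _) _ = refl
indicator-yes (no ¬p) p = contradiction p ¬p

indicator-no : ∀ {P : Set} (P? : Dec P) → ¬ P → indicator P? ≡ 0
indicator-no (yes p) ¬p = contradiction p ¬p
indicator-no (no _)  _  = refl

indicator-mono : ∀ {P Q : Set} (P? : Dec P) (Q? : Dec Q) → (P → Q) → indicator P? ≤ indicator Q?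
indicator-mono (yes p) Q? p→q = ℕ.≤-reflexive (sym (indicator-yes Q? (p→q p)))
indicator-mono (no _)  _  _   = z≤n

length-filter-∑ : ∀ {A : Set} {P : A → Set} (P? : ∀ x → Dec (P x)) xs → length (filter P? xs) ≡ ∑ xs (indicator ∘ P?)
length-filter-∑ P? []       = refl
length-filter-∑ P? (x ∷ xs) with does (P? x)
... | true  = cong suc (length-filter-∑ P? xs)
... | false = length-filter-∑ P? xs

∑-filterᵇ-split : ∀ {A : Set} (p : A → Bool) xs f → ∑ (filterᵇ p xs) f ℕ.+ ∑ (filterᵇ (not ∘ p) xs) f ≡ ∑ xs f
∑-filterᵇ-split p []       f = refl
∑-filterᵇ-split p (x ∷ xs) f with p x
... | true  = trans (ℕ.+-assoc (f x) _ _) (cong (f x ℕ.+_) (∑-filterᵇ-split p xs f))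
... | false = trans (swap (∑ (filterᵇ p xs) f) (f x) _) (cong (f x ℕ.+_) (∑-filterᵇ-split p xs f))
  where
  swap : ∀ a b c → a ℕ.+ (b ℕ.+ c) ≡ b ℕ.+ (a ℕ.+ c)
  swap = ℕ-solve-∀

-- Layer sizes as numbers of chains

diagonal-count : ∀ s m → ∑< m (λ a → indicator ((a ℕ.≤? s) ×-dec (s ℕ.≤? a ℕ.+ 0))) ≡ indicator (suc s ℕ.≤? m)
diagonal-count s zero    = refl
diagonal-count s (suc m) = trans (∑<-suc m _) (trans (cong (ℕ._+ indicator ((m ℕ.≤? s) ×-dec (s ℕ.≤? m ℕ.+ 0))) (diagonal-count s m)) step)
  where
  s≤m+0 : s ≡ m → s ≤ m ℕ.+ 0
  s≤m+0 refl = ℕ.m≤m+n m 0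
  step : indicator (suc s ℕ.≤? m) ℕ.+ indicator ((m ℕ.≤? s) ×-dec (s ℕ.≤? m ℕ.+ 0)) ≡ indicator (suc s ℕ.≤? suc m)
  step with ℕ.<-cmp s m
  ... | tri< s<m _ _ = trans (cong₂ ℕ._+_ (indicator-yes (suc s ℕ.≤? m) s<m)
      (indicator-no ((m ℕ.≤? s) ×-dec (s ℕ.≤? m ℕ.+ 0)) (ℕ.<⇒≱ s<m ∘ proj₁)))
      (sym (indicator-yes (suc s ℕ.≤? suc m) (ℕ.m≤n⇒m≤1+n s<m)))
  ... | tri≈ s≮m s≡m _ = trans (cong₂ ℕ._+_ (indicator-no (suc s ℕ.≤? m) s≮m)
      (indicator-yes ((m ℕ.≤? s) ×-dec (s ℕ.≤? m ℕ.+ 0)) (ℕ.≤-reflexive (sym s≡m) , s≤m+0 s≡m)))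
      (sym (indicator-yes (suc s ℕ.≤? suc m) (s≤s (ℕ.≤-reflexive s≡m))))
  ... | tri> s≮m _ m<s = trans (cong₂ ℕ._+_ (indicator-no (suc s ℕ.≤? m) s≮m)
      (indicator-no ((m ℕ.≤? s) ×-dec (s ℕ.≤? m ℕ.+ 0)) (λ (_ , s≤) → ℕ.<⇒≱ m<s (subst (s ≤_) (ℕ.+-identityʳ m) s≤))))
      (sym (indicator-no (suc s ℕ.≤? suc m) (ℕ.<⇒≱ (s≤s m<s))))

-- Lengthening the interval [b, b + M] by one adds the single point b + M + 1. Over all b < m these
-- points fill (M, m + M], which is the difference of the two outer indicators.
telescope : ∀ M s m →
  indicator (s ℕ.≤? M) ℕ.+ ∑< m (λ b → indicator ((b ℕ.≤? s) ×-dec (s ℕ.≤? suc b ℕ.+ M))) ≡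
  indicator (s ℕ.≤? m ℕ.+ M) ℕ.+ ∑< m (λ b → indicator ((b ℕ.≤? s) ×-dec (s ℕ.≤? b ℕ.+ M)))
telescope M s zero    = refl
telescope M s (suc m) = begin
  A ℕ.+ ∑< (suc m) f          ≡⟨ cong (A ℕ.+_) (∑<-suc m f) ⟩
  A ℕ.+ (∑< m f ℕ.+ f m)      ≡⟨ ℕ.+-assoc A _ _ ⟨
  A ℕ.+ ∑< m f ℕ.+ f m        ≡⟨ cong (ℕ._+ f m) (telescope M s m) ⟩
  B ℕ.+ ∑< m g ℕ.+ f m        ≡⟨ swap B (∑< m g) (f m) ⟩
  B ℕ.+ f m ℕ.+ ∑< m g        ≡⟨ cong (ℕ._+ ∑< m g) step ⟩
  C ℕ.+ g m ℕ.+ ∑< m g        ≡⟨ swap C (g m) (∑< m g) ⟩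
  C ℕ.+ ∑< m g ℕ.+ g m        ≡⟨ ℕ.+-assoc C _ _ ⟩
  C ℕ.+ (∑< m g ℕ.+ g m)      ≡⟨ cong (C ℕ.+_) (∑<-suc m g) ⟨
  C ℕ.+ ∑< (suc m) g          ∎
  where
  A B C : ℕ
  A = indicator (s ℕ.≤? M)
  B = indicator (s ℕ.≤? m ℕ.+ M)
  C = indicator (s ℕ.≤? suc m ℕ.+ M)
  f g : ℕ → ℕ
  f b = indicator ((b ℕ.≤? s) ×-dec (s ℕ.≤? suc b ℕ.+ M))
  g b = indicator ((b ℕ.≤? s) ×-dec (s ℕ.≤? b ℕ.+ M))
  swap : ∀ x y z → x ℕ.+ y ℕ.+ z ≡ x ℕ.+ z ℕ.+ y
  swap = ℕ-solve-∀
  step : B ℕ.+ f m ≡ C ℕ.+ g m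
  step with m ℕ.≤? s
  ... | yes m≤s = trans (ℕ.+-comm B (f m)) (cong₂ ℕ._+_
    (indicator-⇔ ((m ℕ.≤? s) ×-dec (s ℕ.≤? suc m ℕ.+ M)) (s ℕ.≤? suc m ℕ.+ M) proj₂ (m≤s ,_))
    (indicator-⇔ (s ℕ.≤? m ℕ.+ M) ((m ℕ.≤? s) ×-dec (s ℕ.≤? m ℕ.+ M)) (m≤s ,_) proj₂))
  ... | no m≰s = cong₂ ℕ._+_
    (trans (indicator-yes (s ℕ.≤? m ℕ.+ M) s≤m+M) (sym (indicator-yes (s ℕ.≤? suc m ℕ.+ M) (ℕ.m≤n⇒m≤1+n s≤m+M))))
    (trans (indicator-no ((m ℕ.≤? s) ×-dec (s ℕ.≤? suc m ℕ.+ M)) (m≰s ∘ proj₁)) (sym (indicator-no ((m ℕ.≤? s) ×-dec (s ℕ.≤? m ℕ.+ M)) (m≰s ∘ proj₁))))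
    where
    s≤m+M : s ≤ m ℕ.+ M
    s≤m+M = ℕ.≤-trans (ℕ.≰⇒≥ m≰s) (ℕ.m≤m+n m M)

-- The r = 0 chain of [0,M+1] × [0,K+1] is its boundary hook; the others are those of [0,M] × [0,K].
rect-count : ∀ M K s → ∑< (suc K) (λ a → indicator ((a ℕ.≤? s) ×-dec (s ℕ.≤? a ℕ.+ M))) ≡
  ∑< (suc (M ⊓ K)) (λ r → indicator ((r ℕ.≤? s) ×-dec (s ℕ.≤? r ℕ.+ ((M ∸ r) ℕ.+ (K ∸ r)))))
rect-count zero K s = trans (diagonal-count s (suc K)) (trans
  (indicator-⇔ (suc s ℕ.≤? suc K) ((0 ℕ.≤? s) ×-dec (s ℕ.≤? K)) (λ s<1+K → z≤n , s≤s⁻¹ s<1+K) (λ (_ , s≤K) → s≤s s≤K))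
  (sym (ℕ.+-identityʳ _)))
rect-count (suc M) zero s = cong (ℕ._+ 0) (indicator-⇔ ((0 ℕ.≤? s) ×-dec (s ℕ.≤? suc M)) ((0 ℕ.≤? s) ×-dec (s ℕ.≤? suc M ℕ.+ 0))
  (λ (_ , s≤) → z≤n , subst (s ≤_) (sym (ℕ.+-identityʳ (suc M))) s≤) (λ (_ , s≤) → z≤n , subst (s ≤_) (ℕ.+-identityʳ (suc M)) s≤))
rect-count (suc M) (suc K) zero = cong₂ ℕ._+_
  (indicator-⇔ ((0 ℕ.≤? 0) ×-dec (0 ℕ.≤? suc M)) ((0 ℕ.≤? 0) ×-dec (0 ℕ.≤? suc M ℕ.+ suc K)) (λ _ → z≤n , z≤n) (λ _ → z≤n , z≤n))
  (trans (∑<-zero (suc K) (λ a → indicator-no ((suc a ℕ.≤? 0) ×-dec (0 ℕ.≤? suc a ℕ.+ suc M)) λ ()))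
    (sym (∑<-zero (suc (M ⊓ K)) (λ r → indicator-no ((suc r ℕ.≤? 0) ×-dec (0 ℕ.≤? suc r ℕ.+ ((M ∸ r) ℕ.+ (K ∸ r)))) λ ()))))
rect-count (suc M) (suc K) (suc s) = begin
  indicator ((0 ℕ.≤? suc s) ×-dec (suc s ℕ.≤? suc M)) ℕ.+ ∑< (suc K) (λ a → indicator ((suc a ℕ.≤? suc s) ×-dec (suc s ℕ.≤? suc a ℕ.+ suc M)))
    ≡⟨ cong₂ ℕ._+_
         (indicator-⇔ ((0 ℕ.≤? suc s) ×-dec (suc s ℕ.≤? suc M)) (s ℕ.≤? M) (s≤s⁻¹ ∘ proj₂) (λ s≤M → z≤n , s≤s s≤M))
         (∑<-cong (suc K) (λ a → indicator-⇔ ((suc a ℕ.≤? suc s) ×-dec (suc s ℕ.≤? suc a ℕ.+ suc M)) ((a ℕ.≤? s) ×-dec (s ℕ.≤? suc a ℕ.+ M))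
           (λ (a≤ , s≤) → s≤s⁻¹ a≤ , subst (s ≤_) (ℕ.+-suc a M) (s≤s⁻¹ s≤))
           (λ (a≤ , s≤) → s≤s a≤ , s≤s (subst (s ≤_) (sym (ℕ.+-suc a M)) s≤)))) ⟩
  indicator (s ℕ.≤? M) ℕ.+ ∑< (suc K) (λ a → indicator ((a ℕ.≤? s) ×-dec (s ℕ.≤? suc a ℕ.+ M)))
    -- The last points of the rows after the first, joined to the first row, form one interval, the
    -- hook; the rows of [0,M] × [0,K] are left over.
    ≡⟨ telescope M s (suc K) ⟩
  indicator (s ℕ.≤? suc K ℕ.+ M) ℕ.+ ∑< (suc K) (λ a → indicator ((a ℕ.≤? s) ×-dec (s ℕ.≤? a ℕ.+ M)))
    ≡⟨ cong₂ ℕ._+_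
         (indicator-⇔ (s ℕ.≤? suc K ℕ.+ M) ((0 ℕ.≤? suc s) ×-dec (suc s ℕ.≤? suc M ℕ.+ suc K))
           (λ s≤ → z≤n , s≤s (subst (s ≤_) (ℕ.+-comm (suc K) M) s≤)) (λ (_ , s≤) → subst (s ≤_) (ℕ.+-comm M (suc K)) (s≤s⁻¹ s≤)))
         (rect-count M K s) ⟩
  indicator ((0 ℕ.≤? suc s) ×-dec (suc s ℕ.≤? suc M ℕ.+ suc K)) ℕ.+
    ∑< (suc (M ⊓ K)) (λ r → indicator ((r ℕ.≤? s) ×-dec (s ℕ.≤? r ℕ.+ ((M ∸ r) ℕ.+ (K ∸ r)))))
    ≡⟨ cong (indicator ((0 ℕ.≤? suc s) ×-dec (suc s ℕ.≤? suc M ℕ.+ suc K)) ℕ.+_)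
         (∑<-cong (suc (M ⊓ K)) (λ r → indicator-⇔ ((r ℕ.≤? s) ×-dec (s ℕ.≤? r ℕ.+ ((M ∸ r) ℕ.+ (K ∸ r))))
           ((suc r ℕ.≤? suc s) ×-dec (suc s ℕ.≤? suc r ℕ.+ ((M ∸ r) ℕ.+ (K ∸ r))))
           (λ (r≤ , s≤) → s≤s r≤ , s≤s s≤) (λ (r≤ , s≤) → s≤s⁻¹ r≤ , s≤s⁻¹ s≤))) ⟩
  indicator ((0 ℕ.≤? suc s) ×-dec (suc s ℕ.≤? suc M ℕ.+ suc K)) ℕ.+
    ∑< (suc (M ⊓ K)) (λ r → indicator ((suc r ℕ.≤? suc s) ×-dec (suc s ℕ.≤? suc r ℕ.+ ((M ∸ r) ℕ.+ (K ∸ r))))) ∎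

-- A translate of `rect-count` by i: on the left the chain [i, i + M] is shifted by each first
-- coordinate a, on the right stand the chains of the rectangle. Both sides vanish for w < i.
fibre-count : ∀ i M K w → ∑< (suc K) (λ a → indicator ((a ℕ.+ i ℕ.≤? w) ×-dec (w ℕ.≤? a ℕ.+ (i ℕ.+ M)))) ≡
  ∑< (suc (M ⊓ K)) (λ r → indicator ((r ℕ.+ i ℕ.≤? w) ×-dec (w ℕ.≤? r ℕ.+ i ℕ.+ ((M ∸ r) ℕ.+ (K ∸ r)))))
fibre-count i M K w with i ℕ.≤? w
... | no i≰w = trans
  (∑<-zero (suc K) (λ a → indicator-no ((a ℕ.+ i ℕ.≤? w) ×-dec (w ℕ.≤? a ℕ.+ (i ℕ.+ M))) (i≰w ∘ ℕ.m+n≤o⇒n≤o a ∘ proj₁)))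
  (sym (∑<-zero (suc (M ⊓ K)) (λ r → indicator-no ((r ℕ.+ i ℕ.≤? w) ×-dec (w ℕ.≤? r ℕ.+ i ℕ.+ ((M ∸ r) ℕ.+ (K ∸ r)))) (i≰w ∘ ℕ.m+n≤o⇒n≤o r ∘ proj₁))))
... | yes i≤w = subst (λ w → ∑< (suc K) (λ a → indicator ((a ℕ.+ i ℕ.≤? w) ×-dec (w ℕ.≤? a ℕ.+ (i ℕ.+ M)))) ≡
    ∑< (suc (M ⊓ K)) (λ r → indicator ((r ℕ.+ i ℕ.≤? w) ×-dec (w ℕ.≤? r ℕ.+ i ℕ.+ ((M ∸ r) ℕ.+ (K ∸ r))))))
  (ℕ.m∸n+n≡m i≤w) (begin
    ∑< (suc K) (λ a → indicator ((a ℕ.+ i ℕ.≤? s ℕ.+ i) ×-dec (s ℕ.+ i ℕ.≤? a ℕ.+ (i ℕ.+ M))))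
      ≡⟨ ∑<-cong (suc K) (λ a → indicator-⇔ ((a ℕ.+ i ℕ.≤? s ℕ.+ i) ×-dec (s ℕ.+ i ℕ.≤? a ℕ.+ (i ℕ.+ M))) ((a ℕ.≤? s) ×-dec (s ℕ.≤? a ℕ.+ M))
           (λ (low , high) → ℕ.+-cancelʳ-≤ i a s low , ℕ.+-cancelʳ-≤ i s (a ℕ.+ M) (subst (s ℕ.+ i ≤_) (rearrange a i M) high))
           (λ (low , high) → ℕ.+-monoˡ-≤ i low , subst (s ℕ.+ i ≤_) (sym (rearrange a i M)) (ℕ.+-monoˡ-≤ i high))) ⟩
    ∑< (suc K) (λ a → indicator ((a ℕ.≤? s) ×-dec (s ℕ.≤? a ℕ.+ M)))
      ≡⟨ rect-count M K s ⟩
    ∑< (suc (M ⊓ K)) (λ r → indicator ((r ℕ.≤? s) ×-dec (s ℕ.≤? r ℕ.+ ((M ∸ r) ℕ.+ (K ∸ r)))))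
      ≡⟨ ∑<-cong (suc (M ⊓ K)) (λ r → indicator-⇔ ((r ℕ.≤? s) ×-dec (s ℕ.≤? r ℕ.+ ((M ∸ r) ℕ.+ (K ∸ r))))
           ((r ℕ.+ i ℕ.≤? s ℕ.+ i) ×-dec (s ℕ.+ i ℕ.≤? r ℕ.+ i ℕ.+ ((M ∸ r) ℕ.+ (K ∸ r))))
           (λ (low , high) → ℕ.+-monoˡ-≤ i low , subst (s ℕ.+ i ≤_) (swap r ((M ∸ r) ℕ.+ (K ∸ r)) i) (ℕ.+-monoˡ-≤ i high))
           (λ (low , high) → ℕ.+-cancelʳ-≤ i r s low , ℕ.+-cancelʳ-≤ i s _ (subst (s ℕ.+ i ≤_) (sym (swap r ((M ∸ r) ℕ.+ (K ∸ r)) i)) high))) ⟩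
    ∑< (suc (M ⊓ K)) (λ r → indicator ((r ℕ.+ i ℕ.≤? s ℕ.+ i) ×-dec (s ℕ.+ i ℕ.≤? r ℕ.+ i ℕ.+ ((M ∸ r) ℕ.+ (K ∸ r))))) ∎)
  where
  s : ℕ
  s = w ∸ i
  rearrange : ∀ a i M → a ℕ.+ (i ℕ.+ M) ≡ a ℕ.+ M ℕ.+ i
  rearrange = ℕ-solve-∀
  swap : ∀ r u i → r ℕ.+ u ℕ.+ i ≡ r ℕ.+ i ℕ.+ u
  swap = ℕ-solve-∀

layer-∑ : ∀ {n} (ks : Vec ℕ n) w → layer ks w ≡ ∑ (grid ks) (λ x → indicator (wt x ℕ.≟ w))
layer-∑ ks w = length-filter-∑ (λ x → T? (does (wt x ℕ.≟ w))) (grid ks)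

-- The first coordinate a cuts a layer into layers of the smaller grid, which are counted by chains.
-- After exchanging the sums, the shifts of each single chain are regrouped by `fibre-count`.
layer-chains : ∀ {n} (ks : Vec ℕ n) → VAll.All (2 ≤_) ks → ∀ w →
  layer ks w ≡ ∑ (chains ks) (λ c → indicator (inChain? ks c w))
layer-chains []           _ zero    = refl
layer-chains []           _ (suc w) = refl
layer-chains (suc K ∷ ks) (_ VAll.∷ ks≥2) w = begin
  layer (suc K ∷ ks) w
    ≡⟨ layer-∑ (suc K ∷ ks) w ⟩
  ∑ (grid (suc K ∷ ks)) (λ x → indicator (wt x ℕ.≟ w))
    ≡⟨ ∑-concatMap (λ a → map (a ∷_) (grid ks)) (upTo (suc K)) _ ⟩
  ∑ (upTo (suc K)) (λ a → ∑ (map (a ∷_) (grid ks)) (λ x → indicator (wt x ℕ.≟ w)))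
    ≡⟨ ∑-cong (upTo (suc K)) (λ {a} _ → trans (∑-map (a ∷_) (grid ks) _) (slice a)) ⟩
  ∑ (upTo (suc K)) (λ a → ∑ (chains ks) (λ c → indicator ((a ℕ.+ wt c ℕ.≤? w) ×-dec (w ℕ.≤? a ℕ.+ (wt c ℕ.+ chainLength ks c)))))
    ≡⟨ ∑-swap (upTo (suc K)) (chains ks) _ ⟩
  ∑ (chains ks) (λ c → ∑ (upTo (suc K)) (λ a → indicator ((a ℕ.+ wt c ℕ.≤? w) ×-dec (w ℕ.≤? a ℕ.+ (wt c ℕ.+ chainLength ks c)))))
    ≡⟨ ∑-cong (chains ks) (λ {c} _ → trans (∑-upTo (suc K) _) (fibre-count (wt c) (chainLength ks c) K w)) ⟩
  ∑ (chains ks) (λ c → ∑< (suc (chainLength ks c ⊓ K)) (λ r → indicator (inChain? (suc K ∷ ks) (r ∷ c) w)))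
    ≡⟨ ∑-extend (chains ks) _ ⟨
  ∑ (chains (suc K ∷ ks)) (λ c → indicator (inChain? (suc K ∷ ks) c w)) ∎
  where
  slice : ∀ a → ∑ (grid ks) (λ x → indicator (a ℕ.+ wt x ℕ.≟ w)) ≡
    ∑ (chains ks) (λ c → indicator ((a ℕ.+ wt c ℕ.≤? w) ×-dec (w ℕ.≤? a ℕ.+ (wt c ℕ.+ chainLength ks c))))
  slice a with a ℕ.≤? w
  ... | no a≰w = trans
    (∑-zero (grid ks) (λ {x} _ → indicator-no (a ℕ.+ wt x ℕ.≟ w) (λ eq → a≰w (subst (a ≤_) eq (ℕ.m≤m+n a (wt x))))))
    (sym (∑-zero (chains ks) (λ {c} _ → indicator-no ((a ℕ.+ wt c ℕ.≤? w) ×-dec (w ℕ.≤? a ℕ.+ (wt c ℕ.+ chainLength ks c)))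
      (λ (low , _) → a≰w (ℕ.≤-trans (ℕ.m≤m+n a (wt c)) low)))))
  ... | yes a≤w = begin
    ∑ (grid ks) (λ x → indicator (a ℕ.+ wt x ℕ.≟ w))
      ≡⟨ ∑-cong (grid ks) (λ {x} _ → indicator-⇔ (a ℕ.+ wt x ℕ.≟ w) (wt x ℕ.≟ w ∸ a)
           (λ eq → trans (sym (ℕ.m+n∸m≡n a (wt x))) (cong (_∸ a) eq))
           (λ eq → trans (cong (a ℕ.+_) eq) a+w′≡w)) ⟩
    ∑ (grid ks) (λ x → indicator (wt x ℕ.≟ w ∸ a))
      ≡⟨ layer-∑ ks (w ∸ a) ⟨
    layer ks (w ∸ a)
      ≡⟨ layer-chains ks ks≥2 (w ∸ a) ⟩
    ∑ (chains ks) (λ c → indicator (inChain? ks c (w ∸ a)))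
      ≡⟨ ∑-cong (chains ks) (λ {c} _ → indicator-⇔ (inChain? ks c (w ∸ a)) ((a ℕ.+ wt c ℕ.≤? w) ×-dec (w ℕ.≤? a ℕ.+ (wt c ℕ.+ chainLength ks c)))
           (λ (low , high) → subst (a ℕ.+ wt c ≤_) a+w′≡w (ℕ.+-monoʳ-≤ a low) ,
             subst (_≤ a ℕ.+ (wt c ℕ.+ chainLength ks c)) a+w′≡w (ℕ.+-monoʳ-≤ a high))
           (λ (low , high) → ℕ.+-cancelˡ-≤ a _ _ (subst (a ℕ.+ wt c ≤_) (sym a+w′≡w) low) ,
             ℕ.+-cancelˡ-≤ a _ _ (subst (_≤ a ℕ.+ (wt c ℕ.+ chainLength ks c)) (sym a+w′≡w) high))) ⟩
    ∑ (chains ks) (λ c → indicator ((a ℕ.+ wt c ℕ.≤? w) ×-dec (w ℕ.≤? a ℕ.+ (wt c ℕ.+ chainLength ks c)))) ∎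
    where
    a+w′≡w : a ℕ.+ (w ∸ a) ≡ w
    a+w′≡w = ℕ.m+[n∸m]≡n a≤w

-- Nesting of the chains and minima of layer sizes

module _ {n} (ks : Vec ℕ n) {c} (c∈ : c ∈ chains ks) where

  inChain-≤N : ∀ {w} → InChain ks c w → w ≤ N ks
  inChain-≤N (_ , high) = ℕ.≤-trans high (subst (wt c ℕ.+ chainLength ks c ≤_) (chain-symmetric ks c∈) (ℕ.m≤n+m _ (wt c)))

  inChain-depth : ∀ {w} → InChain ks c w → wt c ≤ w ⊓ (N ks ∸ w)
  inChain-depth {w} (low , high) =
    ℕ.⊓-glb low (ℕ.m+n≤o⇒m≤o∸n (wt c) (subst (wt c ℕ.+ w ≤_) (chain-symmetric ks c∈) (ℕ.+-monoʳ-≤ (wt c) high)))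

  depth-inChain : ∀ {w} → w ≤ N ks → wt c ≤ w ⊓ (N ks ∸ w) → InChain ks c w
  depth-inChain {w} w≤N deep = ℕ.≤-trans deep (ℕ.m⊓n≤m w (N ks ∸ w)) ,
    ℕ.+-cancelˡ-≤ (wt c) w _ (subst (wt c ℕ.+ w ≤_) (sym (chain-symmetric ks c∈))
      (ℕ.m≤o∸n⇒m+n≤o (wt c) w≤N (ℕ.≤-trans deep (ℕ.m⊓n≤n w (N ks ∸ w)))))

-- A layer at distance δ from the nearer end meets exactly the chains starting at a weight at most δ.
chains-nested : ∀ {n} (ks : Vec ℕ n) t w →
  (∀ {c} → c ∈ chains ks → InChain ks c t → InChain ks c w) ⊎ (∀ {c} → c ∈ chains ks → InChain ks c w → InChain ks c t)
chains-nested ks t w with t ℕ.≤? N ks | w ℕ.≤? N ks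
... | no t≰N | _      = inj₁ (λ c∈ ∈t → contradiction (inChain-≤N ks c∈ ∈t) t≰N)
... | yes _  | no w≰N = inj₂ (λ c∈ ∈w → contradiction (inChain-≤N ks c∈ ∈w) w≰N)
... | yes t≤N | yes w≤N with ℕ.≤-total (t ⊓ (N ks ∸ t)) (w ⊓ (N ks ∸ w))
...   | inj₁ t≤w = inj₁ (λ c∈ ∈t → depth-inChain ks c∈ w≤N (ℕ.≤-trans (inChain-depth ks c∈ ∈t) t≤w))
...   | inj₂ w≤t = inj₂ (λ c∈ ∈w → depth-inChain ks c∈ t≤N (ℕ.≤-trans (inChain-depth ks c∈ ∈w) w≤t))

layers-⊓ : ∀ {n} (ks : Vec ℕ n) → VAll.All (2 ≤_) ks → ∀ t w →
  layer ks t ⊓ layer ks w ≡ ∑ (chains ks) (λ c → indicator (inChain? ks c t ×-dec inChain? ks c w))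
layers-⊓ ks ks≥2 t w = trans (cong₂ _⊓_ (layer-chains ks ks≥2 t) (layer-chains ks ks≥2 w)) (go (chains-nested ks t w))
  where
  go : (∀ {c} → c ∈ chains ks → InChain ks c t → InChain ks c w) ⊎ (∀ {c} → c ∈ chains ks → InChain ks c w → InChain ks c t) →
    ∑ (chains ks) (λ c → indicator (inChain? ks c t)) ⊓ ∑ (chains ks) (λ c → indicator (inChain? ks c w)) ≡
    ∑ (chains ks) (λ c → indicator (inChain? ks c t ×-dec inChain? ks c w))
  go (inj₁ t⇒w) = trans
    (ℕ.m≤n⇒m⊓n≡m (∑-mono (chains ks) (λ {c} c∈ → indicator-mono (inChain? ks c t) (inChain? ks c w) (t⇒w c∈))))
    (∑-cong (chains ks) (λ {c} c∈ → indicator-⇔ (inChain? ks c t) (inChain? ks c t ×-dec inChain? ks c w) (λ ∈t → ∈t , t⇒w c∈ ∈t) proj₁))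
  go (inj₂ w⇒t) = trans
    (ℕ.m≥n⇒m⊓n≡n (∑-mono (chains ks) (λ {c} c∈ → indicator-mono (inChain? ks c w) (inChain? ks c t) (w⇒t c∈))))
    (∑-cong (chains ks) (λ {c} c∈ → indicator-⇔ (inChain? ks c w) (inChain? ks c t ×-dec inChain? ks c w) (λ ∈w → w⇒t c∈ ∈w , ∈w) proj₂))

-- Pairs and ranks within one chain

module _ {P : ℕ → Set} (P? : ∀ x → Dec (P x)) where

  zip-count-zeroˡ : ∀ ts ws → All (¬_ ∘ P) ts → sum (zipWith (λ t w → indicator (P? t ×-dec P? w)) ts ws) ≡ 0
  zip-count-zeroˡ []       ws       _          = refl
  zip-count-zeroˡ (t ∷ ts) []       _          = refl
  zip-count-zeroˡ (t ∷ ts) (w ∷ ws) (¬pt ∷ ¬p) = cong₂ ℕ._+_ (indicator-no (P? t ×-dec P? w) (¬pt ∘ proj₁)) (zip-count-zeroˡ ts ws ¬p)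

  zip-count-zeroʳ : ∀ ts ws → All (¬_ ∘ P) ws → sum (zipWith (λ t w → indicator (P? t ×-dec P? w)) ts ws) ≡ 0
  zip-count-zeroʳ []       ws       _          = refl
  zip-count-zeroʳ (t ∷ ts) []       _          = refl
  zip-count-zeroʳ (t ∷ ts) (w ∷ ws) (¬pw ∷ ¬p) = cong₂ ℕ._+_ (indicator-no (P? t ×-dec P? w) (¬pw ∘ proj₂)) (zip-count-zeroʳ ts ws ¬p)

  count-zero : ∀ xs → All (¬_ ∘ P) xs → ∑ xs (indicator ∘ P?) ≡ 0
  count-zero xs ¬p = ∑-zero xs (λ {x} x∈ → indicator-no (P? x) (All.lookup ¬p x∈))

  -- By the hypotheses on pairs, P holds on an initial segment of each list, and two initial
  -- segments share as many positions as the shorter one has.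
  zip-count : ∀ ts ws → AllPairs (λ t t′ → P t′ → P t) ts → AllPairs (λ w w′ → P w′ → P w) ws →
    sum (zipWith (λ t w → indicator (P? t ×-dec P? w)) ts ws) ≡ ∑ ts (indicator ∘ P?) ⊓ ∑ ws (indicator ∘ P?)
  zip-count []       ws       _ _ = refl
  zip-count (t ∷ ts) []       _ _ = sym (ℕ.⊓-zeroʳ (∑ (t ∷ ts) (indicator ∘ P?)))
  zip-count (t ∷ ts) (w ∷ ws) (tR ∷ ts!) (wR ∷ ws!) = go (P? t) (P? w)
    where
    go : Dec (P t) → Dec (P w) → sum (zipWith (λ t w → indicator (P? t ×-dec P? w)) (t ∷ ts) (w ∷ ws)) ≡
      ∑ (t ∷ ts) (indicator ∘ P?) ⊓ ∑ (w ∷ ws) (indicator ∘ P?)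
    go (no ¬pt) _ = trans (zip-count-zeroˡ (t ∷ ts) (w ∷ ws) (¬pt ∷ All.map (¬pt ∘_) tR))
      (cong (_⊓ ∑ (w ∷ ws) (indicator ∘ P?)) (sym (count-zero (t ∷ ts) (¬pt ∷ All.map (¬pt ∘_) tR))))
    go (yes _) (no ¬pw) = trans (zip-count-zeroʳ (t ∷ ts) (w ∷ ws) (¬pw ∷ All.map (¬pw ∘_) wR))
      (trans (sym (ℕ.⊓-zeroʳ (∑ (t ∷ ts) (indicator ∘ P?))))
        (cong (∑ (t ∷ ts) (indicator ∘ P?) ⊓_) (sym (count-zero (w ∷ ws) (¬pw ∷ All.map (¬pw ∘_) wR)))))
    go (yes pt) (yes pw) = trans
      (cong₂ ℕ._+_ (indicator-yes (P? t ×-dec P? w) (pt , pw)) (zip-count ts ws ts! ws!))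
      (sym (cong₂ _⊓_ (cong (ℕ._+ ∑ ts (indicator ∘ P?)) (indicator-yes (P? t) pt))
        (cong (ℕ._+ ∑ ws (indicator ∘ P?)) (indicator-yes (P? w) pw))))

interval-count : ∀ i j m → m ≤ suc j → ∑< m (λ w → indicator ((i ℕ.≤? w) ×-dec (w ℕ.≤? j))) ≡ m ∸ i
interval-count i j zero    _     = sym (ℕ.0∸n≡0 i)
interval-count i j (suc m) m<1+j = trans (∑<-suc m _) (trans (cong (ℕ._+ indicator ((i ℕ.≤? m) ×-dec (m ℕ.≤? j))) (interval-count i j m (ℕ.<⇒≤ m<1+j))) step)
  where
  step : m ∸ i ℕ.+ indicator ((i ℕ.≤? m) ×-dec (m ℕ.≤? j)) ≡ suc m ∸ i
  step with i ℕ.≤? m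
  ... | yes i≤m = trans (cong (m ∸ i ℕ.+_) (indicator-yes ((i ℕ.≤? m) ×-dec (m ℕ.≤? j)) (i≤m , s≤s⁻¹ m<1+j)))
    (trans (ℕ.+-comm (m ∸ i) 1) (sym (ℕ.+-∸-assoc 1 i≤m)))
  ... | no i≰m = trans (cong₂ ℕ._+_ (ℕ.m≤n⇒m∸n≡0 (ℕ.≰⇒≥ i≰m)) (indicator-no ((i ℕ.≤? m) ×-dec (m ℕ.≤? j)) (i≰m ∘ proj₁)))
    (sym (ℕ.m≤n⇒m∸n≡0 (ℕ.≰⇒> i≰m)))

interval-count-≤ : ∀ i j m → ∑< m (λ w → indicator ((i ℕ.≤? w) ×-dec (w ℕ.≤? j))) ≤ m ∸ i
-- Raising the upper end to m + j can only add weights, and then the exact count applies.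
interval-count-≤ i j m = subst₂ _≤_ (∑-upTo m _) (trans (∑-upTo m _) (interval-count i (m ℕ.+ j) m (ℕ.m≤n⇒m≤1+n (ℕ.m≤m+n m j))))
  (∑-mono (upTo m) (λ {w} _ → indicator-mono ((i ℕ.≤? w) ×-dec (w ℕ.≤? j)) ((i ℕ.≤? w) ×-dec (w ℕ.≤? m ℕ.+ j))
    (λ (low , high) → low , ℕ.≤-trans high (ℕ.m≤n+m j m))))

reverse-filter : ∀ {A : Set} {P : A → Set} (P? : ∀ x → Dec (P x)) xs → reverse (filter P? xs) ≡ filter P? (reverse xs)
reverse-filter P? []       = refl
reverse-filter P? (x ∷ xs) = sym (begin
  filter P? (reverse (x ∷ xs))                        ≡⟨ cong (filter P?) (List.unfold-reverse x xs) ⟩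
  filter P? (reverse xs ++ x ∷ [])                    ≡⟨ List.filter-++ P? (reverse xs) (x ∷ []) ⟩
  filter P? (reverse xs) ++ filter P? (x ∷ [])        ≡⟨ cong (_++ filter P? (x ∷ [])) (reverse-filter P? xs) ⟨
  reverse (filter P? xs) ++ filter P? (x ∷ [])        ≡⟨ last-step ⟩
  reverse (filter P? (x ∷ xs))                        ∎)
  where
  last-step : reverse (filter P? xs) ++ filter P? (x ∷ []) ≡ reverse (filter P? (x ∷ xs))
  last-step with does (P? x)
  ... | true  = sym (List.unfold-reverse x (filter P? xs))
  ... | false = List.++-identityʳ (reverse (filter P? xs))

tList-downFrom : ∀ d E → tList d E ≡ filterᵇ (λ t → not (t ∈ᵇ E)) (downFrom (suc d))
tList-downFrom d E = trans (reverse-filter (λ t → T? (not (t ∈ᵇ E))) (upTo (suc d)))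
  (cong (filterᵇ (λ t → not (t ∈ᵇ E))) (List.reverse-upTo (suc d)))

∑-reverse : ∀ {A : Set} (xs : List A) f → ∑ (reverse xs) f ≡ ∑ xs f
∑-reverse []       f = refl
∑-reverse (x ∷ xs) f = begin
  ∑ (reverse (x ∷ xs)) f              ≡⟨ cong (λ ys → ∑ ys f) (List.unfold-reverse x xs) ⟩
  ∑ (reverse xs ++ x ∷ []) f          ≡⟨ ∑-++ (reverse xs) (x ∷ []) f ⟩
  ∑ (reverse xs) f ℕ.+ (f x ℕ.+ 0)    ≡⟨ cong₂ ℕ._+_ (∑-reverse xs f) (ℕ.+-identityʳ (f x)) ⟩
  ∑ xs f ℕ.+ f x                      ≡⟨ ℕ.+-comm (∑ xs f) (f x) ⟩
  f x ℕ.+ ∑ xs f                      ∎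

capList-tList-∑ : ∀ d E f → ∑ (capList d E) f ℕ.+ ∑ (tList d E) f ≡ ∑< (suc d) f
capList-tList-∑ d E f = trans
  (cong (∑ (capList d E) f ℕ.+_) (∑-reverse (filterᵇ (λ t → not (t ∈ᵇ E)) (upTo (suc d))) f))
  (trans (∑-filterᵇ-split (_∈ᵇ E) (upTo (suc d)) f) (∑-upTo (suc d) f))

module _ {n} (ks : Vec ℕ n) (d : ℕ) (E : List ℕ) (c : Vec ℕ n) where

  private
    i j : ℕ
    i = wt c
    j = wt c ℕ.+ chainLength ks c
    meets : ℕ → ℕ
    meets w = indicator (inChain? ks c w)
    cap ts ws : List ℕ
    cap = capList d E
    ts  = tList d E
    ws  = wList (N ks) d E
    pairs : ℕ
    pairs = sum (zipWith (λ t w → indicator (inChain? ks c t ×-dec inChain? ks c w)) ts ws)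

    chainRank-⊓ : chainRank ks d E c ≡ (suc d ∸ i) ⊓ (∑ cap meets ℕ.+ ∑ ws meets)
    chainRank-⊓ = cong ((suc d ∸ i) ⊓_) (trans (length-filter-∑ (inChain? ks c) (cap ++ ws)) (∑-++ cap ws meets))

    ∈-tList⁻ : ∀ {t} → t ∈ ts → t ≤ d
    ∈-tList⁻ {t} t∈ = s≤s⁻¹ (∈-downFrom⁻ (proj₁ (∈-filter⁻ (λ t → T? (not (t ∈ᵇ E))) {xs = downFrom (suc d)} (subst (t ∈_) (tList-downFrom d E) t∈))))

    -- No weight up to d is on the chain, so every pair fails at its t, and the degree bound leaves
    -- rank 0.
    starting-above : d < i → chainRank ks d E c ≡ ∑ cap meets ℕ.+ pairs
    starting-above d<i = begin
      chainRank ks d E c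
        ≡⟨ cong (_⊓ length (chainLevels ks d E c)) (ℕ.m≤n⇒m∸n≡0 d<i) ⟩
      0
        ≡⟨ cong₂ ℕ._+_ (count-zero (inChain? ks c) cap (All.tabulate λ w∈ → below (proj₁ (∈-capList⁻ {d} {E} w∈))))
             (zip-count-zeroˡ (inChain? ks c) ts ws (All.tabulate λ t∈ → below (∈-tList⁻ t∈))) ⟨
      ∑ cap meets ℕ.+ pairs ∎
      where
      below : ∀ {w} → w ≤ d → ¬ InChain ks c w
      below w≤d (i≤w , _) = ℕ.<⇒≱ d<i (ℕ.≤-trans i≤w w≤d)

    -- Every pair fails at its w, and the weights of E on the chain are all at most d, hence no more
    -- than the d + 1 - i that the degree bound allows.
    ending-below : j ≤ d → chainRank ks d E c ≡ ∑ cap meets ℕ.+ pairs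
    ending-below j≤d = begin
      chainRank ks d E c
        ≡⟨ chainRank-⊓ ⟩
      (suc d ∸ i) ⊓ (∑ cap meets ℕ.+ ∑ ws meets)
        ≡⟨ cong (λ k → (suc d ∸ i) ⊓ (∑ cap meets ℕ.+ k)) (count-zero (inChain? ks c) ws above) ⟩
      (suc d ∸ i) ⊓ (∑ cap meets ℕ.+ 0)
        ≡⟨ cong ((suc d ∸ i) ⊓_) (ℕ.+-identityʳ (∑ cap meets)) ⟩
      (suc d ∸ i) ⊓ ∑ cap meets
        ≡⟨ ℕ.m≥n⇒m⊓n≡n (ℕ.≤-trans (ℕ.m≤m+n (∑ cap meets) (∑ ts meets))
             (subst (_≤ suc d ∸ i) (sym (capList-tList-∑ d E meets)) (interval-count-≤ i j (suc d)))) ⟩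
      ∑ cap meets
        ≡⟨ ℕ.+-identityʳ (∑ cap meets) ⟨
      ∑ cap meets ℕ.+ 0
        ≡⟨ cong (∑ cap meets ℕ.+_) (zip-count-zeroʳ (inChain? ks c) ts ws above) ⟨
      ∑ cap meets ℕ.+ pairs ∎
      where
      above : All (¬_ ∘ InChain ks c) ws
      above = All.tabulate λ w∈ (_ , w≤j) → ℕ.<⇒≱ (proj₁ (∈-wList⁻ {N ks} {d} {E} w∈)) (ℕ.≤-trans w≤j j≤d)

    -- All weights from i to d are on the chain, so d + 1 - i counts those in E and those outside E.
    -- The common summand `∑ cap meets` comes out of the minimum, and `zip-count` turns what remains
    -- into the number of pairs.
    crossing : i ≤ d → d < j → chainRank ks d E c ≡ ∑ cap meets ℕ.+ pairs
    crossing i≤d d<j = begin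
      chainRank ks d E c
        ≡⟨ chainRank-⊓ ⟩
      (suc d ∸ i) ⊓ (∑ cap meets ℕ.+ ∑ ws meets)
        ≡⟨ cong (_⊓ (∑ cap meets ℕ.+ ∑ ws meets)) (trans (sym (interval-count i j (suc d) (ℕ.m≤n⇒m≤1+n d<j))) (sym (capList-tList-∑ d E meets))) ⟩
      (∑ cap meets ℕ.+ ∑ ts meets) ⊓ (∑ cap meets ℕ.+ ∑ ws meets)
        ≡⟨ ℕ.+-distribˡ-⊓ (∑ cap meets) (∑ ts meets) (∑ ws meets) ⟨
      ∑ cap meets ℕ.+ ∑ ts meets ⊓ ∑ ws meets
        ≡⟨ cong (∑ cap meets ℕ.+_) (zip-count (inChain? ks c) ts ws ts-closed ws-closed) ⟨
      ∑ cap meets ℕ.+ pairs ∎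
      where
      Closed : ℕ → ℕ → Set
      Closed v v′ = InChain ks c v′ → InChain ks c v
      -- Both lists move away from d, and the chain is an interval containing d and d + 1, so a
      -- listed weight on the chain forces all earlier ones onto it.
      ts-closed : AllPairs Closed ts
      ts-closed = subst (AllPairs Closed) (sym (tList-downFrom d E)) (AllPairs.filter⁺ (λ t → T? (not (t ∈ᵇ E)))
        (AllPairs.applyDownFrom⁺₁ id (suc d) (λ t′<t t≤d (i≤t′ , _) →
          ℕ.≤-trans i≤t′ (ℕ.<⇒≤ t′<t) , ℕ.≤-trans (s≤s⁻¹ t≤d) (ℕ.<⇒≤ d<j))))
      ws-closed : AllPairs Closed ws
      ws-closed = AllPairs.filter⁺ (T? ∘ (_∈ᵇ E))
        (AllPairs.applyUpTo⁺₁ (λ k → suc d ℕ.+ k) (N ks ∸ d) (λ {k} k<k′ _ (_ , w′≤j) →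
          ℕ.≤-trans i≤d (ℕ.m≤n⇒m≤1+n (ℕ.m≤m+n d k)) , ℕ.≤-trans (ℕ.+-monoʳ-≤ (suc d) (ℕ.<⇒≤ k<k′)) w′≤j))

  chainRank-count : chainRank ks d E c ≡ ∑ cap meets ℕ.+ pairs
  chainRank-count with i ℕ.≤? d | j ℕ.≤? d
  ... | no i≰d  | _       = starting-above (ℕ.≰⇒> i≰d)
  ... | yes _   | yes j≤d = ending-below j≤d
  ... | yes i≤d | no j≰d  = crossing i≤d (ℕ.≰⇒> j≰d)

-- Layer sizes and their minima are both numbers of chains, so after exchanging the sums the
-- identity holds for one chain at a time.
chainRank-∑ : ∀ {n} (ks : Vec ℕ n) → VAll.All (2 ≤_) ks → ∀ d E → ∑ (chains ks) (chainRank ks d E) ≡ rhs ks d E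
chainRank-∑ ks ks≥2 d E = begin
  ∑ (chains ks) (chainRank ks d E)
    ≡⟨ ∑-cong (chains ks) (λ {c} _ → chainRank-count ks d E c) ⟩
  ∑ (chains ks) (λ c → ∑ cap (λ w → indicator (inChain? ks c w)) ℕ.+ sum (zipWith (λ t w → both t w c) ts ws))
    ≡⟨ ∑-+ (chains ks) _ _ ⟩
  ∑ (chains ks) (λ c → ∑ cap (λ w → indicator (inChain? ks c w))) ℕ.+ ∑ (chains ks) (λ c → sum (zipWith (λ t w → both t w c) ts ws))
    ≡⟨ cong₂ ℕ._+_ (∑-swap (chains ks) cap _) (sym (∑-zipWith ts ws (chains ks) both)) ⟩
  ∑ cap (λ w → ∑ (chains ks) (λ c → indicator (inChain? ks c w))) ℕ.+ sum (zipWith (λ t w → ∑ (chains ks) (both t w)) ts ws)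
    ≡⟨ cong₂ ℕ._+_ (∑-cong cap (λ {w} _ → sym (layer-chains ks ks≥2 w)))
         (cong sum (List.zipWith-cong (λ t w → sym (layers-⊓ ks ks≥2 t w)) ts ws)) ⟩
  rhs ks d E ∎
  where
  cap ts ws : List ℕ
  cap = capList d E
  ts  = tList d E
  ws  = wList (N ks) d E
  both : ℕ → ℕ → Vec ℕ _ → ℕ
  both t w c = indicator (inChain? ks c t ×-dec inChain? ks c w)

theorem1p5 : (n : ℕ) (ks : Vec ℕ n) → VAll.All (2 ≤_) ks →
    (d : ℕ) → d ≤ N ks → (E : List ℕ) → All (_≤ N ks) E →
    HilbertDim d (InLayers ks E) (rhs ks d E)
theorem1p5 n ks ks≥2 d d≤N E E≤N =
  subst (HilbertDim d (InLayers ks E)) (chainRank-∑ ks ks≥2 d E) (hilbertDim-chains ks d E ks≥2)
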